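{- For every positive equivalence relation $\eta$, there is an $\eta$-family which is behaviourally correctly learnable but not vacillatorily learnable.
   Context: A positive equivalence relation is an equivalence relation $\eta$ on $\mathbb{N}$ that is recursively enumerable (as a set of pairs) and has infinitely many equivalence classes. A set is $\eta$-closed if it is a union of $\eta$-equivalence classes. An $\eta$-family is an infinite family of $\eta$-closed sets possessing a uniformly r.e. one-one numbering $B_0,B_1,\dots$ (i.e. $\{\langle k,x\rangle:x\in B_k\}$ is r.e. and $B_i\neq B_j$ for $i\ne j$). $W_0,W_1,\dots$ is a fixed acceptable numbering of the r.e. sets. A text for $L$ is a total $T:\mathbb N\to\mathbb N\cup\{\#\}$ whose range minus $\{\#\}$ is $L$; $T[n]$ is its initial segment of length $n$. A learner is a recursive function $M$ from finite sequences over $\mathbb N\cup\{\#\}$ to $\mathbb N\cup\{?\}$; an output $e$ is interpreted as the hypothesis "the $\eta$-closure of $W_e$". A family $\mathcal C$ is behaviourally correctly learnable if some $M$, on every text $T$ for every $L\in\mathcal C$, outputs for almost all $n$ an index $M(T[n])$ whose hypothesis equals $L$; it is vacillatorily learnable if some $M$ behaviourally correctly learns $\mathcal C$ and, in addition, on every text $T$ for every $L\in\mathcal C$ the set $\{M(T[n]):n\ge 1\}$ is finite. -}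

module Defs where

open import Level using (0ℓ)
open import Data.Nat using (ℕ; zero; suc; _+_; _*_; _<_; _≤_)
open import Data.Maybe using (Maybe; just; nothing)
open import Data.List using (List; []; _∷_; map; upTo)
open import Data.List.Relation.Unary.All using (All)
open import Data.List.Membership.Propositional using (_∈_)
open import Data.Product using (Σ; ∃; _×_; _,_)
open import Function using (_⇔_)
open import Relation.Nullary using (¬_)
open import Relation.Binary.PropositionalEquality using (_≡_; _≢_)
open import Relation.Binary.Structures using (IsEquivalence)

-- Cantor pairing  ⟨a,b⟩ = T(a+b) + b  (a bijection ℕ×ℕ → ℕ)

tri : ℕ → ℕ
tri zero    = zero
tri (suc n) = suc n + tri n

pair : ℕ → ℕ → ℕ
pair a b = tri (a + b) + b

-- A Gödel numbering of (unary, pairing-based) partial recursive functions.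
-- Basic functions: zero, successor, identity, left/right unpairing;
-- operations: composition, pairing, primitive recursion, minimisation.
-- Numbers which are not codes of the listed forms denote the empty function.

cZ cS cI cL cR : ℕ
cZ = 0
cS = 1
cI = 2
cL = 3
cR = 4

cComp cPair cRec : ℕ → ℕ → ℕ
cComp f g = 5 + 5 * pair f g
cPair f g = 6 + 5 * pair f g
cRec  f g = 7 + 5 * pair f g

cMu : ℕ → ℕ
cMu f = 8 + 5 * f

data Eval : ℕ → ℕ → ℕ → Set where
  ev-Z    : ∀ {x} → Eval cZ x 0
  ev-S    : ∀ {x} → Eval cS x (suc x)
  ev-I    : ∀ {x} → Eval cI x x
  ev-L    : ∀ {a b} → Eval cL (pair a b) a
  ev-R    : ∀ {a b} → Eval cR (pair a b) b
  ev-comp : ∀ {f g x y z} → Eval g x y → Eval f y z → Eval (cComp f g) x z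
  ev-pair : ∀ {f g x y z} → Eval f x y → Eval g x z → Eval (cPair f g) x (pair y z)
  ev-rec0 : ∀ {f g x y} → Eval f x y → Eval (cRec f g) (pair x 0) y
  ev-recS : ∀ {f g x n y z} → Eval (cRec f g) (pair x n) y →
            Eval g (pair x (pair n y)) z → Eval (cRec f g) (pair x (suc n)) z
  ev-mu   : ∀ {f x y} → Eval f (pair x y) 0 →
            (∀ z → z < y → Σ ℕ (λ v → Eval f (pair x z) (suc v))) →
            Eval (cMu f) x y

-- The fixed acceptable numbering of r.e. sets: W_e = dom φ_e
W : ℕ → ℕ → Set
W e x = Σ ℕ (λ y → Eval e x y)

IsRE : (ℕ → Set) → Set
IsRE A = Σ ℕ (λ e → ∀ x → A x ⇔ W e x)

InfinitelyManyClasses : (ℕ → ℕ → Set) → Set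
InfinitelyManyClasses η = (l : List ℕ) → Σ ℕ (λ x → All (λ y → ¬ η x y) l)

record Positive (η : ℕ → ℕ → Set) : Set where
  field
    isEquivalence : IsEquivalence η
    re            : IsRE (λ z → Σ ℕ (λ x → Σ ℕ (λ y → z ≡ pair x y × η x y)))
    infClasses    : InfinitelyManyClasses η

EtaClosed : (ℕ → ℕ → Set) → (ℕ → Set) → Set
EtaClosed η A = ∀ x y → η x y → A x → A y

SameSet : (ℕ → Set) → (ℕ → Set) → Set
SameSet A B = ∀ x → A x ⇔ B x

record EtaFamily (η : ℕ → ℕ → Set) (B : ℕ → ℕ → Set) : Set where
  field
    closed    : ∀ k → EtaClosed η (B k)
    uniformRE : IsRE (λ z → Σ ℕ (λ k → Σ ℕ (λ x → z ≡ pair k x × B k x)))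
    oneOne    : ∀ i j → i ≢ j → ¬ SameSet (B i) (B j)

-- # is represented by nothing
Text : Set
Text = ℕ → Maybe ℕ

IsTextFor : Text → (ℕ → Set) → Set
IsTextFor T L = ∀ x → L x ⇔ Σ ℕ (λ n → T n ≡ just x)

initSeg : Text → ℕ → List (Maybe ℕ)
initSeg T n = map T (upTo n)

encMaybe : Maybe ℕ → ℕ
encMaybe nothing  = 0
encMaybe (just x) = suc x

codeSeq : List (Maybe ℕ) → ℕ
codeSeq []      = 0
codeSeq (a ∷ s) = suc (pair (encMaybe a) (codeSeq s))

-- a learner: a recursive function from finite sequences to ℕ ∪ {?}
-- (? is represented by nothing)
record Learner : Set where
  field
    run        : List (Maybe ℕ) → Maybe ℕ
    computable : Σ ℕ (λ m → ∀ s → Eval m (codeSeq s) (encMaybe (run s)))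
open Learner public

-- hypothesis e denotes the η-closure of W_e
closure : (ℕ → ℕ → Set) → (ℕ → Set) → ℕ → Set
closure η A x = Σ ℕ (λ y → A y × η x y)

CorrectAt : (ℕ → ℕ → Set) → (ℕ → Set) → Maybe ℕ → Set
CorrectAt η L o = Σ ℕ (λ e → o ≡ just e × SameSet (closure η (W e)) L)

BCLearns : (ℕ → ℕ → Set) → Learner → (ℕ → ℕ → Set) → Set
BCLearns η M B = ∀ i (T : Text) → IsTextFor T (B i) →
  Σ ℕ (λ n₀ → ∀ n → n₀ ≤ n → CorrectAt η (B i) (run M (initSeg T n)))

BCLearnable : (ℕ → ℕ → Set) → (ℕ → ℕ → Set) → Set
BCLearnable η B = Σ Learner (λ M → BCLearns η M B)

VacLearnable : (ℕ → ℕ → Set) → (ℕ → ℕ → Set) → Set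
VacLearnable η B = Σ Learner (λ M → BCLearns η M B ×
  (∀ i (T : Text) → IsTextFor T (B i) →
     Σ (List (Maybe ℕ)) (λ l → ∀ n → 1 ≤ n → run M (initSeg T n) ∈ l)))

{-# OPTIONS --safe #-}
-- Write [x] for the η-class of x. Let F consist of all [x] ∪ [y]. On a finite union of classes the content of a
-- text is eventually a correct hypothesis, so F is behaviourally correctly learnable, and we are done unless some M
-- learns it vacillatorily. In that case let s lock M on a class [w], so that M issues only hypotheses bounded by
-- the code of s on extensions of s over [w]. The set V of all x for which M exceeds this bound on some
-- extension of s over [w] ∪ [x] is Σ₁, η-closed and disjoint from [w]; and it meets all but finitely many classes,
-- because the finitely many hypotheses below the bound are correct for finitely many of the sets [w] ∪ [x] only.
-- Thus from w a Σ₁ set avoiding [w], with infinitely many classes, is found in the limit.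
--
-- The second family B has, for every j, the set L j consisting of the first 2j classes and of as much of V
-- (for w the representative of rank 2j) as is released by the stages s at which the j-th partial recursive function
-- is 0 at (j , s), and, if L j is thereby finitely generated, also all L j ∪ [x]. As the first class missing in the set
-- is the one of rank 2j, a learner finds j in the limit and may conjecture L j together with the content. Indices
-- based on wrong guesses are redirected to initial segments of the classes, of odd length.
-- If N learns B vacillatorily, let the e-th function be 0 at (j , s) when at stage s the current guess for a
-- locking sequence of N on L j is seen to be exceeded on L j ∪ [x] for some x ∈ V. For j = e, infinitely many zeros would
-- give V ⊆ L e and contradict the locking, while finitely many zeros make L e finitely generated, and the sets
-- L e ∪ [x] again force N to exceed the bound, which gives zeros at all large stages.

module Submission where

open import Defs
open import Level using (0ℓ)
open import Axiom.ExcludedMiddle using (ExcludedMiddle)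
open import Data.Nat
open import Data.Nat.Properties
open import Data.Product hiding (map)
open import Data.Product.Function.NonDependent.Propositional using (_×-⇔_)
open import Data.Sum using (_⊎_; inj₁; inj₂)
open import Data.Sum.Function.Propositional using (_⊎-⇔_)
open import Data.Empty using (⊥)
open import Data.Unit using (⊤; tt)
open import Data.Maybe using (Maybe; just; nothing)
open import Data.Fin using (Fin; zero; suc; toℕ; fromℕ<)
open import Data.Fin.Properties using (pigeonhole; fromℕ<-injective)
open import Data.List using (List; []; _∷_; _++_; [_]; map; drop; length; upTo; applyUpTo)
open import Data.List.Properties using (map-upTo; ++-assoc; length-++; length-applyUpTo)
import Data.List.Properties as List
open import Data.List.Membership.Propositional using (_∈_)
open import Data.List.Membership.Propositional.Properties
  using (∈-++⁺ˡ; ∈-++⁺ʳ; ∈-++⁻; ∈-map⁺; ∈-map⁻; ∈-applyUpTo⁺; ∈-applyUpTo⁻; ∈-upTo⁺; ∈-upTo⁻)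
import Data.List.Relation.Unary.All as All
open import Data.List.Relation.Unary.Any using (here; there)
open import Data.Vec using (Vec; []; _∷_; lookup; tabulate)
open import Data.Vec.Properties using (tabulate∘lookup)
open import Function using (_⇔_; mk⇔; Equivalence; id; flip; _∘_)
open import Function.Construct.Composition using (_⇔-∘_)
open import Function.Construct.Identity using (⇔-id)
open import Function.Construct.Symmetry using (⇔-sym)
open import Relation.Nullary using (¬_; Dec; yes; no; contradiction)
open import Relation.Nullary.Decidable using (decidable-stable) renaming (map to map?)
open import Relation.Unary using (Decidable)
open import Relation.Binary.Definitions using (tri<; tri≈; tri>)
open import Relation.Binary.PropositionalEquality hiding ([_]; isEquivalence)
open import Relation.Binary.Structures using (IsEquivalence)
open Equivalence using (to; from)

-- Pairing and computable functions

-- The step to the next pair in the Cantor enumeration: along an antidiagonal, and from its end to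
-- the start of the next one.
unpairSuc : ℕ × ℕ → ℕ × ℕ
unpairSuc (zero  , b) = suc b , 0
unpairSuc (suc a , b) = a , suc b

unpair : ℕ → ℕ × ℕ
unpair zero    = 0 , 0
unpair (suc n) = unpairSuc (unpair n)

π₁ π₂ : ℕ → ℕ
π₁ n = proj₁ (unpair n)
π₂ n = proj₂ (unpair n)

pair-zero : ∀ a → pair (suc a) 0 ≡ suc (pair 0 a)
pair-zero a rewrite +-identityʳ a | +-identityʳ (a + tri a) = cong suc (+-comm a (tri a))

pair-suc : ∀ a b → pair a (suc b) ≡ suc (pair (suc a) b)
pair-suc a b rewrite +-suc a b | +-suc (a + b + tri (a + b)) b = refl

uncurry-pair-unpairSuc : ∀ p → uncurry pair (unpairSuc p) ≡ suc (uncurry pair p)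
uncurry-pair-unpairSuc (zero  , b) = pair-zero b
uncurry-pair-unpairSuc (suc a , b) = pair-suc a b

pair-unpair : ∀ n → pair (π₁ n) (π₂ n) ≡ n
pair-unpair zero    = refl
pair-unpair (suc n) = trans (uncurry-pair-unpairSuc (unpair n)) (cong suc (pair-unpair n))

-- Induction on the value `n`, because neither component decreases structurally: the predecessor of
-- `pair (suc a) 0` is `pair 0 a`.
unpair-pair′ : ∀ n a b → pair a b ≡ n → unpair n ≡ (a , b)
unpair-pair′ zero zero zero eq = refl
unpair-pair′ zero zero (suc b) ()
unpair-pair′ zero (suc a) b ()
unpair-pair′ (suc n) a (suc b) eq =
  cong unpairSuc (unpair-pair′ n (suc a) b (suc-injective (trans (sym (pair-suc a b)) eq)))
unpair-pair′ (suc n) (suc a) zero eq =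
  cong unpairSuc (unpair-pair′ n 0 a (suc-injective (trans (sym (pair-zero a)) eq)))

unpair-pair : ∀ a b → unpair (pair a b) ≡ (a , b)
unpair-pair a b = unpair-pair′ (pair a b) a b refl

π₁-pair : ∀ a b → π₁ (pair a b) ≡ a
π₁-pair a b = cong proj₁ (unpair-pair a b)

π₂-pair : ∀ a b → π₂ (pair a b) ≡ b
π₂-pair a b = cong proj₂ (unpair-pair a b)

pair-injectiveˡ : ∀ {a b c d} → pair a b ≡ pair c d → a ≡ c
pair-injectiveˡ {a} {b} {c} {d} eq = trans (sym (π₁-pair a b)) (trans (cong π₁ eq) (π₁-pair c d))

pair-injectiveʳ : ∀ {a b c d} → pair a b ≡ pair c d → b ≡ d
pair-injectiveʳ {a} {b} {c} {d} eq = trans (sym (π₂-pair a b)) (trans (cong π₂ eq) (π₂-pair c d))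

n≤tri : ∀ n → n ≤ tri n
n≤tri zero    = z≤n
n≤tri (suc n) = m≤m+n (suc n) (tri n)

m+n≤pair : ∀ m n → m + n ≤ pair m n
m+n≤pair m n = ≤-trans (n≤tri (m + n)) (m≤m+n (tri (m + n)) n)

m≤pair : ∀ m n → m ≤ pair m n
m≤pair m n = ≤-trans (m≤m+n m n) (m+n≤pair m n)

n≤pair : ∀ m n → n ≤ pair m n
n≤pair m n = ≤-trans (m≤n+m n m) (m+n≤pair m n)

π₁≤ : ∀ n → π₁ n ≤ n
π₁≤ n = subst (π₁ n ≤_) (pair-unpair n) (m≤pair (π₁ n) (π₂ n))

π₂≤ : ∀ n → π₂ n ≤ n
π₂≤ n = subst (π₂ n ≤_) (pair-unpair n) (n≤pair (π₁ n) (π₂ n))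

Fn₁ : (ℕ → ℕ) → Set
Fn₁ f = Σ ℕ λ e → ∀ x → Eval e x (f x)

Fn₂ : (ℕ → ℕ → ℕ) → Set
Fn₂ f = Σ ℕ λ e → ∀ x y → Eval e (pair x y) (f x y)

idᶠ : Fn₁ (λ x → x)
idᶠ = cI , λ _ → ev-I

sucᶠ : Fn₁ suc
sucᶠ = cS , λ _ → ev-S

constCode : ℕ → ℕ
constCode zero    = cZ
constCode (suc k) = cComp cS (constCode k)

eval-constCode : ∀ k x → Eval (constCode k) x k
eval-constCode zero    x = ev-Z
eval-constCode (suc k) x = ev-comp (eval-constCode k x) ev-S

constᶠ : ∀ k → Fn₁ (λ _ → k)
constᶠ k = constCode k , eval-constCode k

π₁ᶠ : Fn₁ π₁
π₁ᶠ = cL , λ x → subst (λ z → Eval cL z (π₁ x)) (pair-unpair x) (ev-L {b = π₂ x})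

π₂ᶠ : Fn₁ π₂
π₂ᶠ = cR , λ x → subst (λ z → Eval cR z (π₂ x)) (pair-unpair x) (ev-R {a = π₁ x})

infixr 9 _∘ᶠ_
_∘ᶠ_ : ∀ {f g} → Fn₁ f → Fn₁ g → Fn₁ (λ x → f (g x))
(e , p) ∘ᶠ (d , q) = cComp e d , λ x → ev-comp (q x) (p _)

pairᶠ : ∀ {f g} → Fn₁ f → Fn₁ g → Fn₁ (λ x → pair (f x) (g x))
pairᶠ (e , p) (d , q) = cPair e d , λ x → ev-pair (p x) (q x)

ap₂ᶠ : ∀ {h f g} → Fn₂ h → Fn₁ f → Fn₁ g → Fn₁ (λ x → h (f x) (g x))
ap₂ᶠ (e , p) (d , q) (d′ , q′) = cComp e (cPair d d′) , λ x → ev-comp (ev-pair (q x) (q′ x)) (p _ _)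

curryᶠ : ∀ {f : ℕ → ℕ → ℕ} → Fn₁ (λ z → f (π₁ z) (π₂ z)) → Fn₂ f
curryᶠ {f} (e , p) = e , λ x y →
  subst (Eval e (pair x y)) (cong₂ f (π₁-pair x y) (π₂-pair x y)) (p (pair x y))

-- `h` is passed in with its recursion equations, so that functions defined elsewhere, such as `_+_`
-- and `_∸_`, receive codes.
recᶠ : ∀ {f : ℕ → ℕ} {g : ℕ → ℕ → ℕ → ℕ} (h : ℕ → ℕ → ℕ) → Fn₁ f →
       Fn₁ (λ z → g (π₁ z) (π₁ (π₂ z)) (π₂ (π₂ z))) →
       (∀ x → h x 0 ≡ f x) → (∀ x n → h x (suc n) ≡ g x n (h x n)) → Fn₂ h
recᶠ {f} {g} h (e , p) (d , q) h0 hS = cRec e d , go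
  where
  go : ∀ x n → Eval (cRec e d) (pair x n) (h x n)
  go x zero    = subst (Eval _ _) (sym (h0 x)) (ev-rec0 {f = e} {g = d} {x = x} (p x))
  go x (suc n) = subst (Eval _ _)
    (trans (cong₂ (λ a b → g a (π₁ b) (π₂ b)) (π₁-pair x (pair n (h x n))) (π₂-pair x (pair n (h x n))))
    (trans (cong₂ (g x) (π₁-pair n (h x n)) (π₂-pair n (h x n))) (sym (hS x n))))
    (ev-recS {f = e} {g = d} {x = x} {n = n} (go x n) (q _))

+ᶠ : Fn₂ _+_
+ᶠ = recᶠ {g = λ _ _ y → suc y} _+_ idᶠ (sucᶠ ∘ᶠ π₂ᶠ ∘ᶠ π₂ᶠ) +-identityʳ +-suc

*ᶠ : Fn₂ _*_
*ᶠ = recᶠ {g = λ x _ y → x + y} _*_ (constᶠ 0) (ap₂ᶠ +ᶠ π₁ᶠ (π₂ᶠ ∘ᶠ π₂ᶠ)) *-zeroʳ *-suc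

predᶠ : Fn₁ pred
predᶠ = ap₂ᶠ (recᶠ {g = λ _ n _ → n} (λ _ n → pred n) (constᶠ 0) (π₁ᶠ ∘ᶠ π₂ᶠ) (λ _ → refl) (λ _ _ → refl)) idᶠ idᶠ

∸ᶠ : Fn₂ _∸_
∸ᶠ = recᶠ {g = λ _ _ y → pred y} _∸_ idᶠ (predᶠ ∘ᶠ π₂ᶠ ∘ᶠ π₂ᶠ) (λ _ → refl) (λ x n → sym (pred[m∸n]≡m∸[1+n] x n))

foldTo : (ℕ → ℕ → ℕ) → ℕ → ℕ → (ℕ → ℕ) → ℕ
foldTo _∙_ u zero    f = u
foldTo _∙_ u (suc n) f = foldTo _∙_ u n f ∙ f n

module _ {_∙_ : ℕ → ℕ → ℕ} (∙ᶠ : Fn₂ _∙_) (u e : ℕ) where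
  private
    lastCode nextCode stepCode : ℕ
    lastCode = cComp cR cR
    nextCode = cComp e (cPair (cComp cL cR) cL)
    stepCode = cComp (proj₁ ∙ᶠ) (cPair lastCode nextCode)

  foldCode : ℕ
  foldCode = cRec (constCode u) stepCode

  -- The index stands in front of the parameter, as in `pair k X`, because `enc` codes an
  -- environment extended by a bound variable in this way. Bounded quantifiers can then be computed
  -- by folding.
  eval-foldCode : ∀ {X f} → (∀ k → Eval e (pair k X) (f k)) →
                  ∀ n → Eval foldCode (pair X n) (foldTo _∙_ u n f)
  eval-foldCode {X} h zero        = ev-rec0 {constCode u} {stepCode} {X} (eval-constCode u X)
  eval-foldCode {X} {f} h (suc n) = ev-recS {constCode u} {stepCode} {X} {n} (eval-foldCode h n)
    (ev-comp {proj₁ ∙ᶠ} {cPair lastCode nextCode}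
      (ev-pair {lastCode} {nextCode}
        (ev-comp {cR} {cR} (ev-R {X}) (ev-R {n}))
        (ev-comp {e} {cPair (cComp cL cR) cL}
          (ev-pair {cComp cL cR} {cL} (ev-comp {cL} {cR} (ev-R {X}) (ev-L {n} {y})) (ev-L {X} {pair n y}))
          (h n)))
      (proj₂ ∙ᶠ y (f n)))
    where
    y = foldTo _∙_ u n f

-- Arithmetical formulas and their codes

data Tm (n : ℕ) : Set where
  var : Fin n → Tm n
  lit : ℕ → Tm n
  ap₁ : ∀ {f} → Fn₁ f → Tm n → Tm n
  ap₂ : ∀ {f} → Fn₂ f → Tm n → Tm n → Tm n

infix  7 _==_ _<<_
infixr 6 _∧_ _∧ˢ_
infixr 5 _∨_ _∨ˢ_

data Fm : ℕ → Set
data Sg : ℕ → Set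

-- Fm: decidable formulas. Sg: Σ₁ formulas; `at t φ ts` is the decidable approximation of φ at stage t,
-- in which unbounded quantifiers are bounded by t.
data Fm where
  _==_ _<<_ : ∀ {n} → Tm n → Tm n → Fm n
  _∧_ _∨_   : ∀ {n} → Fm n → Fm n → Fm n
  neg       : ∀ {n} → Fm n → Fm n
  all ex    : ∀ {n} → Tm n → Fm (suc n) → Fm n
  sub       : ∀ {m n} → Fm m → Vec (Tm n) m → Fm n
  at        : ∀ {m n} → Tm n → Sg m → Vec (Tm n) m → Fm n

data Sg where
  dec       : ∀ {n} → Fm n → Sg n
  _∧ˢ_ _∨ˢ_ : ∀ {n} → Sg n → Sg n → Sg n
  exˢ       : ∀ {n} → Sg (suc n) → Sg n
  allˢ      : ∀ {n} → Tm n → Sg (suc n) → Sg n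
  subˢ      : ∀ {m n} → Sg m → Vec (Tm n) m → Sg n

⟦_⟧ᵗ : ∀ {n} → Tm n → Vec ℕ n → ℕ
⟦ var i ⟧ᵗ v           = lookup v i
⟦ lit k ⟧ᵗ v           = k
⟦ ap₁ {f} _ t ⟧ᵗ v     = f (⟦ t ⟧ᵗ v)
⟦ ap₂ {f} _ t u ⟧ᵗ v   = f (⟦ t ⟧ᵗ v) (⟦ u ⟧ᵗ v)

⟦_⟧ᵛ : ∀ {m n} → Vec (Tm n) m → Vec ℕ n → Vec ℕ m
⟦ [] ⟧ᵛ v     = []
⟦ t ∷ ts ⟧ᵛ v = ⟦ t ⟧ᵗ v ∷ ⟦ ts ⟧ᵛ v

⟦_⟧ : ∀ {n} → Fm n → Vec ℕ n → Set
⟦_⟧[_] : ∀ {n} → Sg n → ℕ → Vec ℕ n → Set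

⟦ t == u ⟧ v    = ⟦ t ⟧ᵗ v ≡ ⟦ u ⟧ᵗ v
⟦ t << u ⟧ v    = ⟦ t ⟧ᵗ v < ⟦ u ⟧ᵗ v
⟦ φ ∧ ψ ⟧ v     = ⟦ φ ⟧ v × ⟦ ψ ⟧ v
⟦ φ ∨ ψ ⟧ v     = ⟦ φ ⟧ v ⊎ ⟦ ψ ⟧ v
⟦ neg φ ⟧ v     = ¬ ⟦ φ ⟧ v
⟦ all t φ ⟧ v   = ∀ x → x < ⟦ t ⟧ᵗ v → ⟦ φ ⟧ (x ∷ v)
⟦ ex t φ ⟧ v    = Σ ℕ λ x → x < ⟦ t ⟧ᵗ v × ⟦ φ ⟧ (x ∷ v)
⟦ sub φ ts ⟧ v  = ⟦ φ ⟧ (⟦ ts ⟧ᵛ v)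
⟦ at t φ ts ⟧ v = ⟦ φ ⟧[ ⟦ t ⟧ᵗ v ] (⟦ ts ⟧ᵛ v)

⟦ dec φ ⟧[ t ] v     = ⟦ φ ⟧ v
⟦ φ ∧ˢ ψ ⟧[ t ] v    = ⟦ φ ⟧[ t ] v × ⟦ ψ ⟧[ t ] v
⟦ φ ∨ˢ ψ ⟧[ t ] v    = ⟦ φ ⟧[ t ] v ⊎ ⟦ ψ ⟧[ t ] v
⟦ exˢ φ ⟧[ t ] v     = Σ ℕ λ x → x < t × ⟦ φ ⟧[ t ] (x ∷ v)
⟦ allˢ b φ ⟧[ t ] v  = ∀ x → x < ⟦ b ⟧ᵗ v → ⟦ φ ⟧[ t ] (x ∷ v)
⟦ subˢ φ ts ⟧[ t ] v = ⟦ φ ⟧[ t ] (⟦ ts ⟧ᵛ v)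

⟦_⟧ˢ : ∀ {n} → Sg n → Vec ℕ n → Set
⟦ dec φ ⟧ˢ v     = ⟦ φ ⟧ v
⟦ φ ∧ˢ ψ ⟧ˢ v    = ⟦ φ ⟧ˢ v × ⟦ ψ ⟧ˢ v
⟦ φ ∨ˢ ψ ⟧ˢ v    = ⟦ φ ⟧ˢ v ⊎ ⟦ ψ ⟧ˢ v
⟦ exˢ φ ⟧ˢ v     = Σ ℕ λ x → ⟦ φ ⟧ˢ (x ∷ v)
⟦ allˢ b φ ⟧ˢ v  = ∀ x → x < ⟦ b ⟧ᵗ v → ⟦ φ ⟧ˢ (x ∷ v)
⟦ subˢ φ ts ⟧ˢ v = ⟦ φ ⟧ˢ (⟦ ts ⟧ᵛ v)

stage-sound : ∀ {n} (φ : Sg n) {t v} → ⟦ φ ⟧[ t ] v → ⟦ φ ⟧ˢ v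
stage-sound (dec φ)     h             = h
stage-sound (φ ∧ˢ ψ)    (h , k)       = stage-sound φ h , stage-sound ψ k
stage-sound (φ ∨ˢ ψ)    (inj₁ h)      = inj₁ (stage-sound φ h)
stage-sound (φ ∨ˢ ψ)    (inj₂ h)      = inj₂ (stage-sound ψ h)
stage-sound (exˢ φ)     (x , _ , h)   = x , stage-sound φ h
stage-sound (allˢ b φ)  h             = λ x x< → stage-sound φ (h x x<)
stage-sound (subˢ φ ts) h             = stage-sound φ h

-- The stage only bounds existential quantifiers, and `Sg` has no negation; a part under `dec` does
-- not depend on the stage.
stage-mono : ∀ {n} (φ : Sg n) {t u v} → t ≤ u → ⟦ φ ⟧[ t ] v → ⟦ φ ⟧[ u ] v
stage-mono (dec φ)     t≤u h            = h
stage-mono (φ ∧ˢ ψ)    t≤u (h , k)      = stage-mono φ t≤u h , stage-mono ψ t≤u k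
stage-mono (φ ∨ˢ ψ)    t≤u (inj₁ h)     = inj₁ (stage-mono φ t≤u h)
stage-mono (φ ∨ˢ ψ)    t≤u (inj₂ h)     = inj₂ (stage-mono ψ t≤u h)
stage-mono (exˢ φ)     t≤u (x , x< , h) = x , <-≤-trans x< t≤u , stage-mono φ t≤u h
stage-mono (allˢ b φ)  t≤u h            = λ x x< → stage-mono φ t≤u (h x x<)
stage-mono (subˢ φ ts) t≤u h            = stage-mono φ t≤u h

bounded-stage : ∀ {P : ℕ → ℕ → Set} → (∀ {x t u} → t ≤ u → P x t → P x u) →
                ∀ b → (∀ x → x < b → Σ ℕ (P x)) → Σ ℕ λ t → ∀ x → x < b → P x t
bounded-stage mono zero    h = 0 , λ _ ()
bounded-stage {P} mono (suc b) h
  with bounded-stage mono b (λ x x<b → h x (m<n⇒m<1+n x<b)) | h b ≤-refl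
... | t , p | u , q = t + u , λ x x<1+b → case x (m<1+n⇒m<n∨m≡n x<1+b)
  where
  case : ∀ x → x < b ⊎ x ≡ b → P x (t + u)
  case x (inj₁ x<b)  = mono (m≤m+n t u) (p x x<b)
  case .b (inj₂ refl) = mono (m≤n+m u t) q

stage-complete : ∀ {n} (φ : Sg n) {v} → ⟦ φ ⟧ˢ v → Σ ℕ λ t → ⟦ φ ⟧[ t ] v
stage-complete (dec φ)     h        = 0 , h
stage-complete (φ ∧ˢ ψ)    (h , k) with stage-complete φ h | stage-complete ψ k
... | t , p | u , q = t + u , stage-mono φ (m≤m+n t u) p , stage-mono ψ (m≤n+m u t) q
stage-complete (φ ∨ˢ ψ)    (inj₁ h) = map₂ inj₁ (stage-complete φ h)
stage-complete (φ ∨ˢ ψ)    (inj₂ h) = map₂ inj₂ (stage-complete ψ h)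
stage-complete (exˢ φ)     (x , h) with stage-complete φ h
... | t , p = suc x + t , x , m≤m+n (suc x) t , stage-mono φ (m≤n+m t (suc x)) p
stage-complete (allˢ b φ) {v} h     =
  bounded-stage (stage-mono φ) (⟦ b ⟧ᵗ v) (λ x x< → stage-complete φ (h x x<))
stage-complete (subˢ φ ts) h        = stage-complete φ h

-- 0 stands for truth.
Σ< Π< : ℕ → (ℕ → ℕ) → ℕ
Σ< = foldTo _+_ 0
Π< = foldTo _*_ 1

χ  : ∀ {n} → Fm n → Vec ℕ n → ℕ
χˢ : ∀ {n} → Sg n → ℕ → Vec ℕ n → ℕ

χ (t == u) v    = (⟦ t ⟧ᵗ v ∸ ⟦ u ⟧ᵗ v) + (⟦ u ⟧ᵗ v ∸ ⟦ t ⟧ᵗ v)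
χ (t << u) v    = suc (⟦ t ⟧ᵗ v) ∸ ⟦ u ⟧ᵗ v
χ (φ ∧ ψ) v     = χ φ v + χ ψ v
χ (φ ∨ ψ) v     = χ φ v * χ ψ v
χ (neg φ) v     = 1 ∸ χ φ v
χ (all t φ) v   = Σ< (⟦ t ⟧ᵗ v) (λ x → χ φ (x ∷ v))
χ (ex t φ) v    = Π< (⟦ t ⟧ᵗ v) (λ x → χ φ (x ∷ v))
χ (sub φ ts) v  = χ φ (⟦ ts ⟧ᵛ v)
χ (at t φ ts) v = χˢ φ (⟦ t ⟧ᵗ v) (⟦ ts ⟧ᵛ v)

χˢ (dec φ) t v     = χ φ v
χˢ (φ ∧ˢ ψ) t v    = χˢ φ t v + χˢ ψ t v
χˢ (φ ∨ˢ ψ) t v    = χˢ φ t v * χˢ ψ t v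
χˢ (exˢ φ) t v     = Π< t (λ x → χˢ φ t (x ∷ v))
χˢ (allˢ b φ) t v  = Σ< (⟦ b ⟧ᵗ v) (λ x → χˢ φ t (x ∷ v))
χˢ (subˢ φ ts) t v = χˢ φ t (⟦ ts ⟧ᵛ v)

m∸n+n∸m≡0⇔m≡n : ∀ m n → (m ∸ n) + (n ∸ m) ≡ 0 ⇔ m ≡ n
m∸n+n∸m≡0⇔m≡n m n = mk⇔
  (λ eq → ≤-antisym (m∸n≡0⇒m≤n (m+n≡0⇒m≡0 (m ∸ n) eq)) (m∸n≡0⇒m≤n (m+n≡0⇒n≡0 (m ∸ n) eq)))
  (λ { refl → cong₂ _+_ (n∸n≡0 n) (n∸n≡0 n) })

+≡0⇔ : ∀ {m n} {A B : Set} → m ≡ 0 ⇔ A → n ≡ 0 ⇔ B → m + n ≡ 0 ⇔ (A × B)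
+≡0⇔ {m} p q = mk⇔ (λ eq → to p (m+n≡0⇒m≡0 m eq) , to q (m+n≡0⇒n≡0 m eq))
                   (λ (a , b) → cong₂ _+_ (from p a) (from q b))

*≡0⇔ : ∀ {m n} {A B : Set} → m ≡ 0 ⇔ A → n ≡ 0 ⇔ B → m * n ≡ 0 ⇔ (A ⊎ B)
*≡0⇔ {m} {n} {A} {B} p q = mk⇔ (λ eq → case (m*n≡0⇒m≡0∨n≡0 m eq)) λ
  { (inj₁ a) → cong (_* n) (from p a)
  ; (inj₂ b) → trans (cong (m *_) (from q b)) (*-zeroʳ m) }
  where
  case : m ≡ 0 ⊎ n ≡ 0 → A ⊎ B
  case (inj₁ z) = inj₁ (to p z)
  case (inj₂ z) = inj₂ (to q z)

1∸≡0⇔ : ∀ {m} {A : Set} → m ≡ 0 ⇔ A → 1 ∸ m ≡ 0 ⇔ (¬ A)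
1∸≡0⇔ {zero}  p = mk⇔ (λ ()) (λ ¬a → contradiction (to p refl) ¬a)
1∸≡0⇔ {suc m} p = mk⇔ (λ _ a → contradiction (from p a) λ ()) (λ _ → 0∸n≡0 m)

Σ<≡0⇔ : ∀ {f} {P : ℕ → Set} → (∀ x → f x ≡ 0 ⇔ P x) → ∀ n → Σ< n f ≡ 0 ⇔ (∀ x → x < n → P x)
Σ<≡0⇔ p zero    = mk⇔ (λ _ _ ()) (λ _ → refl)
Σ<≡0⇔ {f} {P} p (suc n) = mk⇔
  (λ eq x x< → case eq x (m<1+n⇒m<n∨m≡n x<))
  (λ h → cong₂ _+_ (from (Σ<≡0⇔ p n) (λ x x< → h x (m<n⇒m<1+n x<))) (from (p n) (h n ≤-refl)))
  where
  case : Σ< n f + f n ≡ 0 → ∀ x → x < n ⊎ x ≡ n → P x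
  case eq x (inj₁ x<)    = to (Σ<≡0⇔ p n) (m+n≡0⇒m≡0 (Σ< n f) eq) x x<
  case eq .n (inj₂ refl) = to (p n) (m+n≡0⇒n≡0 (Σ< n f) eq)

Π<≡0⇔ : ∀ {f} {P : ℕ → Set} → (∀ x → f x ≡ 0 ⇔ P x) → ∀ n → Π< n f ≡ 0 ⇔ (Σ ℕ λ x → x < n × P x)
Π<≡0⇔ p zero    = mk⇔ (λ ()) (λ ())
Π<≡0⇔ {f} {P} p (suc n) = mk⇔
  (λ eq → case₁ (m*n≡0⇒m≡0∨n≡0 (Π< n f) eq))
  (λ (x , x< , q) → case₂ x q (m<1+n⇒m<n∨m≡n x<))
  where
  case₁ : Π< n f ≡ 0 ⊎ f n ≡ 0 → Σ ℕ λ x → x < suc n × P x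
  case₁ (inj₁ z) = map₂ (map₁ m<n⇒m<1+n) (to (Π<≡0⇔ p n) z)
  case₁ (inj₂ z) = n , ≤-refl , to (p n) z
  case₂ : ∀ x → P x → x < n ⊎ x ≡ n → Π< n f * f n ≡ 0
  case₂ x q (inj₁ x<)    = cong (_* f n) (from (Π<≡0⇔ p n) (x , x< , q))
  case₂ .n q (inj₂ refl) = trans (cong (Π< n f *_) (from (p n) q)) (*-zeroʳ (Π< n f))

χ≡0⇔  : ∀ {n} (φ : Fm n) v → χ φ v ≡ 0 ⇔ ⟦ φ ⟧ v
χˢ≡0⇔ : ∀ {n} (φ : Sg n) t v → χˢ φ t v ≡ 0 ⇔ ⟦ φ ⟧[ t ] v

χ≡0⇔ (t == u) v    = m∸n+n∸m≡0⇔m≡n (⟦ t ⟧ᵗ v) (⟦ u ⟧ᵗ v)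
χ≡0⇔ (t << u) v    = mk⇔ (m∸n≡0⇒m≤n {suc (⟦ t ⟧ᵗ v)}) m≤n⇒m∸n≡0
χ≡0⇔ (φ ∧ ψ) v     = +≡0⇔ (χ≡0⇔ φ v) (χ≡0⇔ ψ v)
χ≡0⇔ (φ ∨ ψ) v     = *≡0⇔ (χ≡0⇔ φ v) (χ≡0⇔ ψ v)
χ≡0⇔ (neg φ) v     = 1∸≡0⇔ (χ≡0⇔ φ v)
χ≡0⇔ (all t φ) v   = Σ<≡0⇔ (λ x → χ≡0⇔ φ (x ∷ v)) (⟦ t ⟧ᵗ v)
χ≡0⇔ (ex t φ) v    = Π<≡0⇔ (λ x → χ≡0⇔ φ (x ∷ v)) (⟦ t ⟧ᵗ v)
χ≡0⇔ (sub φ ts) v  = χ≡0⇔ φ (⟦ ts ⟧ᵛ v)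
χ≡0⇔ (at t φ ts) v = χˢ≡0⇔ φ (⟦ t ⟧ᵗ v) (⟦ ts ⟧ᵛ v)

χˢ≡0⇔ (dec φ) t v     = χ≡0⇔ φ v
χˢ≡0⇔ (φ ∧ˢ ψ) t v    = +≡0⇔ (χˢ≡0⇔ φ t v) (χˢ≡0⇔ ψ t v)
χˢ≡0⇔ (φ ∨ˢ ψ) t v    = *≡0⇔ (χˢ≡0⇔ φ t v) (χˢ≡0⇔ ψ t v)
χˢ≡0⇔ (exˢ φ) t v     = Π<≡0⇔ (λ x → χˢ≡0⇔ φ t (x ∷ v)) t
χˢ≡0⇔ (allˢ b φ) t v  = Σ<≡0⇔ (λ x → χˢ≡0⇔ φ t (x ∷ v)) (⟦ b ⟧ᵗ v)
χˢ≡0⇔ (subˢ φ ts) t v = χˢ≡0⇔ φ t (⟦ ts ⟧ᵛ v)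

⟦_⟧? : ∀ {n} (φ : Fm n) v → Dec (⟦ φ ⟧ v)
⟦ φ ⟧? v = map? (χ≡0⇔ φ v) (χ φ v ≟ 0)

⟦_⟧[_]? : ∀ {n} (φ : Sg n) t v → Dec (⟦ φ ⟧[ t ] v)
⟦ φ ⟧[ t ]? v = map? (χˢ≡0⇔ φ t v) (χˢ φ t v ≟ 0)

-- Computability relative to a coding `ι` of the domain, which lets codes be combined over vectors
-- and pairs. `Fn₁` is the case where `ι` is the identity.
Cn : {A : Set} → (A → ℕ) → (A → ℕ) → Set
Cn ι f = Σ ℕ λ e → ∀ a → Eval e (ι a) (f a)

_⊗_ : {A B : Set} → (A → ℕ) → (B → ℕ) → A × B → ℕ
(ι ⊗ κ) (a , b) = pair (ι a) (κ b)

fstᶜ : {A B : Set} {ι : A → ℕ} {κ : B → ℕ} → Cn (ι ⊗ κ) (λ (a , b) → ι a)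
fstᶜ {ι = ι} {κ} = cL , λ (a , b) → ev-L {ι a} {κ b}

sndᶜ : {A B : Set} {ι : A → ℕ} {κ : B → ℕ} → Cn (ι ⊗ κ) (λ (a , b) → κ b)
sndᶜ {ι = ι} {κ} = cR , λ (a , b) → ev-R {ι a} {κ b}

module _ {A : Set} {ι : A → ℕ} where

  constᶜ : ∀ k → Cn ι (λ _ → k)
  constᶜ k = constCode k , λ a → eval-constCode k (ι a)

  idᶜ : Cn ι ι
  idᶜ = cI , λ _ → ev-I

  op₁ : ∀ {h f} → Fn₁ h → Cn ι f → Cn ι (λ a → h (f a))
  op₁ (d , q) (e , p) = cComp d e , λ a → ev-comp {d} {e} (p a) (q _)

  op₂ : ∀ {h f g} → Fn₂ h → Cn ι f → Cn ι g → Cn ι (λ a → h (f a) (g a))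
  op₂ (d , q) (e , p) (e′ , p′) = cComp d (cPair e e′) , λ a →
    ev-comp {d} {cPair e e′} (ev-pair {e} {e′} (p a) (p′ a)) (q _ _)

  pairᶜ : ∀ {f g} → Cn ι f → Cn ι g → Cn ι (λ a → pair (f a) (g a))
  pairᶜ (e , p) (e′ , p′) = cPair e e′ , λ a → ev-pair {e} {e′} (p a) (p′ a)

  reindex : ∀ {B : Set} {κ : B → ℕ} {f} (g : A → B) → Cn κ f → Cn ι (λ a → κ (g a)) → Cn ι (λ a → f (g a))
  reindex g (d , q) (e , p) = cComp d e , λ a → ev-comp {d} {e} (p a) (q (g a))

  foldᶜ : ∀ {_∙_ n} {f : ℕ × A → ℕ} → Fn₂ _∙_ → ∀ u → Cn ι n → Cn (id ⊗ ι) f →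
          Cn ι (λ a → foldTo _∙_ u (n a) (λ k → f (k , a)))
  foldᶜ {n = n} op u (d , q) (e , p) =
    cComp (foldCode op u e) (cPair cI d) , λ a →
      ev-comp {foldCode op u e} {cPair cI d} (ev-pair {cI} {d} ev-I (q a))
              (eval-foldCode op u e (λ k → p (k , a)) (n a))

enc : ∀ {n} → Vec ℕ n → ℕ
enc []      = 0
enc (x ∷ v) = pair x (enc v)

codeVar : ∀ {n} (i : Fin n) → Cn enc (λ v → lookup v i)
codeVar zero    = cL , λ { (x ∷ v) → ev-L {x} {enc v} }
codeVar (suc i) = cComp (proj₁ (codeVar i)) cR , λ
  { (x ∷ v) → ev-comp {proj₁ (codeVar i)} {cR} (ev-R {x} {enc v}) (proj₂ (codeVar i) v) }

codeTm : ∀ {n} (t : Tm n) → Cn enc ⟦ t ⟧ᵗ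
codeTm (var i)       = codeVar i
codeTm (lit k)       = constᶜ k
codeTm (ap₁ f t)     = op₁ f (codeTm t)
codeTm (ap₂ f t u)   = op₂ f (codeTm t) (codeTm u)

codeTms : ∀ {m n} (ts : Vec (Tm n) m) → Cn enc (λ v → enc (⟦ ts ⟧ᵛ v))
codeTms []       = constᶜ 0
codeTms (t ∷ ts) = pairᶜ (codeTm t) (codeTms ts)

module _ {n : ℕ} where
  stageᶜ : Cn (id ⊗ enc {n}) proj₁
  stageᶜ = fstᶜ {ι = id} {κ = enc}

  envᶜ : Cn (id ⊗ enc {n}) (λ (t , v) → enc v)
  envᶜ = sndᶜ {ι = id} {κ = enc}

-- The approximation at stage t in the environment v is computed from ⟨t , enc v⟩.
bodyᶜ : ∀ {n} {f : ℕ × Vec ℕ (suc n) → ℕ} → Cn (id ⊗ enc) f →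
        Cn (id ⊗ (id ⊗ enc)) (λ (k , t , v) → f (t , k ∷ v))
bodyᶜ c = reindex (λ (k , t , v) → t , k ∷ v) c
  (pairᶜ (reindex {κ = id ⊗ enc} proj₂ stageᶜ tail)
         (pairᶜ (fstᶜ {ι = id} {κ = id ⊗ enc}) (reindex {κ = id ⊗ enc} proj₂ envᶜ tail)))
  where
  tail = sndᶜ {ι = id} {κ = id ⊗ enc}

opaque
  codeFm : ∀ {n} (φ : Fm n) → Cn enc (χ φ)
  codeSg : ∀ {n} (φ : Sg n) → Cn (id ⊗ enc) (λ (t , v) → χˢ φ t v)

  codeFm (t == u)    = op₂ +ᶠ (op₂ ∸ᶠ (codeTm t) (codeTm u)) (op₂ ∸ᶠ (codeTm u) (codeTm t))
  codeFm (t << u)    = op₂ ∸ᶠ (op₁ sucᶠ (codeTm t)) (codeTm u)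
  codeFm (φ ∧ ψ)     = op₂ +ᶠ (codeFm φ) (codeFm ψ)
  codeFm (φ ∨ ψ)     = op₂ *ᶠ (codeFm φ) (codeFm ψ)
  codeFm (neg φ)     = op₂ ∸ᶠ (constᶜ 1) (codeFm φ)
  codeFm (all t φ)   = foldᶜ +ᶠ 0 (codeTm t) (reindex (uncurry _∷_) (codeFm φ) idᶜ)
  codeFm (ex t φ)    = foldᶜ *ᶠ 1 (codeTm t) (reindex (uncurry _∷_) (codeFm φ) idᶜ)
  codeFm (sub φ ts)  = reindex ⟦ ts ⟧ᵛ (codeFm φ) (codeTms ts)
  codeFm (at t φ ts) = reindex (λ v → ⟦ t ⟧ᵗ v , ⟦ ts ⟧ᵛ v) (codeSg φ) (pairᶜ (codeTm t) (codeTms ts))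

  codeSg (dec φ)     = reindex proj₂ (codeFm φ) envᶜ
  codeSg (φ ∧ˢ ψ)    = op₂ +ᶠ (codeSg φ) (codeSg ψ)
  codeSg (φ ∨ˢ ψ)    = op₂ *ᶠ (codeSg φ) (codeSg ψ)
  codeSg (exˢ φ)     = foldᶜ *ᶠ 1 stageᶜ (bodyᶜ (codeSg φ))
  codeSg (allˢ b φ)  = foldᶜ +ᶠ 0 (reindex proj₂ (codeTm b) envᶜ) (bodyᶜ (codeSg φ))
  codeSg (subˢ φ ts) = reindex (map₂ ⟦ ts ⟧ᵛ) (codeSg φ) (pairᶜ stageᶜ (reindex proj₂ (codeTms ts) envᶜ))

-- Determinism of evaluation and Σ₁ sets

-- The outermost constructor of a code, recovered from its residue modulo 5. Inversion of `Eval`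
-- goes through this decoding, since arithmetical expressions such as `cComp f g` cannot be unified
-- directly.
data Op : Set where
  opZ opS opI opL opR opJunk : Op
  opComp opPair opRec : ℕ → ℕ → Op
  opMu : ℕ → Op

divMod5 : ℕ → ℕ × ℕ
divMod5 (suc (suc (suc (suc (suc n))))) = map₁ suc (divMod5 n)
divMod5 r                               = 0 , r

compound : ℕ × ℕ → Op
compound (q , 0) = opComp (π₁ q) (π₂ q)
compound (q , 1) = opPair (π₁ q) (π₂ q)
compound (q , 2) = opRec (π₁ q) (π₂ q)
compound (q , 3) = opMu q
compound (q , _) = opJunk

op : ℕ → Op
op 0 = opZ
op 1 = opS
op 2 = opI
op 3 = opL
op 4 = opR
op (suc (suc (suc (suc (suc n))))) = compound (divMod5 n)

divMod5-0 : ∀ q → divMod5 (5 * q) ≡ (q , 0)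
divMod5-0 zero    = refl
divMod5-0 (suc q) rewrite *-suc 5 q = cong (map₁ suc) (divMod5-0 q)

divMod5-1 : ∀ q → divMod5 (1 + 5 * q) ≡ (q , 1)
divMod5-1 zero    = refl
divMod5-1 (suc q) rewrite *-suc 5 q = cong (map₁ suc) (divMod5-1 q)

divMod5-2 : ∀ q → divMod5 (2 + 5 * q) ≡ (q , 2)
divMod5-2 zero    = refl
divMod5-2 (suc q) rewrite *-suc 5 q = cong (map₁ suc) (divMod5-2 q)

divMod5-3 : ∀ q → divMod5 (3 + 5 * q) ≡ (q , 3)
divMod5-3 zero    = refl
divMod5-3 (suc q) rewrite *-suc 5 q = cong (map₁ suc) (divMod5-3 q)

op-cComp : ∀ f g → op (cComp f g) ≡ opComp f g
op-cComp f g = trans (cong compound (divMod5-0 (pair f g))) (cong₂ opComp (π₁-pair f g) (π₂-pair f g))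

op-cPair : ∀ f g → op (cPair f g) ≡ opPair f g
op-cPair f g = trans (cong compound (divMod5-1 (pair f g))) (cong₂ opPair (π₁-pair f g) (π₂-pair f g))

op-cRec : ∀ f g → op (cRec f g) ≡ opRec f g
op-cRec f g = trans (cong compound (divMod5-2 (pair f g))) (cong₂ opRec (π₁-pair f g) (π₂-pair f g))

op-cMu : ∀ f → op (cMu f) ≡ opMu f
op-cMu f = cong compound (divMod5-3 f)

Inv : Op → ℕ → ℕ → Set
Inv opZ x y          = y ≡ 0
Inv opS x y          = y ≡ suc x
Inv opI x y          = y ≡ x
Inv opL x y          = y ≡ π₁ x
Inv opR x y          = y ≡ π₂ x
Inv opJunk x y       = ⊥
Inv (opComp f g) x z = Σ ℕ λ y → Eval g x y × Eval f y z
Inv (opPair f g) x y = Σ ℕ λ u → Σ ℕ λ v → y ≡ pair u v × Eval f x u × Eval g x v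
Inv (opRec f g) x z  =
  (Σ ℕ λ a → x ≡ pair a 0 × Eval f a z) ⊎
  (Σ ℕ λ a → Σ ℕ λ n → Σ ℕ λ y → x ≡ pair a (suc n) × Eval (cRec f g) (pair a n) y × Eval g (pair a (pair n y)) z)
Inv (opMu f) x y     = Eval f (pair x y) 0 × (∀ z → z < y → Σ ℕ λ v → Eval f (pair x z) (suc v))

inversion : ∀ {e x y} → Eval e x y → Inv (op e) x y
inversion ev-Z = refl
inversion ev-S = refl
inversion ev-I = refl
inversion (ev-L {a} {b}) = sym (π₁-pair a b)
inversion (ev-R {a} {b}) = sym (π₂-pair a b)
inversion (ev-comp {f} {g} p q) = subst (λ o → Inv o _ _) (sym (op-cComp f g)) (_ , p , q)
inversion (ev-pair {f} {g} {_} {u} {v} p q) = subst (λ o → Inv o _ (pair u v)) (sym (op-cPair f g)) (u , v , refl , p , q)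
inversion (ev-rec0 {f} {g} {a} p) = subst (λ o → Inv o (pair a 0) _) (sym (op-cRec f g)) (inj₁ (a , refl , p))
inversion (ev-recS {f} {g} {a} {n} {y} p q) =
  subst (λ o → Inv o (pair a (suc n)) _) (sym (op-cRec f g)) (inj₂ (a , n , y , refl , p , q))
inversion (ev-mu {f} p q) = subst (λ o → Inv o _ _) (sym (op-cMu f)) (p , q)

inversion-comp : ∀ f g {x z} → Eval (cComp f g) x z → Σ ℕ λ y → Eval g x y × Eval f y z
inversion-comp f g p = subst (λ o → Inv o _ _) (op-cComp f g) (inversion p)

inversion-mu : ∀ f {x y} → Eval (cMu f) x y → Eval f (pair x y) 0
inversion-mu f p = proj₁ (subst (λ o → Inv o _ _) (op-cMu f) (inversion p))

Eval-deterministic : ∀ {e x y y′} → Eval e x y → Eval e x y′ → y ≡ y′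
Eval-deterministic ev-Z q = sym (inversion q)
Eval-deterministic ev-S q = sym (inversion q)
Eval-deterministic ev-I q = sym (inversion q)
Eval-deterministic (ev-L {a} {b}) q = trans (sym (π₁-pair a b)) (sym (inversion q))
Eval-deterministic (ev-R {a} {b}) q = trans (sym (π₂-pair a b)) (sym (inversion q))
Eval-deterministic {y′ = y′} (ev-comp {f} {g} p₁ p₂) q
  with inversion-comp f g q
... | u , q₁ , q₂ with Eval-deterministic p₁ q₁
... | refl = Eval-deterministic p₂ q₂
Eval-deterministic (ev-pair {f} {g} p₁ p₂) q
  with subst (λ o → Inv o _ _) (op-cPair f g) (inversion q)
... | u , v , refl , q₁ , q₂ = cong₂ pair (Eval-deterministic p₁ q₁) (Eval-deterministic p₂ q₂)
Eval-deterministic (ev-rec0 {f} {g} {x} p) q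
  with subst (λ o → Inv o (pair x 0) _) (op-cRec f g) (inversion q)
... | inj₁ (a , eq , q₁) = Eval-deterministic p (subst (λ z → Eval f z _) (sym (pair-injectiveˡ {x} {0} {a} eq)) q₁)
... | inj₂ (a , n , _ , eq , _) = contradiction (pair-injectiveʳ {x} {0} {a} eq) λ ()
Eval-deterministic (ev-recS {f} {g} {x} {n} p₁ p₂) q
  with subst (λ o → Inv o (pair x (suc n)) _) (op-cRec f g) (inversion q)
... | inj₁ (a , eq , q₁) = contradiction (pair-injectiveʳ {x} {suc n} {a} eq) λ ()
... | inj₂ (a , m , u , eq , q₁ , q₂)
  with pair-injectiveˡ {x} {suc n} {a} eq | suc-injective (pair-injectiveʳ {x} {suc n} {a} eq)
... | refl | refl with Eval-deterministic p₁ q₁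
... | refl = Eval-deterministic p₂ q₂
Eval-deterministic {y′ = y′} (ev-mu {f} {x} {y} p₁ p₂) q
  with subst (λ o → Inv o _ _) (op-cMu f) (inversion q)
... | q₁ , q₂ with <-cmp y y′
-- The smaller of the two results has value 0 by one evaluation and a successor value by the other.
... | tri< y<y′ _ _ = contradiction (Eval-deterministic p₁ (proj₂ (q₂ y y<y′))) λ ()
... | tri≈ _ y≡y′ _ = y≡y′
... | tri> _ _ y′<y = contradiction (Eval-deterministic (proj₂ (p₂ y′ y′<y)) q₁) λ ()

least : ∀ {P : ℕ → Set} → Decidable P → ∀ n → P n → Σ ℕ λ m → P m × m ≤ n × (∀ k → k < m → ¬ P k)
least P? n pn with P? 0
... | yes p0 = 0 , p0 , z≤n , λ _ ()
least P? zero pn | no ¬p0 = contradiction pn ¬p0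
least {P} P? (suc n) pn | no ¬p0 with least (λ k → P? (suc k)) n pn
... | m , pm , m≤n , min = suc m , pm , s≤s m≤n , λ { zero _ → ¬p0 ; (suc k) (s≤s k<m) → min k k<m }

least-unique : ∀ {P : ℕ → Set} {m n} → P m × (∀ k → k < m → ¬ P k) → P n × (∀ k → k < n → ¬ P k) → m ≡ n
least-unique {m = m} {n} (p , min) (q , min′) with <-cmp m n
... | tri< m<n _ _ = contradiction p (min′ m m<n)
... | tri≈ _ m≡n _ = m≡n
... | tri> _ _ n<m = contradiction q (min n n<m)

sucView : ∀ n → n ≢ 0 → Σ ℕ λ m → n ≡ suc m
sucView zero    n≢0 = contradiction refl n≢0
sucView (suc n) _   = n , refl

opaque
  -- Minimisation searches for a stage at which the decidable approximation of the formula holds, so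
  -- the extension is the domain of a partial recursive function.
  Sg-re : ∀ {n} (φ : Sg n) {A : Set} {ι : A → ℕ} (g : A → Vec ℕ n) → Cn ι (λ a → enc (g a)) →
          Σ ℕ λ e → ∀ a → ⟦ φ ⟧ˢ (g a) ⇔ W e (ι a)
  Sg-re φ {A} {ι} g c = cMu (proj₁ test) , λ a → mk⇔ (fwd a) (bwd a)
    where
    test : Cn (ι ⊗ id) (λ (a , t) → χˢ φ t (g a))
    test = reindex {κ = id ⊗ enc} (λ (a , t) → t , g a) (codeSg φ)
             (pairᶜ (sndᶜ {ι = ι} {κ = id}) (reindex {κ = ι} proj₁ c (fstᶜ {ι = ι} {κ = id})))

    fwd : ∀ a → ⟦ φ ⟧ˢ (g a) → W (cMu (proj₁ test)) (ι a)
    fwd a h with stage-complete φ h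
    -- `ev-mu` demands nonzero values below the result, hence the least successful stage.
    ... | t₀ , h₀ with least (λ t → ⟦ φ ⟧[ t ]? (g a)) t₀ h₀
    ... | t , ht , _ , min = t , ev-mu
      (subst (Eval _ (pair (ι a) t)) (from (χˢ≡0⇔ φ t (g a)) ht) (proj₂ test (a , t)))
      (λ u u<t → map₂ (λ eq → subst (Eval _ (pair (ι a) u)) eq (proj₂ test (a , u)))
                      (sucView (χˢ φ u (g a)) (λ eq → min u u<t (to (χˢ≡0⇔ φ u (g a)) eq))))

    bwd : ∀ a → W (cMu (proj₁ test)) (ι a) → ⟦ φ ⟧ˢ (g a)
    bwd a (t , ev) = stage-sound φ (to (χˢ≡0⇔ φ t (g a))
      (Eval-deterministic (proj₂ test (a , t)) (inversion-mu (proj₁ test) ev)))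

cCompᶠ : Fn₂ cComp
cCompᶠ = curryᶠ (ap₂ᶠ +ᶠ (constᶠ 5) (ap₂ᶠ *ᶠ (constᶠ 5) (pairᶠ π₁ᶠ π₂ᶠ)))

cPairᶠ : Fn₂ cPair
cPairᶠ = curryᶠ (ap₂ᶠ +ᶠ (constᶠ 6) (ap₂ᶠ *ᶠ (constᶠ 5) (pairᶠ π₁ᶠ π₂ᶠ)))

cRecᶠ : Fn₂ cRec
cRecᶠ = curryᶠ (ap₂ᶠ +ᶠ (constᶠ 7) (ap₂ᶠ *ᶠ (constᶠ 5) (pairᶠ π₁ᶠ π₂ᶠ)))

cMuᶠ : Fn₁ cMu
cMuᶠ = ap₂ᶠ +ᶠ (constᶠ 8) (ap₂ᶠ *ᶠ (constᶠ 5) idᶠ)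

constCodeᶠ : Fn₁ constCode
constCodeᶠ = ap₂ᶠ (recᶠ {g = λ _ _ y → cComp cS y} (λ _ k → constCode k) (constᶠ 0)
  (ap₂ᶠ cCompᶠ (constᶠ cS) (π₂ᶠ ∘ᶠ π₂ᶠ)) (λ _ → refl) (λ _ _ → refl)) idᶠ idᶠ

module _ (φ : Sg 2) where
  private
    uniform : Σ ℕ λ e → ∀ ((c , x) : ℕ × ℕ) → ⟦ φ ⟧ˢ (c ∷ x ∷ []) ⇔ W e (pair c x)
    uniform = Sg-re φ (λ (c , x) → c ∷ x ∷ [])
           (pairᶜ (fstᶜ {ι = id} {κ = id}) (pairᶜ (sndᶜ {ι = id} {κ = id}) (constᶜ 0)))

    pairing : ℕ → ℕ
    pairing c = cPair (constCode c) cI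

    eval-pairing : ∀ c x → Eval (pairing c) x (pair c x)
    eval-pairing c x = ev-pair {constCode c} {cI} (eval-constCode c x) ev-I

  -- An instance of the s-m-n theorem: the parameter `c` is built into the code as a constant, and
  -- this is computable in `c`.
  section : ℕ → ℕ
  section c = cComp (proj₁ uniform) (pairing c)

  sectionᶠ : Fn₁ section
  sectionᶠ = ap₂ᶠ cCompᶠ (constᶠ (proj₁ uniform)) (ap₂ᶠ cPairᶠ constCodeᶠ (constᶠ cI))

  W-section : ∀ c x → ⟦ φ ⟧ˢ (c ∷ x ∷ []) ⇔ W (section c) x
  W-section c x = mk⇔ fwd bwd
    where
    fwd : ⟦ φ ⟧ˢ (c ∷ x ∷ []) → W (section c) x
    fwd h = map₂ (ev-comp {proj₁ uniform} {pairing c} (eval-pairing c x)) (to (proj₂ uniform (c , x)) h)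

    bwd : W (section c) x → ⟦ φ ⟧ˢ (c ∷ x ∷ [])
    bwd (y , ev) with inversion-comp (proj₁ uniform) (pairing c) ev
    ... | z , p , q = from (proj₂ uniform (c , x))
      (y , subst (λ u → Eval (proj₁ uniform) u y) (Eval-deterministic p (eval-pairing c x)) q)

-- Coded sequences and the universal Σ₁ formula

hd tl : ℕ → ℕ
hd c = π₁ (pred c)
tl c = π₂ (pred c)

tls : ℕ → ℕ → ℕ
tls c zero    = c
tls c (suc i) = tl (tls c i)

-- Positions beyond the end read as 0, like a pause, so searches for elements may run past the end.
entry : ℕ → ℕ → ℕ
entry c i = hd (tls c i)

hdᶠ : Fn₁ hd
hdᶠ = π₁ᶠ ∘ᶠ predᶠ

tlᶠ : Fn₁ tl
tlᶠ = π₂ᶠ ∘ᶠ predᶠ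

tlsᶠ : Fn₂ tls
tlsᶠ = recᶠ {g = λ _ _ y → tl y} tls idᶠ (tlᶠ ∘ᶠ π₂ᶠ ∘ᶠ π₂ᶠ) (λ _ → refl) (λ _ _ → refl)

entryᶠ : Fn₂ entry
entryᶠ = proj₁ e , λ x y → subst (Eval (proj₁ e) (pair x y)) (cong hd (cong₂ tls (π₁-pair x y) (π₂-pair x y))) (proj₂ e (pair x y))
  where
  e = hdᶠ ∘ᶠ ap₂ᶠ tlsᶠ π₁ᶠ π₂ᶠ

Seq : Set
Seq = List (Maybe ℕ)

hd-codeSeq : ∀ a s → hd (codeSeq (a ∷ s)) ≡ encMaybe a
hd-codeSeq a s = π₁-pair (encMaybe a) (codeSeq s)

tl-codeSeq : ∀ a s → tl (codeSeq (a ∷ s)) ≡ codeSeq s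
tl-codeSeq a s = π₂-pair (encMaybe a) (codeSeq s)

tls-tl : ∀ c i → tls (tl c) i ≡ tls c (suc i)
tls-tl c zero    = refl
tls-tl c (suc i) = cong tl (tls-tl c i)

tls-codeSeq : ∀ s i → tls (codeSeq s) i ≡ codeSeq (drop i s)
tls-codeSeq s       zero    = refl
tls-codeSeq []      (suc i) = cong tl (trans (tls-codeSeq [] i) (cong codeSeq (drop-[] i)))
  where
  drop-[] : ∀ i → drop i ([] {A = Maybe ℕ}) ≡ []
  drop-[] zero    = refl
  drop-[] (suc i) = refl
tls-codeSeq (a ∷ s) (suc i) =
  trans (sym (tls-tl (codeSeq (a ∷ s)) i)) (trans (cong (λ c → tls c i) (tl-codeSeq a s)) (tls-codeSeq s i))

codeSeq<codeSeq-∷ : ∀ a s → codeSeq s < codeSeq (a ∷ s)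
codeSeq<codeSeq-∷ a s = s≤s (n≤pair (encMaybe a) (codeSeq s))

-- This lets the code itself bound quantifiers over positions, and lets the code of an initial
-- segment of a text serve as a stage that tends to infinity.
length≤codeSeq : ∀ s → length s ≤ codeSeq s
length≤codeSeq []      = z≤n
length≤codeSeq (a ∷ s) = ≤-trans (s≤s (length≤codeSeq s)) (codeSeq<codeSeq-∷ a s)

decMaybe : ℕ → Maybe ℕ
decMaybe zero    = nothing
decMaybe (suc n) = just n

encMaybe-decMaybe : ∀ n → encMaybe (decMaybe n) ≡ n
encMaybe-decMaybe zero    = refl
encMaybe-decMaybe (suc n) = refl

codeSeq-surjective : ∀ c → Σ Seq λ s → codeSeq s ≡ c
codeSeq-surjective c = go c c ≤-refl
  where
  go : ∀ n c → c ≤ n → Σ Seq λ s → codeSeq s ≡ c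
  go n       zero    _           = [] , refl
  go (suc n) (suc c) (s≤s c≤n) with go n (π₂ c) (≤-trans (π₂≤ c) c≤n)
  ... | s , eq = decMaybe (π₁ c) ∷ s ,
    cong suc (trans (cong₂ pair (encMaybe-decMaybe (π₁ c)) eq) (pair-unpair c))

decodeSeq : ℕ → Seq
decodeSeq c = proj₁ (codeSeq-surjective c)

codeSeq-decodeSeq : ∀ c → codeSeq (decodeSeq c) ≡ c
codeSeq-decodeSeq c = proj₂ (codeSeq-surjective c)

encMaybe-injective : ∀ {a b} → encMaybe a ≡ encMaybe b → a ≡ b
encMaybe-injective {nothing} {nothing} _    = refl
encMaybe-injective {just x}  {just .x} refl = refl

codeSeq-injective : ∀ {s r} → codeSeq s ≡ codeSeq r → s ≡ r
codeSeq-injective {[]}    {[]}    _  = refl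
codeSeq-injective {a ∷ s} {b ∷ r} eq = cong₂ _∷_
  (encMaybe-injective (pair-injectiveˡ {encMaybe a} {codeSeq s} {encMaybe b} (suc-injective eq)))
  (codeSeq-injective (pair-injectiveʳ {encMaybe a} {codeSeq s} {encMaybe b} (suc-injective eq)))

entry-∈ : ∀ s i {y} → entry (codeSeq s) i ≡ suc y → just y ∈ s
entry-∈ s i {y} eq = go s i (trans (cong hd (sym (tls-codeSeq s i))) eq)
  where
  go : ∀ s i → hd (codeSeq (drop i s)) ≡ suc y → just y ∈ s
  go []      zero    ()
  go []      (suc i) ()
  go (a ∷ s) zero    eq = here (sym (encMaybe-injective (trans (sym (hd-codeSeq a s)) eq)))
  go (a ∷ s) (suc i) eq = there (go s i eq)

∈-entry : ∀ {s y} → just y ∈ s → Σ ℕ λ i → i < codeSeq s × entry (codeSeq s) i ≡ suc y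
∈-entry {s} p with go p
  where
  go : ∀ {s y} → just y ∈ s → Σ ℕ λ i → i < length s × hd (codeSeq (drop i s)) ≡ suc y
  go {a ∷ s} (here refl) = 0 , s≤s z≤n , hd-codeSeq a s
  go {a ∷ s} (there p)   = let i , i< , eq = go p in suc i , s≤s i< , eq
... | i , i< , eq = i , <-≤-trans i< (length≤codeSeq s) , trans (cong hd (tls-codeSeq s i)) eq

x₀ : ∀ {n} → Tm (1 + n)
x₀ = var zero
x₁ : ∀ {n} → Tm (2 + n)
x₁ = var (suc zero)
x₂ : ∀ {n} → Tm (3 + n)
x₂ = var (suc (suc zero))
x₃ : ∀ {n} → Tm (4 + n)
x₃ = var (suc (suc (suc zero)))
x₄ : ∀ {n} → Tm (5 + n)
x₄ = var (suc (suc (suc (suc zero))))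
x₅ : ∀ {n} → Tm (6 + n)
x₅ = var (suc (suc (suc (suc (suc zero)))))
x₆ : ∀ {n} → Tm (7 + n)
x₆ = var (suc (suc (suc (suc (suc (suc zero))))))
x₇ : ∀ {n} → Tm (8 + n)
x₇ = var (suc (suc (suc (suc (suc (suc (suc zero)))))))
x₈ : ∀ {n} → Tm (9 + n)
x₈ = var (suc (suc (suc (suc (suc (suc (suc (suc zero))))))))

pairᶠ₂ : Fn₂ pair
pairᶠ₂ = cI , λ x y → ev-I

sucᵗ : ∀ {n} → Tm n → Tm n
sucᵗ = ap₁ sucᶠ

pairᵗ : ∀ {n} → Tm n → Tm n → Tm n
pairᵗ = ap₂ pairᶠ₂

claim : ℕ → ℕ → ℕ → ℕ
claim e x y = pair e (pair x y)

claimᵗ : ∀ {n} → Tm n → Tm n → Tm n → Tm n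
claimᵗ e x y = pairᵗ e (pairᵗ x y)

Member : ℕ → ℕ → Set
Member D t = Σ ℕ λ i → i < D × entry D i ≡ suc t

memberᶠ : Fm 2
memberᶠ = ex x₀ (ap₂ entryᶠ x₁ x₀ == sucᵗ x₂)

memberˢ : ∀ {n} → Tm n → Tm n → Sg n
memberˢ D t = dec (sub memberᶠ (D ∷ t ∷ []))

-- Eval e x y follows by one rule from the claims satisfying M.
Rule : (ℕ → Set) → ℕ → ℕ → ℕ → Set
Rule M e x y =
  (e ≡ cZ × y ≡ 0) ⊎
  (e ≡ cS × y ≡ suc x) ⊎
  (e ≡ cI × y ≡ x) ⊎
  (e ≡ cL × y ≡ π₁ x) ⊎
  (e ≡ cR × y ≡ π₂ x) ⊎
  (Σ ℕ λ f → Σ ℕ λ g → Σ ℕ λ u → e ≡ cComp f g × M (claim g x u) × M (claim f u y)) ⊎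
  (Σ ℕ λ f → Σ ℕ λ g → Σ ℕ λ u → Σ ℕ λ v →
     e ≡ cPair f g × y ≡ pair u v × M (claim f x u) × M (claim g x v)) ⊎
  (Σ ℕ λ f → Σ ℕ λ g → Σ ℕ λ a → e ≡ cRec f g × x ≡ pair a 0 × M (claim f a y)) ⊎
  (Σ ℕ λ f → Σ ℕ λ g → Σ ℕ λ a → Σ ℕ λ n → Σ ℕ λ u →
     e ≡ cRec f g × x ≡ pair a (suc n) × M (claim e (pair a n) u) × M (claim g (pair a (pair n u)) y)) ⊎
  (Σ ℕ λ f → e ≡ cMu f × M (claim f (pair x y) 0) ×
     (∀ z → z < y → Σ ℕ λ v → M (claim f (pair x z) (suc v))))

ruleˢ : Sg 4
ruleˢ =
  dec (x₁ == lit cZ ∧ x₃ == lit 0) ∨ˢ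
  dec (x₁ == lit cS ∧ x₃ == sucᵗ x₂) ∨ˢ
  dec (x₁ == lit cI ∧ x₃ == x₂) ∨ˢ
  dec (x₁ == lit cL ∧ x₃ == ap₁ π₁ᶠ x₂) ∨ˢ
  dec (x₁ == lit cR ∧ x₃ == ap₁ π₂ᶠ x₂) ∨ˢ
  exˢ (exˢ (exˢ (dec (x₄ == ap₂ cCompᶠ x₂ x₁) ∧ˢ
    memberˢ x₃ (claimᵗ x₁ x₅ x₀) ∧ˢ memberˢ x₃ (claimᵗ x₂ x₀ x₆)))) ∨ˢ
  exˢ (exˢ (exˢ (exˢ (dec (x₅ == ap₂ cPairᶠ x₃ x₂) ∧ˢ dec (x₇ == pairᵗ x₁ x₀) ∧ˢ
    memberˢ x₄ (claimᵗ x₃ x₆ x₁) ∧ˢ memberˢ x₄ (claimᵗ x₂ x₆ x₀))))) ∨ˢ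
  exˢ (exˢ (exˢ (dec (x₄ == ap₂ cRecᶠ x₂ x₁) ∧ˢ dec (x₅ == pairᵗ x₀ (lit 0)) ∧ˢ
    memberˢ x₃ (claimᵗ x₂ x₀ x₆)))) ∨ˢ
  exˢ (exˢ (exˢ (exˢ (exˢ (dec (x₆ == ap₂ cRecᶠ x₄ x₃) ∧ˢ dec (x₇ == pairᵗ x₂ (sucᵗ x₁)) ∧ˢ
    memberˢ x₅ (claimᵗ x₆ (pairᵗ x₂ x₁) x₀) ∧ˢ memberˢ x₅ (claimᵗ x₃ (pairᵗ x₂ (pairᵗ x₁ x₀)) x₈)))))) ∨ˢ
  exˢ (dec (x₂ == ap₁ cMuᶠ x₀) ∧ˢ memberˢ x₁ (claimᵗ x₀ (pairᵗ x₃ x₄) (lit 0)) ∧ˢ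
    allˢ x₄ (exˢ (memberˢ x₃ (claimᵗ x₂ (pairᵗ x₅ x₁) (sucᵗ x₀)))))

-- Derivations have their conclusions in front: an entry is justified by the entries behind it. The
-- value 0 covers both pauses and the empty sequence.
Justified : ℕ → Set
Justified c = hd c ≡ 0 ⊎ (Σ ℕ λ e → Σ ℕ λ x → Σ ℕ λ y → hd c ≡ suc (claim e x y) × Rule (Member (tl c)) e x y)

justifiedˢ : Sg 1
justifiedˢ = dec (ap₁ hdᶠ x₀ == lit 0) ∨ˢ
  exˢ (exˢ (exˢ (dec (ap₁ hdᶠ x₃ == sucᵗ (claimᵗ x₂ x₁ x₀)) ∧ˢ subˢ ruleˢ (ap₁ tlᶠ x₃ ∷ x₂ ∷ x₁ ∷ x₀ ∷ []))))

Rule-mono : ∀ {M N : ℕ → Set} → (∀ {t} → M t → N t) → ∀ {e x y} → Rule M e x y → Rule N e x y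
Rule-mono f (inj₁ r) = inj₁ r
Rule-mono f (inj₂ (inj₁ r)) = inj₂ (inj₁ r)
Rule-mono f (inj₂ (inj₂ (inj₁ r))) = inj₂ (inj₂ (inj₁ r))
Rule-mono f (inj₂ (inj₂ (inj₂ (inj₁ r)))) = inj₂ (inj₂ (inj₂ (inj₁ r)))
Rule-mono f (inj₂ (inj₂ (inj₂ (inj₂ (inj₁ r))))) = inj₂ (inj₂ (inj₂ (inj₂ (inj₁ r))))
Rule-mono f (inj₂ (inj₂ (inj₂ (inj₂ (inj₂ (inj₁ (a , b , c , p , m , n))))))) =
  inj₂ (inj₂ (inj₂ (inj₂ (inj₂ (inj₁ (a , b , c , p , f m , f n))))))
Rule-mono f (inj₂ (inj₂ (inj₂ (inj₂ (inj₂ (inj₂ (inj₁ (a , b , c , d , p , q , m , n)))))))) =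
  inj₂ (inj₂ (inj₂ (inj₂ (inj₂ (inj₂ (inj₁ (a , b , c , d , p , q , f m , f n)))))))
Rule-mono f (inj₂ (inj₂ (inj₂ (inj₂ (inj₂ (inj₂ (inj₂ (inj₁ (a , b , c , p , q , m))))))))) =
  inj₂ (inj₂ (inj₂ (inj₂ (inj₂ (inj₂ (inj₂ (inj₁ (a , b , c , p , q , f m))))))))
Rule-mono f (inj₂ (inj₂ (inj₂ (inj₂ (inj₂ (inj₂ (inj₂ (inj₂ (inj₁ (a , b , c , d , e , p , q , m , n)))))))))) =
  inj₂ (inj₂ (inj₂ (inj₂ (inj₂ (inj₂ (inj₂ (inj₂ (inj₁ (a , b , c , d , e , p , q , f m , f n)))))))))
Rule-mono f (inj₂ (inj₂ (inj₂ (inj₂ (inj₂ (inj₂ (inj₂ (inj₂ (inj₂ (a , p , m , h)))))))))) =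
  inj₂ (inj₂ (inj₂ (inj₂ (inj₂ (inj₂ (inj₂ (inj₂ (inj₂ (a , p , f m , λ z z< → map₂ f (h z z<))))))))))

Rule-sound : ∀ {M e x y} → (∀ e x y → M (claim e x y) → Eval e x y) → Rule M e x y → Eval e x y
Rule-sound h (inj₁ (refl , refl)) = ev-Z
Rule-sound h (inj₂ (inj₁ (refl , refl))) = ev-S
Rule-sound h (inj₂ (inj₂ (inj₁ (refl , refl)))) = ev-I
Rule-sound h (inj₂ (inj₂ (inj₂ (inj₁ (refl , refl))))) = proj₂ π₁ᶠ _
Rule-sound h (inj₂ (inj₂ (inj₂ (inj₂ (inj₁ (refl , refl)))))) = proj₂ π₂ᶠ _
Rule-sound {x = x} {z} h (inj₂ (inj₂ (inj₂ (inj₂ (inj₂ (inj₁ (f , g , u , refl , m , n))))))) =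
  ev-comp {f} {g} (h g x u m) (h f u z n)
Rule-sound {x = x} h (inj₂ (inj₂ (inj₂ (inj₂ (inj₂ (inj₂ (inj₁ (f , g , u , v , refl , refl , m , n)))))))) =
  ev-pair {f} {g} (h f x u m) (h g x v n)
Rule-sound {y = y} h (inj₂ (inj₂ (inj₂ (inj₂ (inj₂ (inj₂ (inj₂ (inj₁ (f , g , a , refl , refl , m))))))))) =
  ev-rec0 {f} {g} {a} (h f a y m)
Rule-sound {y = y} h (inj₂ (inj₂ (inj₂ (inj₂ (inj₂ (inj₂ (inj₂ (inj₂ (inj₁ (f , g , a , n , u , refl , refl , m , m′)))))))))) =
  ev-recS {f} {g} {a} {n} (h (cRec f g) (pair a n) u m) (h g (pair a (pair n u)) y m′)
Rule-sound {x = x} {y} h (inj₂ (inj₂ (inj₂ (inj₂ (inj₂ (inj₂ (inj₂ (inj₂ (inj₂ (f , refl , m , k)))))))))) =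
  ev-mu {f} (h f (pair x y) 0 m) (λ z z< → map₂ (λ {v} → h f (pair x z) (suc v)) (k z z<))

∈⇒Member : ∀ {s t} → just t ∈ s → Member (codeSeq s) t
∈⇒Member p = ∈-entry p

Member⇒∈ : ∀ {s t} → Member (codeSeq s) t → just t ∈ s
Member⇒∈ {s} (i , _ , eq) = entry-∈ s i eq

JustifiedSeq : Seq → Set
JustifiedSeq s = ∀ k → Justified (codeSeq (drop k s))

Justified-∷⁻ : ∀ a s → Justified (codeSeq (a ∷ s)) →
               encMaybe a ≡ 0 ⊎ (Σ ℕ λ e → Σ ℕ λ x → Σ ℕ λ y → encMaybe a ≡ suc (claim e x y) × Rule (Member (codeSeq s)) e x y)
Justified-∷⁻ a s rewrite π₁-pair (encMaybe a) (codeSeq s) | π₂-pair (encMaybe a) (codeSeq s) = id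

Justified-∷⁺ : ∀ a s →
               encMaybe a ≡ 0 ⊎ (Σ ℕ λ e → Σ ℕ λ x → Σ ℕ λ y → encMaybe a ≡ suc (claim e x y) × Rule (Member (codeSeq s)) e x y) →
               Justified (codeSeq (a ∷ s))
Justified-∷⁺ a s rewrite π₁-pair (encMaybe a) (codeSeq s) | π₂-pair (encMaybe a) (codeSeq s) = id

JustifiedSeq-sound : ∀ s → JustifiedSeq s → ∀ {e x y} → just (claim e x y) ∈ s → Eval e x y
JustifiedSeq-sound (.(just (claim e x y)) ∷ s) j {e} {x} {y} (here refl)
  with Justified-∷⁻ (just (claim e x y)) s (j 0)
... | inj₂ (e′ , x′ , y′ , eq , r)
  with pair-injectiveˡ {e} {pair x y} {e′} (suc-injective eq)
     | pair-injectiveˡ {x} {y} {x′} (pair-injectiveʳ {e} {pair x y} {e′} (suc-injective eq))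
     | pair-injectiveʳ {x} {y} {x′} (pair-injectiveʳ {e} {pair x y} {e′} (suc-injective eq))
... | refl | refl | refl =
  Rule-sound {Member (codeSeq s)} (λ e x y m → JustifiedSeq-sound s (λ k → j (suc k)) {e} {x} {y} (Member⇒∈ {s} m)) r
JustifiedSeq-sound (a ∷ s) j {e} {x} {y} (there p) = JustifiedSeq-sound s (λ k → j (suc k)) {e} {x} {y} p

JustifiedSeq-[] : JustifiedSeq []
JustifiedSeq-[] zero    = inj₁ refl
JustifiedSeq-[] (suc k) = inj₁ refl

JustifiedSeq-∷ : ∀ a s → Justified (codeSeq (a ∷ s)) → JustifiedSeq s → JustifiedSeq (a ∷ s)
JustifiedSeq-∷ a s h j zero    = h
JustifiedSeq-∷ a s h j (suc k) = j k

JustifiedSeq-++ : ∀ s r → JustifiedSeq s → JustifiedSeq r → JustifiedSeq (s ++ r)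
JustifiedSeq-++ []      r js jr = jr
JustifiedSeq-++ (a ∷ s) r js jr = JustifiedSeq-∷ a (s ++ r)
  (Justified-∷⁺ a (s ++ r) (weaken (Justified-∷⁻ a s (js 0))))
  (JustifiedSeq-++ s r (λ k → js (suc k)) jr)
  where
  weaken : _ → _
  weaken (inj₁ z) = inj₁ z
  weaken (inj₂ (e , x , y , eq , rule)) =
    inj₂ (e , x , y , eq , Rule-mono {Member (codeSeq s)} {Member (codeSeq (s ++ r))} (λ m → ∈⇒Member (∈-++⁺ˡ (Member⇒∈ {s} m))) rule)

Derivation : ℕ → Set
Derivation t = Σ Seq λ s → JustifiedSeq s × just t ∈ s

derive : ∀ s → JustifiedSeq s → ∀ e x y → Rule (λ t → just t ∈ s) e x y → Derivation (claim e x y)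
derive s j e x y r = just (claim e x y) ∷ s ,
  JustifiedSeq-∷ (just (claim e x y)) s
    (Justified-∷⁺ (just (claim e x y)) s (inj₂ (e , x , y , refl , Rule-mono {λ t → just t ∈ s} {Member (codeSeq s)} ∈⇒Member r))) j ,
  here refl

derive₂ : ∀ {t u} → Derivation t → Derivation u → Σ Seq λ s → JustifiedSeq s × just t ∈ s × just u ∈ s
derive₂ (s , j , p) (r , k , q) = s ++ r , JustifiedSeq-++ s r j k , ∈-++⁺ˡ p , ∈-++⁺ʳ s q

derive< : ∀ {t : ℕ → ℕ → ℕ} n → (∀ z → z < n → Σ ℕ λ v → Derivation (t z v)) →
          Σ Seq λ s → JustifiedSeq s × (∀ z → z < n → Σ ℕ λ v → just (t z v) ∈ s)
derive< zero    h = [] , JustifiedSeq-[] , λ _ ()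
derive< {t} (suc n) h with derive< {t} n (λ z z< → h z (m<n⇒m<1+n z<)) | h n ≤-refl
... | s , j , k | v , r , jr , p = s ++ r , JustifiedSeq-++ s r j jr , λ z z< → case z (m<1+n⇒m<n∨m≡n z<)
  where
  case : ∀ z → z < n ⊎ z ≡ n → Σ ℕ λ v → just (t z v) ∈ s ++ r
  case z (inj₁ z<)    = map₂ ∈-++⁺ˡ (k z z<)
  case .n (inj₂ refl) = v , ∈-++⁺ʳ s p

Eval⇒Derivation : ∀ {e x y} → Eval e x y → Derivation (claim e x y)
Eval⇒Derivation {e} {x} {y} ev-Z = derive [] JustifiedSeq-[] e x y (inj₁ (refl , refl))
Eval⇒Derivation {e} {x} {y} ev-S = derive [] JustifiedSeq-[] e x y (inj₂ (inj₁ (refl , refl)))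
Eval⇒Derivation {e} {x} {y} ev-I = derive [] JustifiedSeq-[] e x y (inj₂ (inj₂ (inj₁ (refl , refl))))
Eval⇒Derivation {e} {x} {y} (ev-L {a} {b}) =
  derive [] JustifiedSeq-[] e (pair a b) y (inj₂ (inj₂ (inj₂ (inj₁ (refl , sym (π₁-pair a b))))))
Eval⇒Derivation {e} {x} {y} (ev-R {a} {b}) =
  derive [] JustifiedSeq-[] e (pair a b) y (inj₂ (inj₂ (inj₂ (inj₂ (inj₁ (refl , sym (π₂-pair a b)))))))
Eval⇒Derivation {e} {x} {y} (ev-comp {f} {g} p q) with derive₂ (Eval⇒Derivation p) (Eval⇒Derivation q)
... | s , j , m , n = derive s j (cComp f g) x y
  (inj₂ (inj₂ (inj₂ (inj₂ (inj₂ (inj₁ (f , g , _ , refl , m , n)))))))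
Eval⇒Derivation {e} {x} {y} (ev-pair {f} {g} {_} {u} {v} p q) with derive₂ (Eval⇒Derivation p) (Eval⇒Derivation q)
... | s , j , m , n = derive s j (cPair f g) x (pair u v)
  (inj₂ (inj₂ (inj₂ (inj₂ (inj₂ (inj₂ (inj₁ (f , g , u , v , refl , refl , m , n))))))))
Eval⇒Derivation {e} {x} {y} (ev-rec0 {f} {g} {a} p) with Eval⇒Derivation p
... | s , j , m = derive s j (cRec f g) (pair a 0) y
  (inj₂ (inj₂ (inj₂ (inj₂ (inj₂ (inj₂ (inj₂ (inj₁ (f , g , a , refl , refl , m)))))))))
Eval⇒Derivation {e} {x} {y} (ev-recS {f} {g} {a} {n} {u} p q) with derive₂ (Eval⇒Derivation p) (Eval⇒Derivation q)
... | s , j , m , m′ = derive s j (cRec f g) (pair a (suc n)) y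
  (inj₂ (inj₂ (inj₂ (inj₂ (inj₂ (inj₂ (inj₂ (inj₂ (inj₁ (f , g , a , n , u , refl , refl , m , m′))))))))))
Eval⇒Derivation {e} {x} {y} (ev-mu {f} p q)
  with Eval⇒Derivation p | derive< {λ z v → claim f (pair x z) (suc v)} y (λ z z< → proj₁ (q z z<) , Eval⇒Derivation (proj₂ (q z z<)))
... | s , j , m | r , k , h = derive (s ++ r) (JustifiedSeq-++ s r j k) (cMu f) x y
  (inj₂ (inj₂ (inj₂ (inj₂ (inj₂ (inj₂ (inj₂ (inj₂ (inj₂
    (f , refl , ∈-++⁺ˡ m , λ z z< → map₂ (∈-++⁺ʳ s) (h z z<)))))))))))

-- A form of Kleene's normal form theorem: an evaluation is witnessed by a finite sequence of
-- justified claims. Its code suffices as a bound on the suffixes to be checked, since all later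
-- suffixes are empty.
derivableˢ : Sg 3
derivableˢ = exˢ (allˢ x₀ (subˢ justifiedˢ (ap₂ tlsᶠ x₁ x₀ ∷ [])) ∧ˢ memberˢ x₀ (claimᵗ x₁ x₂ x₃))

derivableˢ-correct : ∀ e x y → ⟦ derivableˢ ⟧ˢ (e ∷ x ∷ y ∷ []) ⇔ Eval e x y
derivableˢ-correct e x y = mk⇔ fwd bwd
  where
  fwd : ⟦ derivableˢ ⟧ˢ (e ∷ x ∷ y ∷ []) → Eval e x y
  fwd (D , j , m) = JustifiedSeq-sound s js {e} {x} {y} (Member⇒∈ {s} (subst (λ D → Member D (claim e x y)) (sym eq) m))
    where
    s = decodeSeq D
    eq : codeSeq s ≡ D
    eq = codeSeq-decodeSeq D
    js : JustifiedSeq s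
    js k with k <? D
    ... | yes k<D = subst Justified (trans (cong (λ D → tls D k) (sym eq)) (tls-codeSeq s k)) (j k k<D)
    ... | no  k≮D = subst (λ s → Justified (codeSeq s)) (sym (drop-all s k (≤-trans (subst (length s ≤_) eq (length≤codeSeq s)) (≮⇒≥ k≮D)))) (inj₁ refl)
      where
      drop-all : ∀ (s : Seq) k → length s ≤ k → drop k s ≡ []
      drop-all []      zero    _         = refl
      drop-all []      (suc k) _         = refl
      drop-all (_ ∷ s) (suc k) (s≤s s≤k) = drop-all s k s≤k
  bwd : Eval e x y → ⟦ derivableˢ ⟧ˢ (e ∷ x ∷ y ∷ [])
  bwd ev with Eval⇒Derivation ev
  ... | s , j , m = codeSeq s , (λ k _ → subst Justified (sym (tls-codeSeq s k)) (j k)) , ∈⇒Member m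

opaque
  evalˢ : Sg 3
  evalˢ = derivableˢ

  evalˢ-correct : ∀ e x y → ⟦ evalˢ ⟧ˢ (e ∷ x ∷ y ∷ []) ⇔ Eval e x y
  evalˢ-correct = derivableˢ-correct

-- Locking sequences and limits

weaken₂ : ∀ {n} → Vec (Tm (2 + n)) n
weaken₂ = tabulate (λ i → var (suc (suc i)))

⟦tabulate⟧ : ∀ {m n} (f : Fin m → Tm n) v → ⟦ tabulate f ⟧ᵛ v ≡ tabulate (λ i → ⟦ f i ⟧ᵗ v)
⟦tabulate⟧ {zero}  f v = refl
⟦tabulate⟧ {suc m} f v = cong (⟦ f zero ⟧ᵗ v ∷_) (⟦tabulate⟧ (f ∘ suc) v)

⟦weaken₂⟧ : ∀ {n} x y (v : Vec ℕ n) → ⟦ weaken₂ ⟧ᵛ (x ∷ y ∷ v) ≡ v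
⟦weaken₂⟧ x y v = trans (⟦tabulate⟧ (λ i → var (suc (suc i))) (x ∷ y ∷ v)) (tabulate∘lookup v)

Over : (ℕ → Set) → Seq → Set
Over P s = ∀ y → just y ∈ s → P y

overˢ : ∀ {n} → Sg (suc n) → Sg (suc n)
overˢ φ = allˢ x₀ (dec (ap₂ entryᶠ x₁ x₀ == lit 0) ∨ˢ subˢ φ (ap₁ predᶠ (ap₂ entryᶠ x₁ x₀) ∷ weaken₂))

overˢ-correct : ∀ {n} (φ : Sg (suc n)) s v → ⟦ overˢ φ ⟧ˢ (codeSeq s ∷ v) ⇔ Over (λ y → ⟦ φ ⟧ˢ (y ∷ v)) s
overˢ-correct φ s v = mk⇔ fwd bwd
  where
  fwd : ⟦ overˢ φ ⟧ˢ (codeSeq s ∷ v) → Over (λ y → ⟦ φ ⟧ˢ (y ∷ v)) s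
  fwd h y y∈s with ∈-entry y∈s
  ... | i , i< , eq with h i i<
  ... | inj₁ z = contradiction (trans (sym eq) z) λ ()
  ... | inj₂ p = subst₂ (λ c w → ⟦ φ ⟧ˢ (c ∷ w)) (cong pred eq) (⟦weaken₂⟧ i (codeSeq s) v) p
  bwd : Over (λ y → ⟦ φ ⟧ˢ (y ∷ v)) s → ⟦ overˢ φ ⟧ˢ (codeSeq s ∷ v)
  bwd h i i< with entry (codeSeq s) i in eq
  ... | zero  = inj₁ refl
  ... | suc y = inj₂ (subst (λ w → ⟦ φ ⟧ˢ (y ∷ w)) (sym (⟦weaken₂⟧ i (codeSeq s) v)) (h y (entry-∈ s i eq)))

extendsᶠ : Fm 2
extendsᶠ = all x₁ (ap₂ tlsᶠ x₂ x₀ == lit 0 ∨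
  -- Past its end a sequence reads as pauses, so it must be required separately that the longer
  -- sequence has not ended.
  neg (ap₂ tlsᶠ x₁ x₀ == lit 0) ∧ ap₂ entryᶠ x₂ x₀ == ap₂ entryᶠ x₁ x₀)

extendsᶠ-correct : ∀ r s → ⟦ extendsᶠ ⟧ (codeSeq r ∷ codeSeq s ∷ []) ⇔ (Σ Seq λ τ → r ≡ s ++ τ)
extendsᶠ-correct r s = mk⇔ (λ h → fwd r s (λ i i< → subst₂ Agree (tls-codeSeq s i) (tls-codeSeq r i) (h i (<-≤-trans i< (length≤codeSeq s)))))
  (λ (τ , eq) i _ → subst₂ Agree (sym (tls-codeSeq s i)) (sym (tls-codeSeq r i)) (bwd r s τ eq i))
  where
  Agree : ℕ → ℕ → Set
  Agree c d = c ≡ 0 ⊎ (¬ (d ≡ 0) × hd c ≡ hd d)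
  fwd : ∀ r s → (∀ i → i < length s → Agree (codeSeq (drop i s)) (codeSeq (drop i r))) → Σ Seq λ τ → r ≡ s ++ τ
  fwd r       []      h = r , refl
  fwd []      (a ∷ s) h with h 0 (s≤s z≤n)
  ... | inj₂ (≢0 , _) = contradiction refl ≢0
  fwd (b ∷ r) (a ∷ s) h with h 0 (s≤s z≤n)
  ... | inj₂ (_ , eq) with fwd r s (λ i i< → h (suc i) (s≤s i<))
  ... | τ , refl = τ , cong (_∷ s ++ τ) (encMaybe-injective (trans (sym (hd-codeSeq b r)) (trans (sym eq) (hd-codeSeq a s))))
  bwd : ∀ r s τ → r ≡ s ++ τ → ∀ i → Agree (codeSeq (drop i s)) (codeSeq (drop i r))
  bwd r []      τ eq   zero    = inj₁ refl
  bwd r []      τ eq   (suc i) = inj₁ refl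
  bwd r (a ∷ s) τ refl zero    = inj₂ ((λ ()) , trans (hd-codeSeq a s) (sym (hd-codeSeq a (s ++ τ))))
  bwd r (a ∷ s) τ refl (suc i) = bwd (s ++ τ) s τ refl i

Over-++ : ∀ {P} s {r} → Over P s → Over P r → Over P (s ++ r)
Over-++ s p q y y∈ with ∈-++⁻ s y∈
... | inj₁ y∈s = p y y∈s
... | inj₂ y∈r = q y y∈r

output : Learner → Seq → ℕ
output M s = encMaybe (run M s)

outputᶜ : Learner → ℕ → ℕ
outputᶜ M c = output M (decodeSeq c)

outputᶠ : ∀ M → Fn₁ (outputᶜ M)
outputᶠ M = proj₁ (computable M) , λ c →
  subst (λ d → Eval (proj₁ (computable M)) d (outputᶜ M c)) (codeSeq-decodeSeq c) (proj₂ (computable M) (decodeSeq c))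

outputᶜ-codeSeq : ∀ M s → outputᶜ M (codeSeq s) ≡ output M s
outputᶜ-codeSeq M s = cong (output M) (codeSeq-injective (codeSeq-decodeSeq (codeSeq s)))

-- On some extension of s over P the learner issues a hypothesis beyond codeSeq s,
-- so s is a locking sequence for P, with codeSeq s bounding all later hypotheses, iff this fails.
Responds : Learner → (ℕ → Set) → Seq → Set
Responds M P s = Σ Seq λ τ → Over P (s ++ τ) × codeSeq s < output M (s ++ τ)

Responds-⊆ : ∀ {M P Q s} → (∀ y → P y → Q y) → Responds M P s → Responds M Q s
Responds-⊆ f (τ , o , l) = τ , (λ y y∈ → f y (o y y∈)) , l

respondsˢ : ∀ {n} → Learner → Sg (suc n) → Sg (suc n)
respondsˢ M φ = exˢ (dec (sub extendsᶠ (x₀ ∷ x₁ ∷ [])) ∧ˢ subˢ (overˢ φ) (x₀ ∷ weaken₂) ∧ˢ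
                     dec (x₁ << ap₁ (outputᶠ M) x₀))

respondsˢ-correct : ∀ {n} M (φ : Sg (suc n)) s v →
                    ⟦ respondsˢ M φ ⟧ˢ (codeSeq s ∷ v) ⇔ Responds M (λ y → ⟦ φ ⟧ˢ (y ∷ v)) s
respondsˢ-correct M φ s v = mk⇔ fwd bwd
  where
  fwd : ⟦ respondsˢ M φ ⟧ˢ (codeSeq s ∷ v) → Responds M (λ y → ⟦ φ ⟧ˢ (y ∷ v)) s
  fwd (c , h) with codeSeq-surjective c
  fwd (.(codeSeq r) , e , o , l) | r , refl with to (extendsᶠ-correct r s) e
  ... | τ , refl = τ ,
    to (overˢ-correct φ (s ++ τ) v) (subst (λ w → ⟦ overˢ φ ⟧ˢ (codeSeq (s ++ τ) ∷ w)) (⟦weaken₂⟧ (codeSeq (s ++ τ)) (codeSeq s) v) o) , l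
  bwd : Responds M (λ y → ⟦ φ ⟧ˢ (y ∷ v)) s → ⟦ respondsˢ M φ ⟧ˢ (codeSeq s ∷ v)
  bwd (τ , o , l) = codeSeq (s ++ τ) , from (extendsᶠ-correct (s ++ τ) s) (τ , refl) ,
    subst (λ w → ⟦ overˢ φ ⟧ˢ (codeSeq (s ++ τ) ∷ w)) (sym (⟦weaken₂⟧ (codeSeq (s ++ τ)) (codeSeq s) v)) (from (overˢ-correct φ (s ++ τ) v) o) ,
    subst (codeSeq s <_) (sym (outputᶜ-codeSeq M (s ++ τ))) l

-- Convergence in the sense of the limit lemma: the truth value of `A t` is eventually that of `Q`.
-- The closure properties below yield approximations to conditions that are not Σ₁, such as being a
-- locking sequence.
Stabilises : (ℕ → Set) → Set → Set
Stabilises A Q = Σ ℕ λ t₀ → ∀ t → t₀ ≤ t → A t ⇔ Q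

stab-× : ∀ {A B P Q} → Stabilises A P → Stabilises B Q → Stabilises (λ t → A t × B t) (P × Q)
stab-× (t , f) (u , g) = t + u , λ v h →
  let a = f v (≤-trans (m≤m+n t u) h); b = g v (≤-trans (m≤n+m u t) h) in
  mk⇔ (λ (x , y) → to a x , to b y) (λ (x , y) → from a x , from b y)

stab-¬ : ∀ {A P} → Stabilises A P → Stabilises (λ t → ¬ A t) (¬ P)
stab-¬ (t , f) = t , λ v h → mk⇔ (λ ¬a p → ¬a (from (f v h) p)) (λ ¬p a → ¬p (to (f v h) a))

stab-all : ∀ {A : ℕ → ℕ → Set} {P : ℕ → Set} b → (∀ x → x < b → Stabilises (λ t → A t x) (P x)) →
           Stabilises (λ t → ∀ x → x < b → A t x) (∀ x → x < b → P x)
stab-all {A} {P} b h with bounded-stage {λ x t₀ → ∀ t → t₀ ≤ t → A t x ⇔ P x} (λ t≤u f v u≤v → f v (≤-trans t≤u u≤v)) b h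
... | t₀ , f = t₀ , λ t t₀≤t → mk⇔ (λ g x x< → to (f x x< t t₀≤t) (g x x<)) (λ g x x< → from (f x x< t t₀≤t) (g x x<))

-- A true Σ₁ statement is confirmed from some stage on, a false one never; excluded middle decides
-- between the two cases.
stab-at : ExcludedMiddle 0ℓ → ∀ {n} (φ : Sg n) v → Stabilises (λ t → ⟦ φ ⟧[ t ] v) (⟦ φ ⟧ˢ v)
stab-at em φ v with em {⟦ φ ⟧ˢ v}
... | yes p = let t₀ , q = stage-complete φ p in t₀ , λ t t₀≤t → mk⇔ (λ _ → p) (λ _ → stage-mono φ t₀≤t q)
... | no ¬p = 0 , λ t _ → mk⇔ (stage-sound φ) (λ p → contradiction p ¬p)

-- The first stage from which `Q` holds for good. It is unique, and for decidable `Q` a wrong `s` is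
-- refuted at a finite stage; both are needed for a one-one numbering.
LastChange : (ℕ → Set) → ℕ → Set
LastChange Q s = (∀ t → s ≤ t → Q t) × ¬ (0 < s × Q (s ∸ 1))

lastChange : ExcludedMiddle 0ℓ → ∀ {Q P} → Stabilises Q P → P → Σ ℕ (LastChange Q)
lastChange em {Q} (t₀ , f) p with least (λ s → em {∀ t → s ≤ t → Q t}) t₀ (λ t h → from (f t h) p)
... | s , always , _ , min = s , always , earlier s always min
  where
  earlier : ∀ s → (∀ t → s ≤ t → Q t) → (∀ k → k < s → ¬ (∀ t → k ≤ t → Q t)) → ¬ (0 < s × Q (s ∸ 1))
  earlier (suc s) always min (_ , q) = min s ≤-refl (λ t s≤t → case t (m≤n⇒m<n∨m≡n s≤t))
    where
    case : ∀ t → s < t ⊎ s ≡ t → Q t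
    case t (inj₁ s<t)  = always t s<t
    case .s (inj₂ refl) = q

lastChange-≮ : ∀ {Q s s′} → LastChange Q s → LastChange Q s′ → ¬ (s < s′)
lastChange-≮ {s′ = suc s′} (a , _) (_ , b) (s≤s s≤s′) = b (s≤s z≤n , a s′ s≤s′)

lastChange-unique : ∀ {Q s s′} → LastChange Q s → LastChange Q s′ → s ≡ s′
lastChange-unique p q = ≤-antisym (≮⇒≥ (lastChange-≮ q p)) (≮⇒≥ (lastChange-≮ p q))

-- Ranks of classes

Σ<-mono : ∀ {f g} n → (∀ x → f x ≤ g x) → Σ< n f ≤ Σ< n g
Σ<-mono zero    h = z≤n
Σ<-mono (suc n) h = +-mono-≤ (Σ<-mono n h) (h n)

module Rank (em : ExcludedMiddle 0ℓ) (η : ℕ → ℕ → Set) (pos : Positive η) where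
  open Positive pos
  open IsEquivalence isEquivalence renaming (refl to η-refl; sym to η-sym; trans to η-trans)

  opaque
    ηˢ : Sg 2
    ηˢ = exˢ (subˢ evalˢ (lit (proj₁ re) ∷ pairᵗ x₁ x₂ ∷ x₀ ∷ []))

    ηˢ-correct : ∀ x y → ⟦ ηˢ ⟧ˢ (x ∷ y ∷ []) ⇔ η x y
    ηˢ-correct x y = mk⇔ fwd bwd
      where
      fwd : ⟦ ηˢ ⟧ˢ (x ∷ y ∷ []) → η x y
      fwd (z , h) with from (proj₂ re (pair x y)) (z , to (evalˢ-correct (proj₁ re) (pair x y) z) h)
      ... | x′ , y′ , eq , p = subst₂ η (sym (pair-injectiveˡ {x} {y} {x′} eq)) (sym (pair-injectiveʳ {x} {y} {x′} eq)) p
      bwd : η x y → ⟦ ηˢ ⟧ˢ (x ∷ y ∷ [])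
      bwd p with to (proj₂ re (pair x y)) (x , y , refl , p)
      ... | z , ev = z , from (evalˢ-correct (proj₁ re) (pair x y) z) ev

  η-stage : ∀ {t x y} → ⟦ ηˢ ⟧[ t ] (x ∷ y ∷ []) → η x y
  η-stage {x = x} {y} h = to (ηˢ-correct x y) (stage-sound ηˢ h)

  Least : ℕ → Set
  Least w = ∀ u → u < w → ¬ η u w

  leastᶠ : Fm 2
  leastᶠ = all x₁ (neg (at x₁ ηˢ (x₀ ∷ x₂ ∷ [])))

  leastᶠ-complete : ∀ t w → Least w → ⟦ leastᶠ ⟧ (t ∷ w ∷ [])
  leastᶠ-complete t w h u u<w p = h u u<w (η-stage p)

  stab-η : ∀ x y → Stabilises (λ t → ⟦ ηˢ ⟧[ t ] (x ∷ y ∷ [])) (η x y)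
  stab-η x y with stab-at em ηˢ (x ∷ y ∷ [])
  ... | t₀ , f = t₀ , λ t h → mk⇔ (λ p → to (ηˢ-correct x y) (to (f t h) p)) (λ p → from (f t h) (from (ηˢ-correct x y) p))

  stab-least : ∀ w → Stabilises (λ t → ⟦ leastᶠ ⟧ (t ∷ w ∷ [])) (Least w)
  stab-least w = stab-all w (λ u _ → stab-¬ (stab-η u w))

  indicatorᵗ : ℕ → ℕ → ℕ
  indicatorᵗ t w = 1 ∸ χ leastᶠ (t ∷ w ∷ [])

  countᵗ : ℕ → ℕ → ℕ
  countᵗ t n = Σ< n (indicatorᵗ t)

  countᵗᶠ : Fn₂ countᵗ
  countᵗᶠ = proj₁ c , λ t n → proj₂ c (t , n)
    where
    c : Cn (id ⊗ id) (λ (t , n) → countᵗ t n)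
    c = foldᶜ {ι = id ⊗ id} +ᶠ 0 (sndᶜ {ι = id} {κ = id})
          (op₂ ∸ᶠ (constᶜ 1) (reindex {κ = enc} (λ (k , t , n) → t ∷ k ∷ []) (codeFm leastᶠ)
            (pairᶜ (reindex {κ = id ⊗ id} proj₂ (fstᶜ {ι = id} {κ = id}) (sndᶜ {ι = id} {κ = id ⊗ id}))
                   (pairᶜ (fstᶜ {ι = id} {κ = id ⊗ id}) (constᶜ 0)))))

  indicator : ℕ → ℕ
  indicator w with em {Least w}
  ... | yes _ = 1
  ... | no  _ = 0

  indicator-Least : ∀ {w} → Least w → indicator w ≡ 1
  indicator-Least {w} h with em {Least w}
  ... | yes _ = refl
  ... | no ¬h = contradiction h ¬h

  indicator≤1 : ∀ w → indicator w ≤ 1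
  indicator≤1 w with em {Least w}
  ... | yes _ = ≤-refl
  ... | no  _ = z≤n

  -- The number of classes having an element below n.
  count : ℕ → ℕ
  count n = Σ< n indicator

  indicatorᵗ≡ : ∀ {t w} → ⟦ leastᶠ ⟧ (t ∷ w ∷ []) → indicatorᵗ t w ≡ 1
  indicatorᵗ≡ {t} {w} h = cong (1 ∸_) (from (χ≡0⇔ leastᶠ (t ∷ w ∷ [])) h)

  indicator≤ᵗ : ∀ t w → indicator w ≤ indicatorᵗ t w
  indicator≤ᵗ t w with em {Least w}
  ... | yes h = ≤-reflexive (sym (indicatorᵗ≡ {t} {w} (leastᶠ-complete t w h)))
  ... | no  _ = z≤n

  -- At a finite stage equivalent numbers may still look inequivalent, so the approximated count
  -- errs upwards only. Therefore an upper bound on a rank is a Σ₁ condition, as used in `Cˢ`.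
  count≤countᵗ : ∀ t n → count n ≤ countᵗ t n
  count≤countᵗ t n = Σ<-mono n (indicator≤ᵗ t)

  indicatorᵗ-limit : ∀ w → Σ ℕ λ t₀ → ∀ t → t₀ ≤ t → indicatorᵗ t w ≡ indicator w
  indicatorᵗ-limit w with em {Least w} | stab-least w
  ... | yes h | t₀ , f = 0 , λ t _ → indicatorᵗ≡ {t} {w} (leastᶠ-complete t w h)
  ... | no ¬h | t₀ , f = t₀ , λ t t₀≤t → case t (χ leastᶠ (t ∷ w ∷ [])) refl (λ eq → ¬h (to (f t t₀≤t) (to (χ≡0⇔ leastᶠ (t ∷ w ∷ [])) eq)))
    where
    case : ∀ t c → χ leastᶠ (t ∷ w ∷ []) ≡ c → χ leastᶠ (t ∷ w ∷ []) ≢ 0 → 1 ∸ χ leastᶠ (t ∷ w ∷ []) ≡ 0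
    case t zero    eq ne = contradiction eq ne
    case t (suc c) eq ne = trans (cong (1 ∸_) eq) (0∸n≡0 c)

  countᵗ-limit : ∀ n → Σ ℕ λ t₀ → ∀ t → t₀ ≤ t → countᵗ t n ≡ count n
  countᵗ-limit zero    = 0 , λ _ _ → refl
  countᵗ-limit (suc n) with countᵗ-limit n | indicatorᵗ-limit n
  ... | t , f | u , g = t + u , λ v h → cong₂ _+_ (f v (≤-trans (m≤m+n t u) h)) (g v (≤-trans (m≤n+m u t) h))

  stab-count : ∀ n k → Stabilises (λ t → countᵗ t n ≡ k) (count n ≡ k)
  stab-count n k with countᵗ-limit n
  ... | t₀ , f = t₀ , λ t h → mk⇔ (trans (sym (f t h))) (trans (f t h))

  Σ<-monoˡ : ∀ f {m n} → m ≤ n → Σ< m f ≤ Σ< n f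
  Σ<-monoˡ f {m} m≤n = go (≤⇒≤′ m≤n)
    where
    go : ∀ {n} → m ≤′ n → Σ< m f ≤ Σ< n f
    go ≤′-refl           = ≤-refl
    go (≤′-step {n} m≤n) = ≤-trans (go m≤n) (m≤m+n (Σ< n f) (f n))

  count-mono : ∀ {m n} → m ≤ n → count m ≤ count n
  count-mono = Σ<-monoˡ indicator

  count-suc : ∀ {w} → Least w → count (suc w) ≡ suc (count w)
  count-suc {w} h = trans (cong (count w +_) (indicator-Least h)) (+-comm (count w) 1)

  count-< : ∀ {u v} → Least u → u < v → count u < count v
  count-< {u} {v} h u<v = subst (_≤ count v) (count-suc h) (count-mono {suc u} {v} u<v)

  count≤ : ∀ n → count n ≤ n
  count≤ zero    = z≤n
  count≤ (suc n) = subst (count n + indicator n ≤_) (+-comm n 1) (+-mono-≤ (count≤ n) (indicator≤1 n))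

  Least-unique : ∀ {u v} → Least u → Least v → η u v → u ≡ v
  Least-unique {u} {v} hu hv p with <-cmp u v
  ... | tri< u<v _ _ = contradiction p (hv u u<v)
  ... | tri≈ _ u≡v _ = u≡v
  ... | tri> _ _ v<u = contradiction (η-sym p) (hu v v<u)

  leastRep : ∀ x → Σ ℕ λ u → η u x × u ≤ x × Least u
  leastRep x with least (λ u → em {η u x}) x η-refl
  ... | u , p , u≤x , min = u , p , u≤x , λ k k<u q → min k k<u (η-trans q p)

  rank : ℕ → ℕ
  rank x = count (proj₁ (leastRep x))

  rank≤ : ∀ x → rank x ≤ x
  rank≤ x = let u , _ , u≤x , _ = leastRep x in ≤-trans (count≤ u) u≤x

  count-injective : ∀ {u v} → Least u → Least v → count u ≡ count v → u ≡ v
  count-injective {u} {v} hu hv eq with <-cmp u v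
  ... | tri< u<v _ _ = contradiction eq (<⇒≢ (count-< hu u<v))
  ... | tri≈ _ u≡v _ = u≡v
  ... | tri> _ _ v<u = contradiction (sym eq) (<⇒≢ (count-< hv v<u))

  rank-cong : ∀ {x y} → η x y → rank x ≡ rank y
  rank-cong {x} {y} p = let u , pu , _ , hu = leastRep x ; v , pv , _ , hv = leastRep y in
    cong count (Least-unique hu hv (η-trans pu (η-trans p (η-sym pv))))

  rank-injective : ∀ {x y} → rank x ≡ rank y → η x y
  rank-injective {x} {y} eq = let u , pu , _ , hu = leastRep x ; v , pv , _ , hv = leastRep y in
    η-trans (η-sym pu) (subst (λ u → η u y) (sym (count-injective hu hv eq)) pv)

  rank-Least : ∀ {w} → Least w → rank w ≡ count w
  rank-Least {w} h = let u , pu , _ , hu = leastRep w in cong count (Least-unique hu h pu)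

  Least-above : ∀ m → Σ ℕ λ w → m ≤ w × Least w
  Least-above m with infClasses (upTo m)
  ... | x , new = let u , pu , _ , hu = leastRep x in
    u , ≮⇒≥ (λ u<m → All.lookup new (∈-upTo⁺ u<m) (η-sym pu)) , hu

  count-unbounded : ∀ k → Σ ℕ λ n → k ≤ count n
  count-unbounded zero    = 0 , z≤n
  count-unbounded (suc k) with count-unbounded k
  ... | n , k≤ with Least-above n
  ... | w , n≤w , h = suc w , subst (suc k ≤_) (sym (count-suc h)) (s≤s (≤-trans k≤ (count-mono n≤w)))

  -- `count` is unbounded and grows by at most one at a time, namely at least elements, so it passes
  -- through every value.
  representative : ∀ i → Σ ℕ λ w → Least w × rank w ≡ i
  representative i = let n , i<n = count-unbounded (suc i) in go n i<n
    where
    go : ∀ n → i < count n → Σ ℕ λ w → Least w × rank w ≡ i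
    go (suc n) i< with i <? count n | em {Least n}
    ... | yes i<n | _     = go n i<n
    ... | no  i≮n | yes h = n , h , trans (rank-Least h) (≤-antisym (≮⇒≥ i≮n) (s≤s⁻¹ (subst (suc i ≤_) (+-comm (count n) 1) i<)))
    ... | no  i≮n | no ¬h = contradiction (subst (suc i ≤_) (+-identityʳ (count n)) i<) i≮n

  rep : ℕ → ℕ
  rep i = proj₁ (representative i)

  Least-rep : ∀ i → Least (rep i)
  Least-rep i = proj₁ (proj₂ (representative i))

  rank-rep : ∀ i → rank (rep i) ≡ i
  rank-rep i = proj₂ (proj₂ (representative i))

  C : ℕ → ℕ → Set
  C k x = rank x < k

  opaque
    Cˢ : Sg 2
    Cˢ = exˢ (exˢ (subˢ ηˢ (x₁ ∷ x₃ ∷ []) ∧ˢ dec (ap₂ countᵗᶠ x₀ x₁ << x₂)))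

    Cˢ-correct : ∀ k x → ⟦ Cˢ ⟧ˢ (k ∷ x ∷ []) ⇔ C k x
    Cˢ-correct k x = mk⇔ fwd bwd
      where
      fwd : ⟦ Cˢ ⟧ˢ (k ∷ x ∷ []) → C k x
      fwd (u , t , p , lt) = subst (_< k) (rank-cong (to (ηˢ-correct u x) p))
        (≤-<-trans (count-mono (proj₁ (proj₂ (proj₂ (leastRep u))))) (≤-<-trans (count≤countᵗ t u) lt))
      bwd : C k x → ⟦ Cˢ ⟧ˢ (k ∷ x ∷ [])
      bwd r = let u , p , _ , h = leastRep x ; t , f = countᵗ-limit u in
        u , t , from (ηˢ-correct u x) p , subst (_< k) (sym (f t ≤-refl)) r

  C-closed : ∀ k → EtaClosed η (C k)
  C-closed k x y p = subst (_< k) (rank-cong p)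

  -- The invariant that tells sets of the families apart; a learner can find it in the limit from a
  -- text.
  FirstGap : (ℕ → Set) → ℕ → Set
  FirstGap L i = (∀ x → rank x < i → L x) × (∀ x → rank x ≡ i → ¬ L x)

  FirstGap-≮ : ∀ {L L′ i i′} → SameSet L L′ → FirstGap L i → FirstGap L′ i′ → ¬ (i < i′)
  FirstGap-≮ {i = i} same (_ , miss) (hits , _) i<i′ =
    miss (rep i) (rank-rep i) (from (same (rep i)) (hits (rep i) (subst (_< _) (sym (rank-rep i)) i<i′)))

  FirstGap-unique : ∀ {L L′ i i′} → SameSet L L′ → FirstGap L i → FirstGap L′ i′ → i ≡ i′
  FirstGap-unique {L} {L′} same g g′ = ≤-antisym
    (≮⇒≥ (FirstGap-≮ {L′} {L} (λ x → mk⇔ (from (same x)) (to (same x))) g′ g)) (≮⇒≥ (FirstGap-≮ {L} {L′} same g g′))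

  FirstGap-C : ∀ k → FirstGap (C k) k
  FirstGap-C k = (λ _ → id) , λ x eq lt → <⇒≢ lt eq

-- Texts and learners

initSeg≡applyUpTo : ∀ T n → initSeg T n ≡ applyUpTo T n
initSeg≡applyUpTo = map-upTo

length-initSeg : ∀ T n → length (initSeg T n) ≡ n
length-initSeg T n = trans (cong length (initSeg≡applyUpTo T n)) (length-applyUpTo T n)

n≤codeSeq-initSeg : ∀ T n → n ≤ codeSeq (initSeg T n)
n≤codeSeq-initSeg T n = subst (_≤ codeSeq (initSeg T n)) (length-initSeg T n) (length≤codeSeq (initSeg T n))

∈-initSeg⁺ : ∀ T {k n} → k < n → T k ∈ initSeg T n
∈-initSeg⁺ T {k} {n} k<n = subst (T k ∈_) (sym (initSeg≡applyUpTo T n)) (∈-applyUpTo⁺ T k<n)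

∈-initSeg⁻ : ∀ T {n a} → a ∈ initSeg T n → Σ ℕ λ k → k < n × a ≡ T k
∈-initSeg⁻ T {n} {a} p = ∈-applyUpTo⁻ T (subst (a ∈_) (initSeg≡applyUpTo T n) p)

Over-initSeg : ∀ {T L} → IsTextFor T L → ∀ n → Over L (initSeg T n)
Over-initSeg {T} text n y p with ∈-initSeg⁻ T {n} p
... | k , _ , eq = from (text y) (k , sym eq)

eventually-∈ : ∀ {T L} → IsTextFor T L → ∀ l → (∀ x → x ∈ l → L x) →
               Σ ℕ λ n₀ → ∀ n → n₀ ≤ n → ∀ x → x ∈ l → just x ∈ initSeg T n
eventually-∈ text []      h = 0 , λ _ _ _ ()
eventually-∈ {T} text (x ∷ l) h with eventually-∈ text l (λ y p → h y (there p)) | to (text x) (h x (here refl))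
... | n₀ , f | k , eq = suc k + n₀ , λ n le → λ
  { .x (here refl) → subst (_∈ initSeg T n) eq (∈-initSeg⁺ T (≤-trans (m≤m+n (suc k) n₀) le))
  ; y (there p)   → f n (≤-trans (m≤n+m n₀ (suc k)) le) y p }

at-or-nothing : Seq → ℕ → Maybe ℕ
at-or-nothing []      _       = nothing
at-or-nothing (a ∷ s) zero    = a
at-or-nothing (a ∷ s) (suc k) = at-or-nothing s k

at-++ : ∀ s r k → k < length s → at-or-nothing (s ++ r) k ≡ at-or-nothing s k
at-++ (a ∷ s) r zero    _         = refl
at-++ (a ∷ s) r (suc k) (s≤s k<) = at-++ s r k k<

at-∈ : ∀ s k {x} → at-or-nothing s k ≡ just x → just x ∈ s
at-∈ (a ∷ s) zero    eq = here (sym eq)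
at-∈ (a ∷ s) (suc k) eq = there (at-∈ s k eq)

∈-at : ∀ {s a} → a ∈ s → Σ ℕ λ k → k < length s × at-or-nothing s k ≡ a
∈-at (here refl) = 0 , s≤s z≤n , refl
∈-at (there p)   = let k , k< , eq = ∈-at p in suc k , s≤s k< , eq

applyUpTo-at : ∀ (T : Text) s → (∀ k → k < length s → T k ≡ at-or-nothing s k) → applyUpTo T (length s) ≡ s
applyUpTo-at T []      h = refl
applyUpTo-at T (a ∷ s) h = cong₂ _∷_ (h 0 (s≤s z≤n)) (applyUpTo-at (T ∘ suc) s (λ k k< → h (suc k) (s≤s k<)))

infixr 5 _⊕_
_⊕_ : Seq → Text → Text
([] ⊕ T) k            = T k
((a ∷ s) ⊕ T) zero    = a
((a ∷ s) ⊕ T) (suc k) = (s ⊕ T) k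

applyUpTo-⊕ : ∀ s T n → applyUpTo (s ⊕ T) (length s + n) ≡ s ++ applyUpTo T n
applyUpTo-⊕ []      T n = refl
applyUpTo-⊕ (a ∷ s) T n = cong (a ∷_) (applyUpTo-⊕ s T n)

⊕-here : ∀ s T k → (s ⊕ T) (length s + k) ≡ T k
⊕-here []      T k = refl
⊕-here (a ∷ s) T k = ⊕-here s T k

⊕-∈ : ∀ s T k → (s ⊕ T) k ∈ s ⊎ (Σ ℕ λ j → (s ⊕ T) k ≡ T j)
⊕-∈ []      T k       = inj₂ (k , refl)
⊕-∈ (a ∷ s) T zero    = inj₁ (here refl)
⊕-∈ (a ∷ s) T (suc k) with ⊕-∈ s T k
... | inj₁ p = inj₁ (there p)
... | inj₂ q = inj₂ q

list-bound : ∀ (l : Seq) → Σ ℕ λ b → ∀ {a} → a ∈ l → encMaybe a ≤ b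
list-bound []      = 0 , λ ()
list-bound (a ∷ l) with list-bound l
... | b , h = encMaybe a + b , λ
  { (here refl) → m≤m+n (encMaybe a) b ; (there p) → ≤-trans (h p) (m≤n+m b (encMaybe a)) }

module Texts (em : ExcludedMiddle 0ℓ) where

  member? : (ℕ → Set) → ℕ → Maybe ℕ
  member? L n with em {L n}
  ... | yes _ = just n
  ... | no  _ = nothing

  member?-sound : ∀ {L n x} → member? L n ≡ just x → L x
  member?-sound {L} {n} eq with em {L n}
  member?-sound refl | yes p = p

  member?-complete : ∀ {L x} → L x → member? L x ≡ just x
  member?-complete {L} {x} p with em {L x}
  ... | yes _ = refl
  ... | no ¬p = contradiction p ¬p

  ⊕-text : ∀ {L} s → Over L s → IsTextFor (s ⊕ member? L) L
  ⊕-text {L} s over x = mk⇔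
    (λ p → length s + x , trans (⊕-here s (member? L) x) (member?-complete p))
    (λ (k , eq) → case k eq (⊕-∈ s (member? L) k))
    where
    case : ∀ k → (s ⊕ member? L) k ≡ just x → (s ⊕ member? L) k ∈ s ⊎ (Σ ℕ λ j → (s ⊕ member? L) k ≡ member? L j) → L x
    case k eq (inj₁ p)        = over x (subst (_∈ s) eq p)
    case k eq (inj₂ (j , eq′)) = member?-sound {L} {j} (trans (sym eq′) eq)

  module _ (M : Learner) (L : ℕ → Set) (responds : ∀ s → Over L s → Responds M L s) where

    private
      Segment : Set
      Segment = Σ Seq (Over L)

      extend : Segment → Seq
      extend (s , o) = s ++ proj₁ (responds s o)

      next : ℕ → Segment → Segment
      -- Appending `n` whenever it belongs to `L` makes the limit a text for all of `L`.
      next n (s , o) = extend (s , o) ++ [ member? L n ] ,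
        Over-++ (extend (s , o)) (proj₁ (proj₂ (responds s o)))
          (λ { y (here eq) → member?-sound {L} {n} (sym eq) })

      segment : ℕ → Segment
      segment zero    = [] , λ _ ()
      segment (suc n) = next n (segment n)

      seg : ℕ → Seq
      seg n = proj₁ (segment n)

      length-seg-suc : ∀ n → length (extend (segment n)) < length (seg (suc n))
      length-seg-suc n = subst (length (extend (segment n)) <_) (sym (length-++ (extend (segment n))))
        (subst (length (extend (segment n)) <_) (+-comm 1 _) ≤-refl)

      length-extend : ∀ n → length (seg n) ≤ length (extend (segment n))
      length-extend n = subst (length (seg n) ≤_) (sym (length-++ (seg n))) (m≤m+n _ _)

      n≤length-seg : ∀ n → n ≤ length (seg n)
      n≤length-seg zero    = z≤n
      n≤length-seg (suc n) = ≤-trans (s≤s (≤-trans (n≤length-seg n) (length-extend n))) (length-seg-suc n)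

      seg-prefix : ∀ {m n} → m ≤′ n → Σ Seq λ τ → seg n ≡ seg m ++ τ
      seg-prefix ≤′-refl = [] , sym (List.++-identityʳ _)
      seg-prefix {m} (≤′-step {n} m≤n) with seg-prefix m≤n
      ... | τ , eq = τ ++ proj₁ (responds _ _) ++ [ member? L n ] ,
        trans (cong (λ s → (s ++ ext) ++ [ member? L n ]) eq)
        (trans (++-assoc (seg m ++ τ) ext _) (++-assoc (seg m) τ _))
        where
        ext = proj₁ (responds (seg n) (proj₂ (segment n)))

      T : Text
      -- `seg (suc k)` is longer than `k`, so the default value is never read.
      T k = at-or-nothing (seg (suc k)) k

      T-seg : ∀ n k → k < length (seg n) → T k ≡ at-or-nothing (seg n) k
      T-seg n k k< with ≤-total (suc k) n
      ... | inj₁ h with seg-prefix (≤⇒≤′ h)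
      ... | τ , eq = sym (trans (cong (λ s → at-or-nothing s k) eq) (at-++ (seg (suc k)) τ k (n≤length-seg (suc k))))
      T-seg n k k< | inj₂ h with seg-prefix (≤⇒≤′ h)
      ... | τ , eq = trans (cong (λ s → at-or-nothing s k) eq) (at-++ (seg n) τ k k<)

      T-text : IsTextFor T L
      T-text x = mk⇔ fwd (λ (k , eq) → proj₂ (segment (suc k)) x (at-∈ (seg (suc k)) k eq))
        where
        fwd : L x → Σ ℕ λ k → T k ≡ just x
        fwd p with ∈-at {seg (suc x)} (∈-++⁺ʳ (extend (segment x)) (here {xs = []} (sym (member?-complete {L} p))))
        ... | k , k< , eq = k , trans (T-seg (suc x) k k<) eq

      initSeg-T : ∀ n → initSeg T (length (extend (segment n))) ≡ extend (segment n)
      initSeg-T n = trans (initSeg≡applyUpTo T _) (applyUpTo-at T (extend (segment n)) (λ k k< →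
        trans (T-seg (suc n) k (<-trans k< (length-seg-suc n))) (at-++ (extend (segment n)) _ k k<)))

      output-T : ∀ n → n < output M (initSeg T (length (extend (segment n))))
      output-T n = subst (λ s → n < output M s) (sym (initSeg-T n))
        (≤-<-trans (≤-trans (n≤length-seg n) (length≤codeSeq (seg n))) (proj₂ (proj₂ (responds (seg n) (proj₂ (segment n))))))

    -- The responses to ever longer segments are strung together. Since each hypothesis exceeds the
    -- code of its segment, and hence the length of that segment, the hypotheses on the resulting
    -- text are unbounded.
    no-locking⇒unbounded : Σ Text λ T → IsTextFor T L × (∀ b → Σ ℕ λ n → 1 ≤ n × b < output M (initSeg T n))
    no-locking⇒unbounded = T , T-text , λ b → length (extend (segment (suc b))) ,
      ≤-trans (≤-trans (s≤s z≤n) (n≤length-seg (suc b))) (length-extend (suc b)) , <-trans (n<1+n b) (output-T (suc b))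

  -- Finitely many outputs have a bound, which the text from `no-locking⇒unbounded` violates.
  locking : ∀ M L → (∀ T → IsTextFor T L → Σ Seq λ l → ∀ n → 1 ≤ n → run M (initSeg T n) ∈ l) →
            Σ Seq λ s → Over L s × ¬ Responds M L s
  locking M L vac with em {Σ Seq λ s → Over L s × ¬ Responds M L s}
  ... | yes p = p
  ... | no ¬p with no-locking⇒unbounded M L responds
    where
    responds : ∀ s → Over L s → Responds M L s
    responds s o with em {Responds M L s}
    ... | yes r = r
    ... | no ¬r = contradiction (s , o , ¬r) ¬p
  ... | T , text , unbounded with vac T text
  ... | l , h with list-bound l
  ... | b , bound with unbounded b
  ... | n , 1≤n , b< = contradiction (bound (h n 1≤n)) (<⇒≱ b<)

-- The learner merely writes down an index for the set defined by `φ` with the data as parameter;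
-- all work is left to the enumeration of that set. The index may change with every datum, which
-- behaviourally correct learning permits.
hypothesisLearner : Sg 2 → Learner
run (hypothesisLearner φ) s = just (section φ (codeSeq s))
computable (hypothesisLearner φ) = proj₁ c , λ s → proj₂ c (codeSeq s)
  where
  c : Fn₁ (λ x → suc (section φ x))
  c = sucᶠ ∘ᶠ sectionᶠ φ

module _ (η : ℕ → ℕ → Set) (B : ℕ → ℕ → Set) (φ : Sg 2) where

  hypothesis : Text → ℕ → ℕ → Set
  hypothesis T n z = ⟦ φ ⟧ˢ (codeSeq (initSeg T n) ∷ z ∷ [])

  hypothesisLearner-BC :
    (∀ i T → IsTextFor T (B i) → Σ ℕ λ n₀ → ∀ n → n₀ ≤ n → SameSet (closure η (hypothesis T n)) (B i)) →
    BCLearns η (hypothesisLearner φ) B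
  hypothesisLearner-BC h i T text with h i T text
  ... | n₀ , f = n₀ , λ n n₀≤n → section φ (codeSeq (initSeg T n)) , refl , λ x → mk⇔
    (λ (y , w , p) → to (f n n₀≤n x) (y , from (W-section φ (codeSeq (initSeg T n)) y) w , p))
    (λ b → let y , w , p = from (f n n₀≤n x) b in y , to (W-section φ (codeSeq (initSeg T n)) y) w , p)

  uniformly-re : (∀ k x → ⟦ φ ⟧ˢ (k ∷ x ∷ []) ⇔ B k x) → IsRE (λ z → Σ ℕ λ k → Σ ℕ λ x → z ≡ pair k x × B k x)
  uniformly-re h = proj₁ re , λ z → mk⇔
    (λ { (k , x , refl , b) → to (proj₂ re (pair k x))
         (subst₂ (λ k x → ⟦ φ ⟧ˢ (k ∷ x ∷ [])) (sym (π₁-pair k x)) (sym (π₂-pair k x)) (from (h k x) b)) })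
    (λ w → π₁ z , π₂ z , sym (pair-unpair z) , to (h (π₁ z) (π₂ z)) (from (proj₂ re z) w))
    where
    re : Σ ℕ λ e → ∀ z → ⟦ φ ⟧ˢ (π₁ z ∷ π₂ z ∷ []) ⇔ W e z
    re = Sg-re φ (λ z → π₁ z ∷ π₂ z ∷ []) (pairᶜ π₁ᶠ (pairᶜ π₂ᶠ (constᶜ 0)))

-- Forcing a learner beyond a bound on its hypotheses

module Respond (em : ExcludedMiddle 0ℓ) (η : ℕ → ℕ → Set) (pos : Positive η) where
  open Rank em η pos
  open Texts em

  module _ {M B} (bc : BCLearns η M B) {L s} (over : Over L s) (r₀ : ℕ) (bounded : ∀ x → L x → rank x < r₀)
           {V : ℕ → Set}
           (cand : ∀ r → r₀ ≤ r → Σ ℕ λ x → r ≤ rank x × V x × Σ ℕ λ n → SameSet (B n) (λ z → L z ⊎ η x z)) where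
    private
      Candidate : Set
      Candidate = Σ ℕ λ r → r₀ ≤ r

      point : Candidate → ℕ
      point (r , h) = proj₁ (cand r h)

      rank-point : ∀ c → proj₁ c ≤ rank (point c)
      rank-point (r , h) = proj₁ (proj₂ (cand r h))

      candidate : ℕ → Candidate
      candidate zero    = r₀ , ≤-refl
      candidate (suc k) = suc (rank (point (candidate k))) ,
        ≤-trans (proj₂ (candidate k)) (≤-trans (rank-point (candidate k)) (n≤1+n _))

      x : ℕ → ℕ
      x k = point (candidate k)

      V-x : ∀ k → V (x k)
      V-x k = proj₁ (proj₂ (proj₂ (cand _ (proj₂ (candidate k)))))

      index : ℕ → ℕ
      index k = proj₁ (proj₂ (proj₂ (proj₂ (cand _ (proj₂ (candidate k))))))

      same : ∀ k → SameSet (B (index k)) (λ z → L z ⊎ η (x k) z)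
      same k = proj₂ (proj₂ (proj₂ (proj₂ (cand _ (proj₂ (candidate k))))))

      r₀≤rank : ∀ k → r₀ ≤ rank (x k)
      r₀≤rank k = ≤-trans (proj₂ (candidate k)) (rank-point (candidate k))

      rank-x-< : ∀ {j k} → j < k → rank (x j) < rank (x k)
      rank-x-< {j} {suc k} (s≤s j≤k) with m≤n⇒m<n∨m≡n j≤k
      ... | inj₁ j<k  = <-trans (rank-x-< j<k) (rank-point (candidate (suc k)))
      ... | inj₂ refl = rank-point (candidate (suc k))

      Wanted : Set
      Wanted = Σ ℕ λ x → r₀ ≤ rank x × V x × Responds M (λ z → L z ⊎ η x z) s

      Guess : ℕ → Set
      Guess k = Σ ℕ λ e → e < codeSeq s × SameSet (closure η (W e)) (λ z → L z ⊎ η (x k) z)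

      distinct : ∀ {j k} → j < k → (g : Guess j) (h : Guess k) → proj₁ g ≡ proj₁ h → ⊥
      distinct {j} {k} j<k (e , _ , ok) (.e , _ , ok′) refl
        -- A shared hypothesis would put `x k` into the set for `j`, but its rank exceeds that of
        -- `x j` and those of all elements of `L`.
        with to (ok (x k)) (from (ok′ (x k)) (inj₂ (rank-injective refl)))
      ... | inj₁ p = <⇒≱ (bounded _ p) (r₀≤rank k)
      ... | inj₂ q = <⇒≢ (rank-x-< j<k) (rank-cong q)

      no-guesses : ¬ (∀ k → Guess k)
      no-guesses guess with pigeonhole (n<1+n (codeSeq s)) (λ i → fromℕ< (proj₁ (proj₂ (guess (toℕ i)))))
      ... | i , j , i<j , eq = distinct i<j (guess (toℕ i)) (guess (toℕ j)) (fromℕ<-injective _ _ _ _ eq)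

      module _ (¬wanted : ¬ Wanted) where
        guess : ∀ k → Guess k
        -- The text begins with `s`, so once the learner has converged beyond `s`, its hypothesis is
        -- issued on an extension of `s` over `L` and the class of `x k`.
        guess k with bc (index k) (s ⊕ member? (B (index k))) (⊕-text s (λ y p → from (same k y) (inj₁ (over y p))))
        ... | n₀ , f = refute (f (length s + n₀) (m≤n+m n₀ (length s)))
          where
          T = s ⊕ member? (B (index k))
          τ = applyUpTo (member? (B (index k))) n₀
          init : initSeg T (length s + n₀) ≡ s ++ τ
          init = trans (initSeg≡applyUpTo T _) (applyUpTo-⊕ s (member? (B (index k))) n₀)
          over′ : Over (λ z → L z ⊎ η (x k) z) (s ++ τ)
          over′ = Over-++ s (λ y p → inj₁ (over y p)) (λ y p →
            let j , _ , eq′ = ∈-applyUpTo⁻ (member? (B (index k))) p in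
            to (same k y) (member?-sound {B (index k)} {j} (sym eq′)))
          refute : CorrectAt η (B (index k)) (run M (initSeg T (length s + n₀))) → Guess k
          -- The output `just e` is coded as `suc e`, so not exceeding `codeSeq s` means that `e`
          -- lies strictly below it.
          refute (e , eq , ok) = e , ≮⇒≥ (λ lt → ¬wanted (x k , r₀≤rank k , V-x k , τ , over′ , out lt)) ,
            λ z → mk⇔ (λ c → to (same k z) (to (ok z) c)) (λ b → from (ok z) (from (same k z) b))
            where
            out : codeSeq s < suc e → codeSeq s < output M (s ++ τ)
            out lt = subst (codeSeq s <_) (trans (cong encMaybe (sym eq)) (cong (output M) init)) lt

    -- Otherwise each of infinitely many distinct sets would have a correct hypothesis below
    -- `codeSeq s`, against the pigeonhole principle.
    respond : Wanted
    respond with em {Wanted}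
    ... | yes w = w
    ... | no ¬w = contradiction (guess ¬w) no-guesses

-- The finitely generated family

Σ-⇔ : {A B : ℕ → Set} → (∀ x → A x ⇔ B x) → Σ ℕ A ⇔ Σ ℕ B
Σ-⇔ h = mk⇔ (λ (x , a) → x , to (h x) a) (λ (x , b) → x , from (h x) b)

SameSet-sym : ∀ {A B : ℕ → Set} → SameSet A B → SameSet B A
SameSet-sym h x = ⇔-sym (h x)

SameSet-trans : ∀ {A B C : ℕ → Set} → SameSet A B → SameSet B C → SameSet A C
SameSet-trans h k x = k x ⇔-∘ h x

contentˢ : Sg 2
contentˢ = memberˢ x₀ x₁

module Finite (em : ExcludedMiddle 0ℓ) (η : ℕ → ℕ → Set) (pos : Positive η) where
  open Positive pos using (isEquivalence)
  open IsEquivalence isEquivalence renaming (refl to η-refl; sym to η-sym; trans to η-trans)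
  open Rank em η pos
  open Texts em

  -- The content never leaves the closed set `L`, and as soon as it contains the generators its
  -- closure is all of `L`.
  eventually-generated : ∀ {T L} → IsTextFor T L → EtaClosed η L → ∀ l → (∀ x → x ∈ l → L x) →
    (∀ z → L z → Σ ℕ λ x → x ∈ l × η x z) →
    Σ ℕ λ n₀ → ∀ n → n₀ ≤ n → SameSet (closure η (λ z → just z ∈ initSeg T n)) L
  eventually-generated {T} {L} text closed l l⊆L gen with eventually-∈ {T} {L} text l l⊆L
  ... | n₀ , f = n₀ , λ n n₀≤n z → mk⇔
    (λ (y , p , q) → closed y z (η-sym q) (Over-initSeg {T} {L} text n y p))
    (λ p → let x , x∈l , q = gen z p in x , f n n₀≤n x x∈l , η-sym q)

  reps : ℕ → List ℕ
  reps k = map rep (upTo k)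

  reps⊆C : ∀ k x → x ∈ reps k → C k x
  reps⊆C k x p with ∈-map⁻ rep p
  ... | i , i∈ , refl = subst (_< k) (sym (rank-rep i)) (∈-upTo⁻ i∈)

  reps-generate : ∀ k z → C k z → Σ ℕ λ x → x ∈ reps k × η x z
  reps-generate k z r = rep (rank z) , ∈-map⁺ rep (∈-upTo⁺ r) , rank-injective (rank-rep (rank z))

  NotLeast : ℕ → Set
  NotLeast x = Σ ℕ λ u → u < x × η u x

  ¬NotLeast⇒Least : ∀ {x} → ¬ NotLeast x → Least x
  ¬NotLeast⇒Least ¬p u u<x q = ¬p (u , u<x , q)

  -- A good index is a normal form: the least elements of two classes in weakly increasing order,
  -- equality giving a single class. Badness is Σ₁, so a redirection can be enumerated.
  Bad : ℕ → Set
  Bad n = (π₂ n < π₁ n) ⊎ (NotLeast (π₁ n) ⊎ NotLeast (π₂ n))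

  -- The finitely generated sets [x] ∪ [y], one index for each of them; an index which turns out to be
  -- redundant is redirected to a set that no other index denotes.
  F : ℕ → ℕ → Set
  F n z = (η (π₁ n) z ⊎ η (π₂ n) z) ⊎ (Bad n × C (3 + n) z)

  F-closed : ∀ n → EtaClosed η (F n)
  F-closed n x y p (inj₁ (inj₁ q)) = inj₁ (inj₁ (η-trans q p))
  F-closed n x y p (inj₁ (inj₂ q)) = inj₁ (inj₂ (η-trans q p))
  F-closed n x y p (inj₂ (b , r))  = inj₂ (b , C-closed (3 + n) x y p r)

  notLeastˢ : Sg 1
  notLeastˢ = exˢ (dec (x₀ << x₁) ∧ˢ subˢ ηˢ (x₀ ∷ x₁ ∷ []))

  familyˢ : Sg 2
  familyˢ = (subˢ ηˢ (ap₁ π₁ᶠ x₀ ∷ x₁ ∷ []) ∨ˢ subˢ ηˢ (ap₁ π₂ᶠ x₀ ∷ x₁ ∷ [])) ∨ˢ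
    ((dec (ap₁ π₂ᶠ x₀ << ap₁ π₁ᶠ x₀) ∨ˢ (subˢ notLeastˢ (ap₁ π₁ᶠ x₀ ∷ []) ∨ˢ subˢ notLeastˢ (ap₁ π₂ᶠ x₀ ∷ []))) ∧ˢ
     subˢ Cˢ (ap₂ +ᶠ (lit 3) x₀ ∷ x₁ ∷ []))

  notLeastˢ-correct : ∀ x → ⟦ notLeastˢ ⟧ˢ (x ∷ []) ⇔ NotLeast x
  notLeastˢ-correct x = Σ-⇔ λ u → ⇔-id _ ×-⇔ ηˢ-correct u x

  familyˢ-correct : ∀ n z → ⟦ familyˢ ⟧ˢ (n ∷ z ∷ []) ⇔ F n z
  familyˢ-correct n z = (ηˢ-correct (π₁ n) z ⊎-⇔ ηˢ-correct (π₂ n) z) ⊎-⇔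
    ((⇔-id _ ⊎-⇔ (notLeastˢ-correct (π₁ n) ⊎-⇔ notLeastˢ-correct (π₂ n))) ×-⇔ Cˢ-correct (3 + n) z)

  -- The classes enumerated before the index proved bad are swallowed, because both components of
  -- `n` have rank at most `n`.
  F-bad : ∀ n → Bad n → SameSet (F n) (C (3 + n))
  F-bad n b z = mk⇔ fwd (λ r → inj₂ (b , r))
    where
    small : ∀ {x} → x ≤ n → η x z → C (3 + n) z
    small {x} x≤n p = subst (_< 3 + n) (rank-cong p) (s≤s (≤-trans (rank≤ x) (≤-trans x≤n (m≤n+m n 2))))
    fwd : F n z → C (3 + n) z
    fwd (inj₁ (inj₁ p)) = small (π₁≤ n) p
    fwd (inj₁ (inj₂ p)) = small (π₂≤ n) p
    fwd (inj₂ (_ , r))  = r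

  F-good : ∀ n → ¬ Bad n → SameSet (F n) (λ z → η (π₁ n) z ⊎ η (π₂ n) z)
  F-good n ¬b z = mk⇔ (λ { (inj₁ p) → p ; (inj₂ (b , _)) → contradiction b ¬b }) inj₁

  three-ranks : ∀ {a b} → 0 ≡ a ⊎ 0 ≡ b → 1 ≡ a ⊎ 1 ≡ b → 2 ≡ a ⊎ 2 ≡ b → ⊥
  three-ranks (inj₁ refl) (inj₁ ())
  three-ranks (inj₁ refl) (inj₂ refl) (inj₁ ())
  three-ranks (inj₁ refl) (inj₂ refl) (inj₂ ())
  three-ranks (inj₂ refl) (inj₂ ())
  three-ranks (inj₂ refl) (inj₁ refl) (inj₁ ())
  three-ranks (inj₂ refl) (inj₁ refl) (inj₂ ())

  -- This is the purpose of the offset 3: the ranks 0, 1 and 2 all occur on the left, but at most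
  -- two ranks occur on the right.
  C≢pair : ∀ n x y → ¬ SameSet (C (3 + n)) (λ z → η x z ⊎ η y z)
  C≢pair n x y same = three-ranks (hit 0 (s≤s z≤n)) (hit 1 (s≤s (s≤s z≤n))) (hit 2 (s≤s (s≤s (s≤s z≤n))))
    where
    hit : ∀ i → i < 3 + n → i ≡ rank x ⊎ i ≡ rank y
    hit i i< with to (same (rep i)) (subst (_< 3 + n) (sym (rank-rep i)) i<)
    ... | inj₁ p = inj₁ (trans (sym (rank-rep i)) (sym (rank-cong p)))
    ... | inj₂ p = inj₂ (trans (sym (rank-rep i)) (sym (rank-cong p)))

  sorted-pairs : ∀ {x y x′ y′} → x ≤ y → x′ ≤ y′ → x ≡ x′ ⊎ x ≡ y′ → y ≡ x′ ⊎ y ≡ y′ →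
                 x′ ≡ x ⊎ x′ ≡ y → y′ ≡ x ⊎ y′ ≡ y → x ≡ x′ × y ≡ y′
  sorted-pairs x≤y x′≤y′ (inj₁ refl) (inj₂ refl) _ _ = refl , refl
  sorted-pairs x≤y x′≤y′ (inj₁ refl) (inj₁ refl) _ (inj₁ refl) = refl , refl
  sorted-pairs x≤y x′≤y′ (inj₁ refl) (inj₁ refl) _ (inj₂ refl) = refl , refl
  sorted-pairs x≤y x′≤y′ (inj₂ refl) (inj₁ refl) _ _ = ≤-antisym x≤y x′≤y′ , ≤-antisym x′≤y′ x≤y
  sorted-pairs x≤y x′≤y′ (inj₂ refl) (inj₂ refl) (inj₁ refl) _ = refl , refl
  sorted-pairs x≤y x′≤y′ (inj₂ refl) (inj₂ refl) (inj₂ refl) _ = refl , refl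

  F-oneOne : ∀ i j → i ≢ j → ¬ SameSet (F i) (F j)
  F-oneOne i j i≢j same with em {Bad i} | em {Bad j}
  ... | yes bi | yes bj = i≢j (+-cancelˡ-≡ 3 i j
    (FirstGap-unique {C (3 + i)} {C (3 + j)} (SameSet-trans (SameSet-sym (F-bad i bi)) (SameSet-trans same (F-bad j bj))) (FirstGap-C (3 + i)) (FirstGap-C (3 + j))))
  ... | yes bi | no ¬bj = C≢pair i (π₁ j) (π₂ j) (SameSet-trans (SameSet-sym (F-bad i bi)) (SameSet-trans same (F-good j ¬bj)))
  ... | no ¬bi | yes bj = C≢pair j (π₁ i) (π₂ i) (SameSet-trans (SameSet-sym (F-bad j bj)) (SameSet-trans (SameSet-sym same) (F-good i ¬bi)))
  ... | no ¬bi | no ¬bj = i≢j (trans (sym (pair-unpair i)) (trans (cong₂ pair (proj₁ eqs) (proj₂ eqs)) (pair-unpair j)))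
    where
    least₁ : ∀ n → ¬ Bad n → Least (π₁ n)
    least₁ n ¬b = ¬NotLeast⇒Least (λ p → ¬b (inj₂ (inj₁ p)))
    least₂ : ∀ n → ¬ Bad n → Least (π₂ n)
    least₂ n ¬b = ¬NotLeast⇒Least (λ p → ¬b (inj₂ (inj₂ p)))
    hit : ∀ m n → ¬ Bad n → SameSet (F m) (F n) → ∀ {x} → Least x → F m x → x ≡ π₁ n ⊎ x ≡ π₂ n
    hit m n ¬b same {x} lx p with to (F-good n ¬b x) (to (same x) p)
    ... | inj₁ q = inj₁ (Least-unique lx (least₁ n ¬b) (η-sym q))
    ... | inj₂ q = inj₂ (Least-unique lx (least₂ n ¬b) (η-sym q))
    eqs : π₁ i ≡ π₁ j × π₂ i ≡ π₂ j
    eqs = sorted-pairs (≮⇒≥ (λ lt → ¬bi (inj₁ lt))) (≮⇒≥ (λ lt → ¬bj (inj₁ lt)))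
      (hit i j ¬bj same (least₁ i ¬bi) (inj₁ (inj₁ η-refl))) (hit i j ¬bj same (least₂ i ¬bi) (inj₁ (inj₂ η-refl)))
      (hit j i ¬bi (SameSet-sym same) (least₁ j ¬bj) (inj₁ (inj₁ η-refl))) (hit j i ¬bi (SameSet-sym same) (least₂ j ¬bj) (inj₁ (inj₂ η-refl)))

  F-family : EtaFamily η F
  F-family = record { closed = F-closed ; uniformRE = uniformly-re η F familyˢ familyˢ-correct ; oneOne = F-oneOne }

  F-finitely-generated : ∀ n → Σ (List ℕ) λ l → (∀ x → x ∈ l → F n x) × (∀ z → F n z → Σ ℕ λ x → x ∈ l × η x z)
  F-finitely-generated n with em {Bad n}
  ... | yes b = reps (3 + n) , (λ x p → from (F-bad n b x) (reps⊆C (3 + n) x p)) ,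
                λ z p → reps-generate (3 + n) z (to (F-bad n b z) p)
  ... | no ¬b = π₁ n ∷ π₂ n ∷ [] ,
    (λ { x (here refl) → inj₁ (inj₁ η-refl) ; x (there (here refl)) → inj₁ (inj₂ η-refl) }) ,
    λ z p → gen z (to (F-good n ¬b z) p)
    where
    gen : ∀ z → η (π₁ n) z ⊎ η (π₂ n) z → Σ ℕ λ x → x ∈ π₁ n ∷ π₂ n ∷ [] × η x z
    gen z (inj₁ p) = π₁ n , here refl , p
    gen z (inj₂ p) = π₂ n , there (here refl) , p

  F-BC : BCLearnable η F
  F-BC = hypothesisLearner contentˢ , hypothesisLearner-BC η F contentˢ λ i T text →
    let l , l⊆ , gen = F-finitely-generated i
        n₀ , f = eventually-generated {T} {F i} text (F-closed i) l l⊆ gen in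
    n₀ , λ n n₀≤n → SameSet-trans (content T n) (f n n₀≤n)
    where
    content : ∀ T n → SameSet (closure η (hypothesis η F contentˢ T n)) (closure η (λ z → just z ∈ initSeg T n))
    content T n z = mk⇔ (λ (y , p , q) → y , Member⇒∈ {initSeg T n} p , q) (λ (y , p , q) → y , ∈⇒Member p , q)

  F-pair : ∀ {x y} → Least x → Least y → x ≤ y → SameSet (F (pair x y)) (λ z → η x z ⊎ η y z)
  F-pair {x} {y} lx ly x≤y z = subst₂ (λ a b → F (pair x y) z ⇔ (η a z ⊎ η b z)) (π₁-pair x y) (π₂-pair x y) (F-good (pair x y) good z)
    where
    good : ¬ Bad (pair x y)
    good b with subst₂ (λ a b → b < a ⊎ (NotLeast a ⊎ NotLeast b)) (π₁-pair x y) (π₂-pair x y) b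
    ... | inj₁ y<x                     = <⇒≱ y<x x≤y
    ... | inj₂ (inj₁ (u , u<x , p))    = lx u u<x p
    ... | inj₂ (inj₂ (u , u<y , p))    = ly u u<y p

  module _ (M : Learner) (bc : BCLearns η M F)
           (vac : ∀ i T → IsTextFor T (F i) → Σ Seq λ l → ∀ n → 1 ≤ n → run M (initSeg T n) ∈ l) where

    -- The class of `w` belongs to `F` with index `pair w w`, so `M` issues only finitely many
    -- hypotheses on each of its texts.
    F-locking : ∀ {w} → Least w → Σ Seq λ s → Over (η w) s × ¬ Responds M (η w) s
    F-locking {w} lw = locking M (η w) λ T text → vac (pair w w) T λ x → mk⇔
      (λ p → to (text x) (to (same x) p)) (λ q → from (same x) (from (text x) q))
      where
      same : SameSet (F (pair w w)) (η w)
      same x = mk⇔ (λ p → collapse (to (F-pair lw lw ≤-refl x) p)) (λ p → from (F-pair lw lw ≤-refl x) (inj₁ p))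
        where
        collapse : η w x ⊎ η w x → η w x
        collapse (inj₁ p) = p
        collapse (inj₂ p) = p

    -- The representatives of large rank serve as candidates for `respond`. Later this makes `V`
    -- meet classes of arbitrarily large rank.
    F-responds : ∀ {w s} → Least w → Over (η w) s → ∀ r → rank w < r →
                 Σ ℕ λ x → r ≤ rank x × Responds M (λ z → η w z ⊎ η x z) s
    F-responds {w} {s} lw over r w<r =
      let x , r≤ , _ , resp = Respond.respond em η pos {M} {F} bc {η w} {s} over r
            (λ x p → subst (_< r) (rank-cong p) w<r) {λ _ → ⊤} cand
      in x , r≤ , resp
      where
      cand : ∀ r′ → r ≤ r′ → Σ ℕ λ x → r′ ≤ rank x × ⊤ × Σ ℕ λ n → SameSet (F n) (λ z → η w z ⊎ η x z)
      cand r′ r≤r′ = rep r′ , ≤-reflexive (sym (rank-rep r′)) , tt , pair w (rep r′) ,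
        F-pair lw (Least-rep r′) (≮⇒≥ λ lt → <⇒≱ (<-≤-trans w<r r≤r′)
          (subst₂ _≤_ (trans (sym (rank-Least (Least-rep r′))) (rank-rep r′)) (sym (rank-Least lw)) (count-mono (<⇒≤ lt))))

-- The second family

stab-⇔ : ∀ {A P Q} → P ⇔ Q → Stabilises A P → Stabilises A Q
stab-⇔ e (t₀ , f) = t₀ , λ t h → e ⇔-∘ f t h

stab-agree : ∀ {A P} → Stabilises A P → ∀ s → (∀ t → s ≤ t → A t) → P
stab-agree (t₀ , f) s h = to (f (t₀ + s) (m≤m+n t₀ s)) (h (t₀ + s) (m≤n+m s t₀))

stab-eventually : ∀ {A P} → Stabilises A P → P → Σ ℕ λ t₀ → ∀ t → t₀ ≤ t → A t
stab-eventually (t₀ , f) p = t₀ , λ t h → from (f t h) p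

stab-true : ∀ {A} → (Σ ℕ λ t₀ → ∀ t → t₀ ≤ t → A t) → Stabilises A ⊤
stab-true (t₀ , f) = t₀ , λ t h → mk⇔ (λ _ → tt) (λ _ → f t h)

m+m-injective : ∀ {m n} → m + m ≡ n + n → m ≡ n
m+m-injective {m} {n} eq = trans (n≡⌊n+n/2⌋ m) (trans (cong ⌊_/2⌋ eq) (sym (n≡⌊n+n/2⌋ n)))

m+m≢1+n+n : ∀ m n → m + m ≢ suc (n + n)
m+m≢1+n+n (suc m) zero    eq = contradiction (trans (sym (+-suc m m)) (suc-injective eq)) λ ()
m+m≢1+n+n (suc m) (suc n) eq =
  m+m≢1+n+n m n (suc-injective (trans (sym (+-suc m m)) (trans (suc-injective eq) (cong suc (+-suc n n)))))

doubleᵗ : ∀ {n} → Tm n → Tm n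
doubleᵗ t = ap₂ +ᶠ t t

-- The function with index `j` receives `j` as an argument. This takes the place of the recursion
-- theorem: the diagonal function can refer to its own index.
Halts : ℕ → ℕ → Set
Halts j s = Eval j (enc (j ∷ s ∷ [])) 0

opaque
  haltsˢ : Sg 2
  haltsˢ = subˢ evalˢ (x₀ ∷ pairᵗ x₀ (pairᵗ x₁ (lit 0)) ∷ lit 0 ∷ [])

  haltsˢ-correct : ∀ j s → ⟦ haltsˢ ⟧ˢ (j ∷ s ∷ []) ⇔ Halts j s
  haltsˢ-correct j s = evalˢ-correct j (enc (j ∷ s ∷ [])) 0

-- p = 0 also covers the case that no halting has been seen by stage t.
LastHalt : ℕ → ℕ → ℕ → Set
LastHalt j t p = (p ≡ 0 ⊎ (p < t × ⟦ haltsˢ ⟧[ t ] (j ∷ p ∷ []))) ×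
                 (∀ s → s < t → ¬ (p < s) ⊎ ¬ ⟦ haltsˢ ⟧[ t ] (j ∷ s ∷ []))

lastHalt-≮ : ∀ {j t p q} → LastHalt j t p → LastHalt j t q → ¬ (p < q)
lastHalt-≮ (_ , none) (inj₁ refl , _) ()
lastHalt-≮ {q = q} (_ , none) (inj₂ (q<t , h) , _) p<q with none q q<t
... | inj₁ p≮q = p≮q p<q
... | inj₂ ¬h  = ¬h h

lastHalt-unique : ∀ {j t p q} → LastHalt j t p → LastHalt j t q → p ≡ q
lastHalt-unique h k = ≤-antisym (≮⇒≥ (lastHalt-≮ k h)) (≮⇒≥ (lastHalt-≮ h k))

opaque
  lastHaltᶠ : Fm 3
  lastHaltᶠ = (x₂ == lit 0 ∨ x₂ << x₁ ∧ at x₁ haltsˢ (x₀ ∷ x₂ ∷ [])) ∧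
              all x₁ (neg (x₃ << x₀) ∨ neg (at x₂ haltsˢ (x₁ ∷ x₀ ∷ [])))

  lastHaltᶠ-correct : ∀ j t p → ⟦ lastHaltᶠ ⟧ (j ∷ t ∷ p ∷ []) ⇔ LastHalt j t p
  lastHaltᶠ-correct j t p = ⇔-id _

-- A downward search below `n` finds the greatest halting stage, and once halting there has been
-- seen no other stage displaces it. If there is none, 0 is the default.
lastHalt-limit : ExcludedMiddle 0ℓ → ∀ j n → (∀ s → n ≤ s → ¬ Halts j s) →
                 Σ ℕ λ p → Σ ℕ λ t₀ → ∀ t → t₀ ≤ t → LastHalt j t p
lastHalt-limit em j zero h = 0 , 0 , λ t _ → inj₁ refl , λ s _ → inj₂ (λ a → h s z≤n (to (haltsˢ-correct j s) (stage-sound haltsˢ a)))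
lastHalt-limit em j (suc n) h with em {Halts j n}
... | yes hn = let t₀ , a = stage-complete haltsˢ {j ∷ n ∷ []} (from (haltsˢ-correct j n) hn) in
  n , suc n + t₀ , λ t le →
    inj₂ (≤-trans (m≤m+n (suc n) t₀) le , stage-mono haltsˢ (≤-trans (m≤n+m t₀ (suc n)) le) a) ,
    λ s _ → case t s (n <? s)
  where
  case : ∀ t s → Dec (n < s) → ¬ (n < s) ⊎ ¬ ⟦ haltsˢ ⟧[ t ] (j ∷ s ∷ [])
  case t s (yes n<s) = inj₂ (λ a → h s n<s (to (haltsˢ-correct j s) (stage-sound haltsˢ a)))
  case t s (no n≮s)  = inj₁ n≮s
... | no ¬hn = lastHalt-limit em j n (λ s n≤s → case s (m≤n⇒m<n∨m≡n n≤s))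
  where
  case : ∀ s → n < s ⊎ n ≡ s → ¬ Halts j s
  case s (inj₁ n<s)  = h s n<s
  case .n (inj₂ refl) = ¬hn

-- Locks of the first learner and the format of the indices

module Locks (em : ExcludedMiddle 0ℓ) (η : ℕ → ℕ → Set) (pos : Positive η) (M : Learner) where
  open Positive pos using (isEquivalence)
  open IsEquivalence isEquivalence renaming (refl to η-refl; sym to η-sym; trans to η-trans)
  open Rank em η pos

  V : ℕ → ℕ → Set
  V c x = Responds M (λ z → η (π₁ c) z ⊎ η x z) (decodeSeq (π₂ c))

  OverClass : ℕ → Set
  OverClass c = Over (η (π₁ c)) (decodeSeq (π₂ c))

  opaque
    vˢ : Sg 2
    vˢ = subˢ (respondsˢ M (subˢ ηˢ (x₁ ∷ x₀ ∷ []) ∨ˢ subˢ ηˢ (x₂ ∷ x₀ ∷ []))) (ap₁ π₂ᶠ x₀ ∷ ap₁ π₁ᶠ x₀ ∷ x₁ ∷ [])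

    vˢ-correct : ∀ c x → ⟦ vˢ ⟧ˢ (c ∷ x ∷ []) ⇔ V c x
    vˢ-correct c x = flip _⇔-∘_ raw (mk⇔
      (Responds-⊆ {M} (λ y → to (ηˢ-correct (π₁ c) y ⊎-⇔ ηˢ-correct x y)))
      (Responds-⊆ {M} (λ y → from (ηˢ-correct (π₁ c) y ⊎-⇔ ηˢ-correct x y))))
      where
      φ : Sg 3
      φ = subˢ ηˢ (x₁ ∷ x₀ ∷ []) ∨ˢ subˢ ηˢ (x₂ ∷ x₀ ∷ [])
      raw : ⟦ respondsˢ M φ ⟧ˢ (π₂ c ∷ π₁ c ∷ x ∷ []) ⇔ Responds M (λ y → ⟦ φ ⟧ˢ (y ∷ π₁ c ∷ x ∷ [])) (decodeSeq (π₂ c))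
      raw = subst (λ d → ⟦ respondsˢ M φ ⟧ˢ (d ∷ π₁ c ∷ x ∷ []) ⇔ Responds M (λ y → ⟦ φ ⟧ˢ (y ∷ π₁ c ∷ x ∷ [])) (decodeSeq (π₂ c)))
        (codeSeq-decodeSeq (π₂ c)) (respondsˢ-correct M φ (decodeSeq (π₂ c)) (π₁ c ∷ x ∷ []))

    overClassˢ : Sg 1
    overClassˢ = subˢ (overˢ (subˢ ηˢ (x₁ ∷ x₀ ∷ []))) (ap₁ π₂ᶠ x₀ ∷ ap₁ π₁ᶠ x₀ ∷ [])

    overClassˢ-correct : ∀ c → ⟦ overClassˢ ⟧ˢ (c ∷ []) ⇔ OverClass c
    overClassˢ-correct c = flip _⇔-∘_ raw (mk⇔ (λ h y p → to (ηˢ-correct (π₁ c) y) (h y p)) (λ h y p → from (ηˢ-correct (π₁ c) y) (h y p)))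
      where
      φ : Sg 2
      φ = subˢ ηˢ (x₁ ∷ x₀ ∷ [])
      raw : ⟦ overˢ φ ⟧ˢ (π₂ c ∷ π₁ c ∷ []) ⇔ Over (λ y → ⟦ φ ⟧ˢ (y ∷ π₁ c ∷ [])) (decodeSeq (π₂ c))
      raw = subst (λ d → ⟦ overˢ φ ⟧ˢ (d ∷ π₁ c ∷ []) ⇔ Over (λ y → ⟦ φ ⟧ˢ (y ∷ π₁ c ∷ [])) (decodeSeq (π₂ c)))
        (codeSeq-decodeSeq (π₂ c)) (overˢ-correct φ (decodeSeq (π₂ c)) (π₁ c ∷ []))

  V-cong : ∀ {c x y} → η x y → V c x → V c y
  V-cong p = Responds-⊆ {M} λ { z (inj₁ q) → inj₁ q ; z (inj₂ q) → inj₂ (η-trans (η-sym p) q) }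

  -- c = ⟨w , s⟩ where w is the least element of the class of rank i and s locks M on that class.
  LocksRank : ℕ → ℕ → Set
  LocksRank i c = Least (π₁ c) × count (π₁ c) ≡ i × OverClass c × ¬ V c (π₁ c)

  -- Taking the least code makes the lock unique, so that it is the limit of its approximations.
  FirstLock : ℕ → ℕ → Set
  FirstLock i c = LocksRank i c × (∀ d → d < c → ¬ LocksRank i d)

  locksRankᶠ : Fm 3
  locksRankᶠ = sub leastᶠ (x₁ ∷ ap₁ π₁ᶠ x₂ ∷ []) ∧ ap₂ countᵗᶠ x₁ (ap₁ π₁ᶠ x₂) == x₀ ∧
    at x₁ overClassˢ (x₂ ∷ []) ∧ neg (at x₁ vˢ (x₂ ∷ ap₁ π₁ᶠ x₂ ∷ []))

  stab-locksRank : ∀ i c → Stabilises (λ t → ⟦ locksRankᶠ ⟧ (i ∷ t ∷ c ∷ [])) (LocksRank i c)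
  stab-locksRank i c = stab-× (stab-least (π₁ c)) (stab-× (stab-count (π₁ c) i)
    (stab-× (stab-⇔ (overClassˢ-correct c) (stab-at em overClassˢ (c ∷ [])))
            (stab-¬ (stab-⇔ (vˢ-correct c (π₁ c)) (stab-at em vˢ (c ∷ π₁ c ∷ []))))))

  opaque
    firstLockᶠ : Fm 3
    firstLockᶠ = locksRankᶠ ∧ all x₂ (neg (sub locksRankᶠ (x₁ ∷ x₂ ∷ x₀ ∷ [])))

    stab-firstLock : ∀ i c → Stabilises (λ t → ⟦ firstLockᶠ ⟧ (i ∷ t ∷ c ∷ [])) (FirstLock i c)
    stab-firstLock i c = stab-× (stab-locksRank i c) (stab-all c (λ d _ → stab-¬ (stab-locksRank i d)))

    firstLockᶠ-unique : ∀ {i t c d} → ⟦ firstLockᶠ ⟧ (i ∷ t ∷ c ∷ []) → ⟦ firstLockᶠ ⟧ (i ∷ t ∷ d ∷ []) → c ≡ d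
    firstLockᶠ-unique {i} {t} = least-unique {λ c → ⟦ locksRankᶠ ⟧ (i ∷ t ∷ c ∷ [])}

  FirstLock-unique : ∀ {i c d} → FirstLock i c → FirstLock i d → c ≡ d
  FirstLock-unique {i} = least-unique {LocksRank i}

  rank-lock : ∀ {i c} → FirstLock i c → rank (π₁ c) ≡ i
  rank-lock ((l , eq , _) , _) = trans (rank-Least l) eq

  module _ (locked : ∀ {w} → Least w → Σ Seq λ s → Over (η w) s × ¬ Responds M (η w) s) where
    firstLock-exists : ∀ i → Σ ℕ (FirstLock i)
    firstLock-exists i = minimise (locked (Least-rep i))
      where
      LocksAt : ℕ → Seq → Set
      LocksAt w s = Least w × count w ≡ i × Over (η w) s × ¬ Responds M (λ z → η w z ⊎ η w z) s
      minimise : (Σ Seq λ s → Over (η (rep i)) s × ¬ Responds M (η (rep i)) s) → Σ ℕ (FirstLock i)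
      minimise (s , over , ¬resp) =
        let c , l , _ , min = least (λ c → em {LocksRank i c}) (pair (rep i) (codeSeq s)) locks in c , l , min
        where
        decode≡ : s ≡ decodeSeq (π₂ (pair (rep i) (codeSeq s)))
        decode≡ = codeSeq-injective (sym (trans (codeSeq-decodeSeq _) (π₂-pair (rep i) (codeSeq s))))
        locks : LocksRank i (pair (rep i) (codeSeq s))
        locks = subst₂ LocksAt (sym (π₁-pair (rep i) (codeSeq s))) decode≡
          (Least-rep i , trans (sym (rank-Least (Least-rep i))) (rank-rep i) , over ,
           -- In `LocksRank` the class of `w` is expressed through `V` as its union with itself,
           -- which is collapsed here.
           λ r → ¬resp (Responds-⊆ {M} (λ { y (inj₁ p) → p ; y (inj₂ p) → p }) r))

  -- The set attached to j: all classes of rank below 2j and, as far as Halts j allows, those to which M responds.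
  Core : ℕ → ℕ → ℕ → Set
  Core j c y = C (j + j) y ⊎ (V c y × Σ ℕ λ s → y < suc s × Halts j s)

  opaque
    coreˢ : Sg 3
    coreˢ = subˢ Cˢ (doubleᵗ x₀ ∷ x₂ ∷ []) ∨ˢ (subˢ vˢ (x₁ ∷ x₂ ∷ []) ∧ˢ
      exˢ (dec (x₃ << sucᵗ x₀) ∧ˢ subˢ haltsˢ (x₁ ∷ x₀ ∷ [])))

    coreˢ-correct : ∀ j c y → ⟦ coreˢ ⟧ˢ (j ∷ c ∷ y ∷ []) ⇔ Core j c y
    coreˢ-correct j c y = Cˢ-correct (j + j) y ⊎-⇔ (vˢ-correct c y ×-⇔ Σ-⇔ λ s → ⇔-id _ ×-⇔ haltsˢ-correct j s)

  -- `b` is 0 for the core alone and `suc x` for the core with the class of `x` added.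
  Generator : ℕ → ℕ → ℕ → ℕ → Set
  Generator j c b y = Core j c y ⊎ suc y ≡ b

  opaque
    generatorˢ : Sg 4
    generatorˢ = subˢ coreˢ (x₀ ∷ x₁ ∷ x₃ ∷ []) ∨ˢ dec (sucᵗ x₃ == x₂)

    generatorˢ-correct : ∀ j c b y → ⟦ generatorˢ ⟧ˢ (j ∷ c ∷ b ∷ y ∷ []) ⇔ Generator j c b y
    generatorˢ-correct j c b y = coreˢ-correct j c y ⊎-⇔ ⇔-id _

  -- An index carries claims about itself: `c` as the first lock for rank 2j, `p` as the last
  -- halting stage, `s` as the first stage from which the approximations agree with these two. If
  -- true, they are determined by `j` and `b`; if false, they are refuted at some stage.
  record Index : Set where
    constructor index
    field
      j c p s b : ℕ

  module _ (I : Index) where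
    open Index I

    -- For the core alone `p` is pinned to 0, as that set needs an index even if halting never
    -- ceases. With a class added, a claim that persists forces the halting stages to be finite in
    -- number.
    Claim : ℕ → Set
    Claim t = ⟦ firstLockᶠ ⟧ (j + j ∷ t ∷ c ∷ []) × ((b ≡ 0 × p ≡ 0) ⊎ (b ≢ 0 × ⟦ lastHaltᶠ ⟧ (j ∷ t ∷ p ∷ [])))

    -- The ways in which an added class spoils the numbering: a representative that is not least, or
    -- a class already in the core, would give a set a second index, and the class of `π₁ c` would
    -- fill the gap at rank 2j. Each becomes visible at some stage.
    Clash : ℕ → Set
    Clash t = (Σ ℕ λ u → u < pred b × ⟦ ηˢ ⟧[ t ] (u ∷ pred b ∷ [])) ⊎
              (⟦ ηˢ ⟧[ t ] (pred b ∷ π₁ c ∷ []) ⊎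
               (Σ ℕ λ z → z < suc t × (⟦ coreˢ ⟧[ t ] (j ∷ c ∷ z ∷ []) × ⟦ ηˢ ⟧[ t ] (z ∷ pred b ∷ []))))

    -- What is visible by stage `t` of the failure of `LastChange (Claim I) s`, or of a clash.
    Invalid : ℕ → Set
    Invalid t = (Σ ℕ λ u → u < suc t × (¬ (u < s) × ¬ Claim u)) ⊎ ((0 < s × Claim (s ∸ 1)) ⊎ (b ≢ 0 × Clash t))

  decodeIndex : ℕ → Index
  decodeIndex n = index (π₁ n) (π₁ (π₂ n)) (π₁ (π₂ (π₂ n))) (π₁ (π₂ (π₂ (π₂ n)))) (π₂ (π₂ (π₂ (π₂ n))))

  encodeIndex : Index → ℕ
  encodeIndex (index j c p s b) = pair j (pair c (pair p (pair s b)))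

  encode-decode : ∀ n → encodeIndex (decodeIndex n) ≡ n
  encode-decode n = trans (cong (pair (π₁ n)) (trans (cong (pair (π₁ (π₂ n))) (trans (cong (pair (π₁ (π₂ (π₂ n))))
    (pair-unpair (π₂ (π₂ (π₂ n))))) (pair-unpair (π₂ (π₂ n))))) (pair-unpair (π₂ n)))) (pair-unpair n)

  decode-encode : ∀ I → decodeIndex (encodeIndex I) ≡ I
  decode-encode (index j c p s b)
    rewrite π₁-pair j (pair c (pair p (pair s b))) | π₂-pair j (pair c (pair p (pair s b)))
          | π₁-pair c (pair p (pair s b)) | π₂-pair c (pair p (pair s b))
          | π₁-pair p (pair s b) | π₂-pair p (pair s b) | π₁-pair s b | π₂-pair s b = refl

  claimᶠ : Fm 5
  claimᶠ = sub firstLockᶠ (doubleᵗ x₁ ∷ x₀ ∷ x₂ ∷ []) ∧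
    (x₄ == lit 0 ∧ x₃ == lit 0 ∨ neg (x₄ == lit 0) ∧ sub lastHaltᶠ (x₁ ∷ x₀ ∷ x₃ ∷ []))

  clashᶠ : Fm 4
  clashᶠ = ex (ap₁ predᶠ x₃) (at x₁ ηˢ (x₀ ∷ ap₁ predᶠ x₄ ∷ [])) ∨
    (at x₀ ηˢ (ap₁ predᶠ x₃ ∷ ap₁ π₁ᶠ x₂ ∷ []) ∨
     ex (sucᵗ x₀) (at x₁ coreˢ (x₂ ∷ x₃ ∷ x₀ ∷ []) ∧ at x₁ ηˢ (x₀ ∷ ap₁ predᶠ x₄ ∷ [])))

  invalidᶠ : Fm 6
  invalidᶠ = ex (sucᵗ x₀) (neg (x₀ << x₅) ∧ neg (sub claimᶠ (x₀ ∷ x₂ ∷ x₃ ∷ x₄ ∷ x₆ ∷ []))) ∨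
    (lit 0 << x₄ ∧ sub claimᶠ (ap₂ ∸ᶠ x₄ (lit 1) ∷ x₁ ∷ x₂ ∷ x₃ ∷ x₅ ∷ []) ∨
     neg (x₅ == lit 0) ∧ sub clashᶠ (x₀ ∷ x₁ ∷ x₂ ∷ x₅ ∷ []))

  opaque
    badᶠ : Fm 2
    badᶠ = sub invalidᶠ (x₀ ∷ ap₁ π₁ᶠ x₁ ∷ ap₁ π₁ᶠ (ap₁ π₂ᶠ x₁) ∷ ap₁ π₁ᶠ (ap₁ π₂ᶠ (ap₁ π₂ᶠ x₁)) ∷
      ap₁ π₁ᶠ (ap₁ π₂ᶠ (ap₁ π₂ᶠ (ap₁ π₂ᶠ x₁))) ∷ ap₁ π₂ᶠ (ap₁ π₂ᶠ (ap₁ π₂ᶠ (ap₁ π₂ᶠ x₁))) ∷ [])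

    badᶠ-correct : ∀ t n → ⟦ badᶠ ⟧ (t ∷ n ∷ []) ⇔ Invalid (decodeIndex n) t
    badᶠ-correct t n = ⇔-id _

-- The one-one numbering of the second family

module Family (em : ExcludedMiddle 0ℓ) (η : ℕ → ℕ → Set) (pos : Positive η) (M : Learner) where
  open Positive pos using (isEquivalence)
  open IsEquivalence isEquivalence renaming (refl to η-refl; sym to η-sym; trans to η-trans)
  open Rank em η pos
  open Finite em η pos
  open Locks em η pos M
  open Index

  BadAt : ℕ → ℕ → Set
  BadAt n t = ⟦ badᶠ ⟧ (t ∷ n ∷ [])

  -- Odd, whereas valid indices have the even gap `j + j`; injective in `n`; and above the rank of
  -- every generator enumerated before a refutation at stage `t`, since such generators are at most
  -- `n + t`.
  target : ℕ → ℕ → ℕ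
  target n t = suc (pair n t + pair n t)

  Generatorᵗ : ℕ → ℕ → ℕ → Set
  Generatorᵗ n t y = let I = decodeIndex n in ⟦ generatorˢ ⟧[ t ] (j I ∷ c I ∷ b I ∷ y ∷ [])

  -- An index enumerates the closure of its generators for as long as it looks valid. When it is refuted
  -- it has enumerated a finitely generated subset of C k, where k is odd and determines the index.
  B : ℕ → ℕ → Set
  B n z = (Σ ℕ λ t → (∀ u → u < suc t → ¬ BadAt n u) × Σ ℕ λ y → y < suc (n + t) × Generatorᵗ n t y × η y z) ⊎
          (Σ ℕ λ t → (BadAt n t × (∀ u → u < t → ¬ BadAt n u)) × C (target n t) z)

  opaque
    indexedˢ : Sg 2
    indexedˢ =
      exˢ (dec (all (sucᵗ x₀) (neg (sub badᶠ (x₀ ∷ x₂ ∷ [])))) ∧ˢ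
        exˢ (dec (x₀ << sucᵗ (ap₂ +ᶠ x₂ x₁)) ∧ˢ
          dec (at x₁ generatorˢ (ap₁ π₁ᶠ x₂ ∷ ap₁ π₁ᶠ (ap₁ π₂ᶠ x₂) ∷
                                 ap₁ π₂ᶠ (ap₁ π₂ᶠ (ap₁ π₂ᶠ (ap₁ π₂ᶠ x₂))) ∷ x₀ ∷ [])) ∧ˢ
          subˢ ηˢ (x₀ ∷ x₃ ∷ []))) ∨ˢ
      exˢ (dec (sub badᶠ (x₀ ∷ x₁ ∷ []) ∧ all x₀ (neg (sub badᶠ (x₀ ∷ x₂ ∷ [])))) ∧ˢ
        subˢ Cˢ (sucᵗ (doubleᵗ (pairᵗ x₁ x₀)) ∷ x₂ ∷ []))

    indexedˢ-correct : ∀ n z → ⟦ indexedˢ ⟧ˢ (n ∷ z ∷ []) ⇔ B n z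
    indexedˢ-correct n z =
      (Σ-⇔ λ t → ⇔-id _ ×-⇔ Σ-⇔ λ y → ⇔-id _ ×-⇔ (⇔-id _ ×-⇔ ηˢ-correct y z)) ⊎-⇔
      (Σ-⇔ λ t → ⇔-id _ ×-⇔ Cˢ-correct (target n t) z)

  Valid : ℕ → Set
  Valid n = ∀ t → ¬ BadAt n t

  B-valid : ∀ n → Valid n → let I = decodeIndex n in SameSet (B n) (closure η (Generator (j I) (c I) (b I)))
  B-valid n valid z = mk⇔ fwd bwd
    where
    I = decodeIndex n
    correct = generatorˢ-correct (j I) (c I) (b I)
    fwd : B n z → closure η (Generator (j I) (c I) (b I)) z
    fwd (inj₁ (t , _ , y , _ , g , p)) = y , to (correct y) (stage-sound generatorˢ {t} {j I ∷ c I ∷ b I ∷ y ∷ []} g) , η-sym p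
    fwd (inj₂ (t , (bad , _) , _))     = contradiction bad (valid t)
    bwd : closure η (Generator (j I) (c I) (b I)) z → B n z
    bwd (y , g , p) with stage-complete generatorˢ {j I ∷ c I ∷ b I ∷ y ∷ []} (from (correct y) g)
    -- The stage has to reach `y` as well, because stage `t` only admits generators below
    -- `suc (n + t)`.
    ... | t , a = inj₁ (t + y , (λ u _ → valid u) , y , s≤s (≤-trans (m≤n+m y t) (m≤n+m (t + y) n)) ,
                        stage-mono generatorˢ {t} {t + y} {j I ∷ c I ∷ b I ∷ y ∷ []} (m≤m+n t y) a , η-sym p)

  B-invalid : ∀ n → ¬ Valid n → Σ ℕ λ t → SameSet (B n) (C (target n t))
  B-invalid n ¬valid with em {Σ ℕ (BadAt n)}
  ... | no none = contradiction (λ t bad → none (t , bad)) ¬valid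
  ... | yes (t₀ , bad₀) with least (λ t → ⟦ badᶠ ⟧? (t ∷ n ∷ [])) t₀ bad₀
  ... | t , bad , _ , min = t , λ z → mk⇔ (fwd z) (λ r → inj₂ (t , (bad , min) , r))
    where
    fwd : ∀ z → B n z → C (target n t) z
    fwd z (inj₁ (u , ok , y , y< , _ , p)) = subst (_< target n t) (rank-cong p)
      (s≤s (≤-trans (rank≤ y) (≤-trans (≤-trans (s≤s⁻¹ y<) (+-monoʳ-≤ n (≮⇒≥ λ t<u → ok t (m<n⇒m<1+n t<u) bad)))
        (≤-trans (m+n≤pair n t) (m≤m+n (pair n t) (pair n t))))))
    fwd z (inj₂ (u , (bad′ , min′) , r)) with <-cmp u t
    ... | tri< u<t _ _ = contradiction bad′ (min u u<t)
    ... | tri≈ _ refl _ = r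
    ... | tri> _ _ t<u = contradiction bad (min′ t t<u)

  B-closed : ∀ n → EtaClosed η (B n)
  B-closed n x y p (inj₁ (t , ok , v , v< , g , q)) = inj₁ (t , ok , v , v< , g , η-trans q p)
  B-closed n x y p (inj₂ (t , bad , r))             = inj₂ (t , bad , C-closed (target n t) x y p r)

  module _ (n : ℕ) (valid : Valid n) where
    private
      I = decodeIndex n

      ¬invalid : ∀ t → ¬ Invalid I t
      ¬invalid t inv = valid t (from (badᶠ-correct t n) inv)

    claim-lastChange : LastChange (Claim I) (s I)
    claim-lastChange = (λ t s≤t → decidable-stable em λ ¬claim → ¬invalid t (inj₁ (t , ≤-refl , ≤⇒≯ s≤t , ¬claim))) ,
                       λ cl → ¬invalid 0 (inj₂ (inj₁ cl))

    no-clash : b I ≢ 0 → ∀ t → ¬ Clash I t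
    no-clash b≢0 t cl = ¬invalid t (inj₂ (inj₂ (b≢0 , cl)))

    valid-firstLock : FirstLock (j I + j I) (c I)
    valid-firstLock = stab-agree (stab-firstLock (j I + j I) (c I)) (s I) (λ t s≤t → proj₁ (proj₁ claim-lastChange t s≤t))

    private
      w = π₁ (c I)

    -- Here it matters that `c` is a genuine lock: a point of `V` in the class of `w` would make `M`
    -- respond on that class itself.
    core-avoids : ∀ {y} → Core (j I) (c I) y → ¬ η y w
    core-avoids (inj₁ r)       p = <⇒≢ r (trans (rank-cong p) (rank-lock valid-firstLock))
    core-avoids (inj₂ (v , _)) p = proj₂ (proj₂ (proj₂ (proj₁ valid-firstLock))) (V-cong {c I} p v)

    extra-avoids : ∀ {x} → suc x ≡ b I → ¬ η x w
    extra-avoids {x} eq p with stab-eventually (stab-η x w) p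
    ... | t , h = no-clash (λ b≡0 → contradiction (trans eq b≡0) λ ()) t
      (inj₂ (inj₁ (subst (λ b → ⟦ ηˢ ⟧[ t ] (pred b ∷ w ∷ [])) eq (h t ≤-refl))))

    extra-Least : ∀ {x} → suc x ≡ b I → Least x
    extra-Least {x} eq u u<x p with stab-eventually (stab-η u x) p
    ... | t , h = no-clash (λ b≡0 → contradiction (trans eq b≡0) λ ()) t
      (inj₁ (u , subst (λ b → u < pred b) eq u<x , subst (λ b → ⟦ ηˢ ⟧[ t ] (u ∷ pred b ∷ [])) eq (h t ≤-refl)))

    extra-new : ∀ {x} → suc x ≡ b I → ¬ closure η (Core (j I) (c I)) x
    extra-new {x} eq (y , k , p) with stab-eventually (stab-η y x) (η-sym p)
                                    | stage-complete coreˢ {j I ∷ c I ∷ y ∷ []} (from (coreˢ-correct (j I) (c I) y) k)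
    ... | t , h | u , a = no-clash (λ b≡0 → contradiction (trans eq b≡0) λ ()) v
      (inj₂ (inj₂ (y , s≤s (m≤n+m y (t + u)) ,
        stage-mono coreˢ {u} {v} {j I ∷ c I ∷ y ∷ []} (≤-trans (m≤n+m u t) (m≤m+n (t + u) y)) a ,
        subst (λ b → ⟦ ηˢ ⟧[ v ] (y ∷ pred b ∷ [])) eq (h v (≤-trans (m≤m+n t u) (m≤m+n (t + u) y))))))
      where
      v = t + u + y

    -- The core contains all smaller ranks, and the class of rank 2j, that of `w`, is avoided by the
    -- core and by the added class.
    valid-FirstGap : FirstGap (B n) (j I + j I)
    valid-FirstGap = (λ x r → from (B-valid n valid x) (x , inj₁ (inj₁ r) , η-refl)) ,
                     λ x r p → miss x r (to (B-valid n valid x) p)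
      where
      miss : ∀ x → rank x ≡ j I + j I → ¬ closure η (Generator (j I) (c I) (b I)) x
      miss x r (y , g , p) = case g
        where
        y~w : η y w
        y~w = rank-injective (trans (sym (rank-cong p)) (trans r (sym (rank-lock valid-firstLock))))
        case : ¬ Generator (j I) (c I) (b I) y
        case (inj₁ k)  = core-avoids k y~w
        case (inj₂ eq) = extra-avoids eq y~w

  encodeIndex-cong : ∀ {m n} → decodeIndex m ≡ decodeIndex n → m ≡ n
  encodeIndex-cong {m} {n} eq = trans (sym (encode-decode m)) (trans (cong encodeIndex eq) (encode-decode n))

  extra-transfer : ∀ m n (vm : Valid m) (vn : Valid n) → j (decodeIndex m) ≡ j (decodeIndex n) → c (decodeIndex m) ≡ c (decodeIndex n) →
            SameSet (B m) (B n) → ∀ {x} → suc x ≡ b (decodeIndex m) → Σ ℕ λ y → suc y ≡ b (decodeIndex n) × η x y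
  extra-transfer m n vm vn j≡ c≡ same {x} eq with to (B-valid n vn x) (to (same x) (from (B-valid m vm x) (x , inj₂ eq , η-refl)))
  ... | y , inj₁ k , p = contradiction (y , subst₂ (λ j c → Core j c y) (sym j≡) (sym c≡) k , p) (extra-new m vm eq)
  ... | y , inj₂ e , p = y , e , p

  -- The set determines the index component by component: the first gap gives `j`, then `c` is the
  -- first lock, `b` comes from the least element of what exceeds the core, and `p` and `s` are
  -- limits fixed by these.
  valid-unique : ∀ m n → Valid m → Valid n → SameSet (B m) (B n) → m ≡ n
  valid-unique m n vm vn same = encodeIndex-cong
    (go (decodeIndex m) (decodeIndex n) j≡ c≡ (claim-lastChange m vm) (claim-lastChange n vn) b≡)
    where
    j≡ : j (decodeIndex m) ≡ j (decodeIndex n)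
    j≡ = m+m-injective (FirstGap-unique {B m} {B n} same (valid-FirstGap m vm) (valid-FirstGap n vn))
    c≡ : c (decodeIndex m) ≡ c (decodeIndex n)
    c≡ = FirstLock-unique (valid-firstLock m vm)
      (subst (λ j → FirstLock (j + j) (c (decodeIndex n))) (sym j≡) (valid-firstLock n vn))
    extras : ∀ β β′ → β ≡ b (decodeIndex m) → β′ ≡ b (decodeIndex n) → β ≡ β′
    extras zero    zero     _  _   = refl
    extras zero    (suc x)  eq eq′ = contradiction
      (trans (proj₁ (proj₂ (extra-transfer n m vn vm (sym j≡) (sym c≡) (SameSet-sym {B m} {B n} same) eq′))) (sym eq)) λ ()
    extras (suc x) zero     eq eq′ = contradiction (trans (proj₁ (proj₂ (extra-transfer m n vm vn j≡ c≡ same eq))) (sym eq′)) λ ()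
    extras (suc x) (suc x′) eq eq′ = let y , e , p = extra-transfer m n vm vn j≡ c≡ same eq in
      cong suc (Least-unique (extra-Least m vm eq) (extra-Least n vn eq′) (subst (η x) (suc-injective (trans e (sym eq′))) p))
    b≡ : b (decodeIndex m) ≡ b (decodeIndex n)
    b≡ = extras _ _ refl refl
    go : ∀ I I′ → j I ≡ j I′ → c I ≡ c I′ → LastChange (Claim I) (s I) → LastChange (Claim I′) (s I′) → b I ≡ b I′ → I ≡ I′
    go (index i d p s β) (index .i .d p′ s′ .β) refl refl l l′ refl = finish p≡
      where
      -- A stage at which both claims hold, and at one stage the last halting seen is unique.
      t = s + s′
      common : (β ≡ 0 × p ≡ 0) ⊎ (β ≢ 0 × ⟦ lastHaltᶠ ⟧ (i ∷ t ∷ p ∷ [])) →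
               (β ≡ 0 × p′ ≡ 0) ⊎ (β ≢ 0 × ⟦ lastHaltᶠ ⟧ (i ∷ t ∷ p′ ∷ [])) → p ≡ p′
      common (inj₁ (_ , e)) (inj₁ (_ , e′)) = trans e (sym e′)
      common (inj₁ (z , _)) (inj₂ (nz , _)) = contradiction z nz
      common (inj₂ (nz , _)) (inj₁ (z , _)) = contradiction z nz
      common (inj₂ (_ , h)) (inj₂ (_ , h′)) =
        lastHalt-unique (to (lastHaltᶠ-correct i t p) h) (to (lastHaltᶠ-correct i t p′) h′)
      p≡ : p ≡ p′
      p≡ = common (proj₂ (proj₁ l t (m≤m+n s s′))) (proj₂ (proj₁ l′ t (m≤n+m s′ s)))
      finish : p ≡ p′ → index i d p s β ≡ index i d p′ s′ β
      finish refl = cong (λ s → index i d p s β) (lastChange-unique l l′)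

  -- The parity of the first gap separates valid from refuted indices, and for a refuted index the
  -- gap codes the index.
  B-oneOne : ∀ m n → m ≢ n → ¬ SameSet (B m) (B n)
  B-oneOne m n m≢n same with em {Valid m} | em {Valid n}
  ... | yes vm | yes vn = m≢n (valid-unique m n vm vn same)
  ... | yes vm | no ¬vn = let t , eq = B-invalid n ¬vn in
    m+m≢1+n+n (j (decodeIndex m)) (pair n t) (FirstGap-unique {B m} {C (target n t)} (SameSet-trans same eq) (valid-FirstGap m vm) (FirstGap-C (target n t)))
  ... | no ¬vm | yes vn = let t , eq = B-invalid m ¬vm in
    m+m≢1+n+n (j (decodeIndex n)) (pair m t) (FirstGap-unique {B n} {C (target m t)} (SameSet-trans (SameSet-sym same) eq) (valid-FirstGap n vn) (FirstGap-C (target m t)))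
  ... | no ¬vm | no ¬vn = let t , eq = B-invalid m ¬vm ; u , eq′ = B-invalid n ¬vn in
    m≢n (pair-injectiveˡ {m} {t} {n} {u} (m+m-injective (suc-injective (FirstGap-unique {C (target m t)} {C (target n u)}
      (SameSet-trans (SameSet-sym eq) (SameSet-trans same eq′)) (FirstGap-C (target m t)) (FirstGap-C (target n u))))))

  B-family : EtaFamily η B
  B-family = record { closed = B-closed ; uniformRE = uniformly-re η B indexedˢ indexedˢ-correct ; oneOne = B-oneOne }

-- Behaviourally correct learning of the second family

module FamilyBC (em : ExcludedMiddle 0ℓ) (η : ℕ → ℕ → Set) (pos : Positive η) (M : Learner) where
  open Positive pos using (isEquivalence)
  open IsEquivalence isEquivalence renaming (refl to η-refl; sym to η-sym; trans to η-trans)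
  open Rank em η pos
  open Finite em η pos
  open Locks em η pos M
  open Family em η pos M
  open Index

  -- At stage `t` the number `w` looks like the representative of rank `i`. There is at most one
  -- such `w` at each stage, and it converges to `rep i`.
  Minimal : ℕ → ℕ → ℕ → Set
  Minimal t i w = ⟦ leastᶠ ⟧ (t ∷ w ∷ []) × countᵗ t w ≡ i

  minimal-≮ : ∀ {t i u v} → Minimal t i u → Minimal t i v → ¬ (u < v)
  minimal-≮ {t} {i} {u} {v} (lu , eu) (lv , ev) u<v = <⇒≢
    (subst (_≤ countᵗ t v) (trans (cong (countᵗ t u +_) (indicatorᵗ≡ {t} {u} lu)) (+-comm (countᵗ t u) 1))
      (Σ<-monoˡ (indicatorᵗ t) {suc u} {v} u<v))
    (trans eu (sym ev))

  minimal-unique : ∀ {t i u v} → Minimal t i u → Minimal t i v → u ≡ v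
  minimal-unique {t} {i} p q = ≤-antisym (≮⇒≥ (minimal-≮ {t} {i} q p)) (≮⇒≥ (minimal-≮ {t} {i} p q))

  minimal-rep : ∀ i → Σ ℕ λ t₀ → ∀ t → t₀ ≤ t → Minimal t i (rep i)
  minimal-rep i = stab-eventually (stab-× (stab-least (rep i)) (stab-count (rep i) i))
    (Least-rep i , trans (sym (rank-Least (Least-rep i))) (rank-rep i))

  opaque
    -- At stage κ, read as the code of a sequence, that sequence seems to meet the class of rank i.
    hitᶠ : Fm 2
    hitᶠ = ex x₀ (sub leastᶠ (x₁ ∷ x₀ ∷ []) ∧ ap₂ countᵗᶠ x₁ x₀ == x₂ ∧
      ex x₁ (neg (ap₂ entryᶠ x₂ x₀ == lit 0) ∧ at x₂ ηˢ (ap₁ predᶠ (ap₂ entryᶠ x₂ x₀) ∷ x₁ ∷ [])))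

    hit-sound : ∀ s i → ⟦ hitᶠ ⟧ (codeSeq s ∷ i ∷ []) → Σ ℕ λ w → Minimal (codeSeq s) i w × Σ ℕ λ y → just y ∈ s × η y w
    hit-sound s i (w , _ , l , e , k , _ , ne , p) with sucView (entry (codeSeq s) k) ne
    ... | y , eq = w , (l , e) , y , entry-∈ s k eq , subst (λ y → η y w) (cong pred eq) (η-stage {codeSeq s} {_} {w} p)

    hit-complete : ∀ s i {w y} → w < codeSeq s → Minimal (codeSeq s) i w → just y ∈ s →
                   ⟦ ηˢ ⟧[ codeSeq s ] (y ∷ w ∷ []) → ⟦ hitᶠ ⟧ (codeSeq s ∷ i ∷ [])
    hit-complete s i {w} {y} w< (l , e) y∈ p with ∈-entry {s} y∈
    ... | k , k< , eq = w , w< , l , e , k , k< , (λ z → contradiction (trans (sym eq) z) λ ()) ,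
      subst (λ y → ⟦ ηˢ ⟧[ codeSeq s ] (y ∷ w ∷ [])) (sym (cong pred eq)) p

  gapᶠ : Fm 2
  gapᶠ = neg (sub hitᶠ (x₀ ∷ x₁ ∷ [])) ∧ all x₁ (sub hitᶠ (x₁ ∷ x₀ ∷ []))

  gap-unique : ∀ {κ i i′} → ⟦ gapᶠ ⟧ (κ ∷ i ∷ []) → ⟦ gapᶠ ⟧ (κ ∷ i′ ∷ []) → i ≡ i′
  gap-unique {i = i} {i′} (¬h , h) (¬h′ , h′) with <-cmp i i′
  ... | tri< i<i′ _ _ = contradiction (h′ i i<i′) ¬h
  ... | tri≈ _ i≡i′ _ = i≡i′
  ... | tri> _ _ i′<i = contradiction (h i′ i′<i) ¬h′

  -- The finitely many classes of smaller rank appear in the text and are recognised. The class of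
  -- rank `i` never appears, and once `rep i` has settled nothing else passes for it.
  gap-limit : ∀ {T L i} → IsTextFor T L → EtaClosed η L → FirstGap L i →
              Σ ℕ λ n₀ → ∀ n → n₀ ≤ n → ⟦ gapᶠ ⟧ (codeSeq (initSeg T n) ∷ i ∷ [])
  gap-limit {T} {L} {i} text closed (below , miss) = proj₁ hits + proj₁ (minimal-rep i) , λ n le →
      (λ hit → no-hit n (≤-trans (m≤n+m (proj₁ (minimal-rep i)) (proj₁ hits)) le) (hit-sound (initSeg T n) i hit)) ,
      λ k k<i → proj₂ hits k k<i n (≤-trans (m≤m+n (proj₁ hits) _) le)
    where
    no-hit : ∀ n → proj₁ (minimal-rep i) ≤ n →
             ¬ (Σ ℕ λ w → Minimal (codeSeq (initSeg T n)) i w × Σ ℕ λ y → just y ∈ initSeg T n × η y w)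
    no-hit n le (w , min , y , y∈ , p) =
      miss y (trans (rank-cong (subst (η y) w≡rep p)) (rank-rep i)) (Over-initSeg {T} {L} text n y y∈)
      where
      w≡rep : w ≡ rep i
      w≡rep = minimal-unique {codeSeq (initSeg T n)} {i} min
        (proj₂ (minimal-rep i) (codeSeq (initSeg T n)) (≤-trans le (n≤codeSeq-initSeg T n)))

    hit : ∀ k → k < i → Σ ℕ λ n₀ → ∀ n → n₀ ≤ n → ⟦ hitᶠ ⟧ (codeSeq (initSeg T n) ∷ k ∷ [])
    hit k k<i = combine (minimal-rep k) (stab-eventually (stab-η (rep k) (rep k)) η-refl)
                        (to (text (rep k)) (below (rep k) (subst (_< i) (sym (rank-rep k)) k<i)))
      where
      combine : (Σ ℕ λ t₀ → ∀ t → t₀ ≤ t → Minimal t k (rep k)) →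
                (Σ ℕ λ t₀ → ∀ t → t₀ ≤ t → ⟦ ηˢ ⟧[ t ] (rep k ∷ rep k ∷ [])) →
                (Σ ℕ λ m → T m ≡ just (rep k)) →
                Σ ℕ λ n₀ → ∀ n → n₀ ≤ n → ⟦ hitᶠ ⟧ (codeSeq (initSeg T n) ∷ k ∷ [])
      combine (t₁ , min) (t₂ , self) (m , eq) = (t₁ + t₂) + (suc m + suc (rep k)) , λ n le →
        let κ≥ = ≤-trans le (n≤codeSeq-initSeg T n)
            l₁ = m≤m+n (t₁ + t₂) (suc m + suc (rep k)); l₂ = m≤n+m (suc m + suc (rep k)) (t₁ + t₂) in
        hit-complete (initSeg T n) k {rep k} {rep k} (≤-trans (≤-trans (m≤n+m (suc (rep k)) (suc m)) l₂) κ≥)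
          (min (codeSeq (initSeg T n)) (≤-trans (≤-trans (m≤m+n t₁ t₂) l₁) κ≥))
          (subst (_∈ initSeg T n) eq (∈-initSeg⁺ T (≤-trans (≤-trans (m≤m+n (suc m) (suc (rep k))) l₂) le)))
          (self (codeSeq (initSeg T n)) (≤-trans (≤-trans (m≤n+m t₂ t₁) l₁) κ≥))

    hits : Σ ℕ λ n₀ → ∀ k → k < i → ∀ n → n₀ ≤ n → ⟦ hitᶠ ⟧ (codeSeq (initSeg T n) ∷ k ∷ [])
    hits = bounded-stage {λ k n₀ → ∀ n → n₀ ≤ n → ⟦ hitᶠ ⟧ (codeSeq (initSeg T n) ∷ k ∷ [])}
      (λ le h n le′ → h n (≤-trans le le′)) i hit

  -- The code of the data doubles as the stage. If the gap seems to be even, 2j, the core for the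
  -- apparent first lock is added to the content; an added class needs no search, as the content
  -- will show it.
  guessˢ : Sg 2
  guessˢ = contentˢ ∨ˢ exˢ (exˢ (dec (sub firstLockᶠ (doubleᵗ x₁ ∷ x₂ ∷ x₀ ∷ []) ∧ sub gapᶠ (x₂ ∷ doubleᵗ x₁ ∷ [])) ∧ˢ
    subˢ coreˢ (x₁ ∷ x₀ ∷ x₃ ∷ [])))

  module _ {T : Text} {m : ℕ} (text : IsTextFor T (B m)) where
    private
      κ : ℕ → ℕ
      κ n = codeSeq (initSeg T n)

      Guessed : ℕ → ℕ → Set
      Guessed n = hypothesis η B guessˢ T n

    -- The gap is odd, so in the limit no core is conjectured, and the content suffices for a
    -- finitely generated set.
    invalid-learns : ¬ Valid m → Σ ℕ λ n₀ → ∀ n → n₀ ≤ n → SameSet (closure η (Guessed n)) (B m)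
    invalid-learns ¬valid = combine (B-invalid m ¬valid)
      where
      module _ (t : ℕ) (same : SameSet (B m) (C (target m t))) where
        gap : Σ ℕ λ n₀ → ∀ n → n₀ ≤ n → ⟦ gapᶠ ⟧ (κ n ∷ target m t ∷ [])
        gap = gap-limit {T} {B m} {target m t} text (B-closed m)
          ((λ x r → from (same x) r) , λ x r p → <⇒≢ (to (same x) p) r)

        content : Σ ℕ λ n₀ → ∀ n → n₀ ≤ n → SameSet (closure η (λ z → just z ∈ initSeg T n)) (B m)
        content = eventually-generated {T} {B m} text (B-closed m) (reps (target m t))
          (λ x p → from (same x) (reps⊆C (target m t) x p)) (λ z p → reps-generate (target m t) z (to (same z) p))

        fwd : ∀ n → proj₁ gap ≤ n → ∀ {y} → Guessed n y → B m y
        fwd n le {y} (inj₁ y∈) = Over-initSeg {T} {B m} text n y (Member⇒∈ {initSeg T n} y∈)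
        fwd n le (inj₂ (j′ , c′ , (_ , g) , _)) =
          contradiction (gap-unique {κ n} {j′ + j′} {target m t} g (proj₂ gap n le)) (m+m≢1+n+n j′ (pair m t))

        learns : ∀ n → proj₁ gap + proj₁ content ≤ n → SameSet (closure η (Guessed n)) (B m)
        learns n le z = mk⇔
          (λ (y , h , p) → B-closed m y z (η-sym p) (fwd n (≤-trans (m≤m+n (proj₁ gap) (proj₁ content)) le) h))
          (λ p → let y , y∈ , q = from (proj₂ content n (≤-trans (m≤n+m (proj₁ content) (proj₁ gap)) le) z) p in
                 y , inj₁ (∈⇒Member y∈) , q)

      combine : (Σ ℕ λ t → SameSet (B m) (C (target m t))) →
                Σ ℕ λ n₀ → ∀ n → n₀ ≤ n → SameSet (closure η (Guessed n)) (B m)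
      combine (t , same) = proj₁ (gap t same) + proj₁ (content t same) , learns t same

    module _ (valid : Valid m) where
      private
        I = decodeIndex m

        gap : Σ ℕ λ n₀ → ∀ n → n₀ ≤ n → ⟦ gapᶠ ⟧ (κ n ∷ j I + j I ∷ [])
        gap = gap-limit {T} {B m} {j I + j I} text (B-closed m) (valid-FirstGap m valid)

        lock : Σ ℕ λ t₀ → ∀ t → t₀ ≤ t → ⟦ firstLockᶠ ⟧ (j I + j I ∷ t ∷ c I ∷ [])
        lock = stab-eventually (stab-firstLock (j I + j I) (c I)) (valid-firstLock m valid)

        extra : ∀ β → β ≡ b I → Σ ℕ λ n₀ → ∀ n → n₀ ≤ n → ∀ x → suc x ≡ β → just x ∈ initSeg T n
        extra zero    _  = 0 , λ _ _ _ ()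
        extra (suc x) eq =
          let n₀ , f = eventually-∈ {T} {B m} text (x ∷ [])
                         (λ { .x (here refl) → from (B-valid m valid x) (x , inj₂ eq , η-refl) })
          in n₀ , λ { n le .x refl → f n le x (here refl) }

        n₁ n₂ n₃ : ℕ
        n₁ = proj₁ gap
        n₂ = proj₁ lock
        n₃ = proj₁ (extra (b I) refl)

        fwd : ∀ n → n₁ ≤ n → n₂ ≤ κ n → ∀ y → Guessed n y → B m y
        fwd n le₁ le₂ y (inj₁ y∈) = Over-initSeg {T} {B m} text n y (Member⇒∈ {initSeg T n} y∈)
        fwd n le₁ le₂ y (inj₂ (j′ , c′ , (l , g) , k)) = from (B-valid m valid y) (y , inj₁ core , η-refl)
          where
          j≡ : j′ ≡ j I
          j≡ = m+m-injective {j′} {j I} (gap-unique {κ n} {j′ + j′} {j I + j I} g (proj₂ gap n le₁))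
          c≡ : c′ ≡ c I
          c≡ = firstLockᶠ-unique {j I + j I} {κ n} {c′} {c I}
            (subst (λ i → ⟦ firstLockᶠ ⟧ (i + i ∷ κ n ∷ c′ ∷ [])) j≡ l) (proj₂ lock (κ n) le₂)
          core : Core (j I) (c I) y
          core = subst₂ (λ j c → Core j c y) j≡ c≡ (to (coreˢ-correct j′ c′ y) k)

        bwd : ∀ n → n₁ ≤ n → n₂ ≤ κ n → n₃ ≤ n → ∀ y → Generator (j I) (c I) (b I) y → Guessed n y
        bwd n le₁ le₂ le₃ y (inj₁ k)  =
          inj₂ (j I , c I , (proj₂ lock (κ n) le₂ , proj₂ gap n le₁) , from (coreˢ-correct (j I) (c I) y) k)
        bwd n le₁ le₂ le₃ y (inj₂ eq) = inj₁ (∈⇒Member (proj₂ (extra (b I) refl) n le₃ y eq))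

      -- Gap and first lock converge, which makes the conjectured core right; the added class enters
      -- through the content.
      valid-learns : Σ ℕ λ n₀ → ∀ n → n₀ ≤ n → SameSet (closure η (Guessed n)) (B m)
      valid-learns = (n₁ + n₂) + n₃ , λ n le z →
        let le₁ = ≤-trans (≤-trans (m≤m+n n₁ n₂) (m≤m+n (n₁ + n₂) n₃)) le
            le₂ = ≤-trans (≤-trans (≤-trans (m≤n+m n₂ n₁) (m≤m+n (n₁ + n₂) n₃)) le) (n≤codeSeq-initSeg T n)
            le₃ = ≤-trans (m≤n+m n₃ (n₁ + n₂)) le in
        mk⇔ (λ (y , h , p) → B-closed m y z (η-sym p) (fwd n le₁ le₂ y h))
            (λ p → let y , g , q = to (B-valid m valid z) p in y , bwd n le₁ le₂ le₃ y g , q)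

  B-BC : BCLearnable η B
  B-BC = hypothesisLearner guessˢ , hypothesisLearner-BC η B guessˢ learns
    where
    learns : ∀ m T → IsTextFor T (B m) → Σ ℕ λ n₀ → ∀ n → n₀ ≤ n → SameSet (closure η (hypothesis η B guessˢ T n)) (B m)
    learns m T text with em {Valid m}
    ... | yes valid = valid-learns {T} {m} text valid
    ... | no ¬valid = invalid-learns {T} {m} text ¬valid

  encode-valid : ∀ I → LastChange (Claim I) (s I) → (b I ≢ 0 → ∀ t → ¬ Clash I t) → Valid (encodeIndex I)
  encode-valid I (always , fresh) clash-free t bad =
    refute (subst (λ I → Invalid I t) (decode-encode I) (to (badᶠ-correct t (encodeIndex I)) bad))
    where
    refute : ¬ Invalid I t
    refute (inj₁ (u , _ , u≮s , ¬cl))     = ¬cl (always u (≮⇒≥ u≮s))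
    refute (inj₂ (inj₁ cl))               = fresh cl
    refute (inj₂ (inj₂ (b≢0 , cl)))       = clash-free b≢0 t cl

  encode-B : ∀ I → Valid (encodeIndex I) → SameSet (B (encodeIndex I)) (closure η (Generator (j I) (c I) (b I)))
  encode-B I valid = subst (λ I′ → SameSet (B (encodeIndex I)) (closure η (Generator (j I′) (c I′) (b I′))))
    (decode-encode I) (B-valid (encodeIndex I) valid)

  -- With the true lock the claim stabilises to truth, so its last change supplies the stage
  -- component of a valid index.
  core-index : ∀ {j c} → FirstLock (j + j) c → Σ ℕ λ n → SameSet (B n) (closure η (Core j c))
  core-index {j} {c} lock with lastChange em {Claim (index j c 0 0 0)}
    (stab-× (stab-firstLock (j + j) c) (stab-true (0 , λ _ _ → inj₁ (refl , refl)))) (lock , tt)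
  ... | s , last = encodeIndex I , SameSet-trans (encode-B I (encode-valid I last λ 0≢0 → contradiction refl 0≢0))
    λ z → mk⇔ (λ { (y , inj₁ k , p) → y , k , p }) (λ (y , k , p) → y , inj₁ k , p)
    where
    I = index j c 0 s 0

  extra-index : ∀ {j c p x} → FirstLock (j + j) c → (Σ ℕ λ t₀ → ∀ t → t₀ ≤ t → LastHalt j t p) →
                Least x → ¬ η x (π₁ c) → ¬ closure η (Core j c) x →
                Σ ℕ λ n → SameSet (B n) (λ z → closure η (Core j c) z ⊎ η x z)
  extra-index {j} {c} {p} {x} lock (t₀ , halts) lx avoid new with lastChange em {Claim (index j c p 0 (suc x))}
    (stab-× (stab-firstLock (j + j) c)
      (stab-true (t₀ , λ t le → inj₂ ((λ ()) , from (lastHaltᶠ-correct j t p) (halts t le))))) (lock , tt)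
  ... | s , last = encodeIndex I , SameSet-trans (encode-B I (encode-valid I last λ _ → clash-free))
    λ z → mk⇔ (λ { (y , inj₁ k , q) → inj₁ (y , k , q) ; (.x , inj₂ refl , q) → inj₂ (η-sym q) })
              (λ { (inj₁ (y , k , q)) → y , inj₁ k , q ; (inj₂ q) → x , inj₂ refl , η-sym q })
    where
    I = index j c p s (suc x)
    clash-free : ∀ t → ¬ Clash I t
    clash-free t (inj₁ (u , u<x , q))                = lx u u<x (η-stage {t} {u} {x} q)
    clash-free t (inj₂ (inj₁ q))                     = avoid (η-stage {t} {x} {π₁ c} q)
    clash-free t (inj₂ (inj₂ (z , _ , k , q)))       =
      new (z , to (coreˢ-correct j c z) (stage-sound coreˢ {t} {j ∷ c ∷ z ∷ []} k) , η-sym (η-stage {t} {z} {x} q))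

-- Diagonalisation against vacillatory learners of the second family

module Diagonal (em : ExcludedMiddle 0ℓ) (η : ℕ → ℕ → Set) (pos : Positive η) (M N : Learner)
  (bc-M : BCLearns η M (Finite.F em η pos))
  (vac-M : ∀ i T → IsTextFor T (Finite.F em η pos i) → Σ Seq λ l → ∀ n → 1 ≤ n → run M (initSeg T n) ∈ l)
  (bc-N : BCLearns η N (Family.B em η pos M))
  (vac-N : ∀ i T → IsTextFor T (Family.B em η pos M i) → Σ Seq λ l → ∀ n → 1 ≤ n → run N (initSeg T n) ∈ l)
  where
  open Positive pos using (isEquivalence)
  open IsEquivalence isEquivalence renaming (refl to η-refl; sym to η-sym; trans to η-trans)
  open Rank em η pos
  open Texts em
  open Finite em η pos
  open Locks em η pos M
  open Family em η pos M
  open FamilyBC em η pos M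

  -- For `b = 0` nothing is added, so a single formula expresses both locking on the core and
  -- responding on its enlargements.
  Enlarged : ℕ → ℕ → ℕ → ℕ → Set
  Enlarged j c b y = closure η (Core j c) y ⊎ (Σ ℕ λ x → suc x ≡ b × η x y)

  OverCore : ℕ → ℕ → ℕ → Set
  OverCore σ j c = Over (closure η (Core j c)) (decodeSeq σ)

  RespondsN : ℕ → ℕ → ℕ → ℕ → Set
  RespondsN σ j c b = Responds N (Enlarged j c b) (decodeSeq σ)

  closureˢ : Sg 3
  closureˢ = exˢ (subˢ coreˢ (x₂ ∷ x₃ ∷ x₀ ∷ []) ∧ˢ subˢ ηˢ (x₁ ∷ x₀ ∷ []))

  closureˢ-correct : ∀ y j c → ⟦ closureˢ ⟧ˢ (y ∷ j ∷ c ∷ []) ⇔ closure η (Core j c) y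
  closureˢ-correct y j c = Σ-⇔ λ z → coreˢ-correct j c z ×-⇔ ηˢ-correct y z

  enlargedˢ : Sg 4
  enlargedˢ = subˢ closureˢ (x₀ ∷ x₁ ∷ x₂ ∷ []) ∨ˢ exˢ (dec (sucᵗ x₀ == x₄) ∧ˢ subˢ ηˢ (x₀ ∷ x₁ ∷ []))

  enlargedˢ-correct : ∀ y j c b → ⟦ enlargedˢ ⟧ˢ (y ∷ j ∷ c ∷ b ∷ []) ⇔ Enlarged j c b y
  enlargedˢ-correct y j c b = closureˢ-correct y j c ⊎-⇔ Σ-⇔ λ x → ⇔-id _ ×-⇔ ηˢ-correct x y

  opaque
    overCoreˢ : Sg 3
    overCoreˢ = overˢ closureˢ

    overCoreˢ-correct : ∀ σ j c → ⟦ overCoreˢ ⟧ˢ (σ ∷ j ∷ c ∷ []) ⇔ OverCore σ j c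
    overCoreˢ-correct σ j c = flip _⇔-∘_ raw (mk⇔
      (λ h y p → to (closureˢ-correct y j c) (h y p)) (λ h y p → from (closureˢ-correct y j c) (h y p)))
      where
      raw : ⟦ overˢ closureˢ ⟧ˢ (σ ∷ j ∷ c ∷ []) ⇔ Over (λ y → ⟦ closureˢ ⟧ˢ (y ∷ j ∷ c ∷ [])) (decodeSeq σ)
      raw = subst (λ d → ⟦ overˢ closureˢ ⟧ˢ (d ∷ j ∷ c ∷ []) ⇔ Over (λ y → ⟦ closureˢ ⟧ˢ (y ∷ j ∷ c ∷ [])) (decodeSeq σ))
        (codeSeq-decodeSeq σ) (overˢ-correct closureˢ (decodeSeq σ) (j ∷ c ∷ []))

    respondsNˢ : Sg 4
    respondsNˢ = respondsˢ N enlargedˢ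

    respondsNˢ-correct : ∀ σ j c b → ⟦ respondsNˢ ⟧ˢ (σ ∷ j ∷ c ∷ b ∷ []) ⇔ RespondsN σ j c b
    respondsNˢ-correct σ j c b = flip _⇔-∘_ raw (mk⇔
      (Responds-⊆ {N} (λ y → to (enlargedˢ-correct y j c b))) (Responds-⊆ {N} (λ y → from (enlargedˢ-correct y j c b))))
      where
      raw : ⟦ respondsˢ N enlargedˢ ⟧ˢ (σ ∷ j ∷ c ∷ b ∷ []) ⇔ Responds N (λ y → ⟦ enlargedˢ ⟧ˢ (y ∷ j ∷ c ∷ b ∷ [])) (decodeSeq σ)
      raw = subst (λ d → ⟦ respondsˢ N enlargedˢ ⟧ˢ (d ∷ j ∷ c ∷ b ∷ []) ⇔ Responds N (λ y → ⟦ enlargedˢ ⟧ˢ (y ∷ j ∷ c ∷ b ∷ [])) (decodeSeq σ))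
        (codeSeq-decodeSeq σ) (respondsˢ-correct N enlargedˢ (decodeSeq σ) (j ∷ c ∷ b ∷ []))

  LocksCore : ℕ → ℕ → ℕ → Set
  LocksCore j c σ = OverCore σ j c × ¬ RespondsN σ j c 0

  FirstCoreLock : ℕ → ℕ → ℕ → Set
  FirstCoreLock j c σ = LocksCore j c σ × (∀ τ → τ < σ → ¬ LocksCore j c τ)

  locksCoreᶠ : Fm 4
  locksCoreᶠ = at x₂ overCoreˢ (x₃ ∷ x₀ ∷ x₁ ∷ []) ∧ neg (at x₂ respondsNˢ (x₃ ∷ x₀ ∷ x₁ ∷ lit 0 ∷ []))

  stab-locksCore : ∀ j c σ → Stabilises (λ t → ⟦ locksCoreᶠ ⟧ (j ∷ c ∷ t ∷ σ ∷ [])) (LocksCore j c σ)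
  stab-locksCore j c σ = stab-× (stab-⇔ (overCoreˢ-correct σ j c) (stab-at em overCoreˢ (σ ∷ j ∷ c ∷ [])))
    (stab-¬ (stab-⇔ (respondsNˢ-correct σ j c 0) (stab-at em respondsNˢ (σ ∷ j ∷ c ∷ 0 ∷ []))))

  opaque
    firstCoreLockᶠ : Fm 4
    firstCoreLockᶠ = locksCoreᶠ ∧ all x₃ (neg (sub locksCoreᶠ (x₁ ∷ x₂ ∷ x₃ ∷ x₀ ∷ [])))

    stab-firstCoreLock : ∀ j c σ → Stabilises (λ t → ⟦ firstCoreLockᶠ ⟧ (j ∷ c ∷ t ∷ σ ∷ [])) (FirstCoreLock j c σ)
    stab-firstCoreLock j c σ = stab-× (stab-locksCore j c σ) (stab-all σ (λ τ _ → stab-¬ (stab-locksCore j c τ)))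

    firstCoreLock-unique : ∀ {j c t σ τ} → ⟦ firstCoreLockᶠ ⟧ (j ∷ c ∷ t ∷ σ ∷ []) → ⟦ firstCoreLockᶠ ⟧ (j ∷ c ∷ t ∷ τ ∷ []) → σ ≡ τ
    firstCoreLock-unique {j} {c} {t} = least-unique {λ σ → ⟦ locksCoreᶠ ⟧ (j ∷ c ∷ t ∷ σ ∷ [])}

  firstCoreLock-exists : ∀ {j c} → FirstLock (j + j) c → Σ ℕ (FirstCoreLock j c)
  firstCoreLock-exists {j} {c} lock = minimise (locking N (closure η (Core j c)) vac)
    where
    vac : ∀ T → IsTextFor T (closure η (Core j c)) → Σ Seq λ l → ∀ n → 1 ≤ n → run N (initSeg T n) ∈ l
    vac T text = let n , same = core-index {j} {c} lock in vac-N n T (λ x → text x ⇔-∘ same x)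
    minimise : (Σ Seq λ s → Over (closure η (Core j c)) s × ¬ Responds N (closure η (Core j c)) s) → Σ ℕ (FirstCoreLock j c)
    minimise (s , over , ¬resp) =
      let σ , l , _ , min = least (λ σ → em {LocksCore j c σ}) (codeSeq s) locks in σ , l , min
      where
      locks : LocksCore j c (codeSeq s)
      locks = subst (λ r → Over (closure η (Core j c)) r × ¬ Responds N (Enlarged j c 0) r)
        (codeSeq-injective {s} {decodeSeq (codeSeq s)} (sym (codeSeq-decodeSeq (codeSeq s))))
        (over , λ r → ¬resp (Responds-⊆ {N} (λ { y (inj₁ p) → p }) r))

  -- At stage s, N is seen to abandon its lock on the core of j when shown some x on which M has responded.
  escapeᶠ : Fm 2
  escapeᶠ = ex x₁ (ex x₂ (
    sub firstLockᶠ (doubleᵗ x₂ ∷ x₃ ∷ x₁ ∷ []) ∧ sub firstCoreLockᶠ (x₂ ∷ x₁ ∷ x₃ ∷ x₀ ∷ []) ∧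
    ex x₃ (at x₄ vˢ (x₂ ∷ x₀ ∷ []) ∧ at x₄ respondsNˢ (x₁ ∷ x₃ ∷ x₂ ∷ sucᵗ x₀ ∷ []))))

  Escape : ℕ → ℕ → Set
  Escape j s = Σ ℕ λ c → c < s × Σ ℕ λ σ → σ < s × ⟦ firstLockᶠ ⟧ (j + j ∷ s ∷ c ∷ []) × ⟦ firstCoreLockᶠ ⟧ (j ∷ c ∷ s ∷ σ ∷ []) ×
    (Σ ℕ λ x → x < s × ⟦ vˢ ⟧[ s ] (c ∷ x ∷ []) × ⟦ respondsNˢ ⟧[ s ] (σ ∷ j ∷ c ∷ suc x ∷ []))

  opaque
    -- `escapeᶠ` is decidable with `j` as a variable, reaching the `j`-th function through the
    -- universal formula inside `coreˢ`. The code of its characteristic function, in which 0 means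
    -- truth, is then applied to itself.
    self : Σ ℕ λ e → ∀ s → Halts e s ⇔ Escape e s
    self = e , λ s → mk⇔
      (λ h → to (χ≡0⇔ escapeᶠ (e ∷ s ∷ [])) (Eval-deterministic (proj₂ (codeFm escapeᶠ) (e ∷ s ∷ [])) h))
      (λ p → subst (Eval e (enc (e ∷ s ∷ []))) (from (χ≡0⇔ escapeᶠ (e ∷ s ∷ [])) p) (proj₂ (codeFm escapeᶠ) (e ∷ s ∷ [])))
      where
      e : ℕ
      e = proj₁ (codeFm escapeᶠ)

  e : ℕ
  e = proj₁ self

  module _ {c σ : ℕ} (lock : FirstLock (e + e) c) (coreLock : FirstCoreLock e c σ) where
    private
      w = π₁ c

    settled : Σ ℕ λ t₀ → ∀ t → t₀ ≤ t → ⟦ firstLockᶠ ⟧ (e + e ∷ t ∷ c ∷ []) × ⟦ firstCoreLockᶠ ⟧ (e ∷ c ∷ t ∷ σ ∷ [])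
    settled = stab-eventually (stab-× (stab-firstLock (e + e) c) (stab-firstCoreLock e c σ)) (lock , coreLock)

    -- If e halts at infinitely many stages then the core contains every point on which M responds.
    finitely-often : Σ ℕ λ n → ∀ s → n ≤ s → ¬ Halts e s
    finitely-often with em {Σ ℕ λ n → ∀ s → n ≤ s → ¬ Halts e s}
    ... | yes fin = fin
    ... | no inf  = contradiction (to (proj₂ self s) halts) no-escape
      where
      recurrent : ∀ n → Σ ℕ λ s → n ≤ s × Halts e s
      recurrent n with em {Σ ℕ λ s → n ≤ s × Halts e s}
      ... | yes p = p
      ... | no ¬p = contradiction (n , λ s n≤s h → ¬p (s , n≤s , h)) inf
      s : ℕ
      s = proj₁ (recurrent (proj₁ settled))
      halts : Halts e s
      halts = proj₂ (proj₂ (recurrent (proj₁ settled)))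
      at-s : ⟦ firstLockᶠ ⟧ (e + e ∷ s ∷ c ∷ []) × ⟦ firstCoreLockᶠ ⟧ (e ∷ c ∷ s ∷ σ ∷ [])
      at-s = proj₂ settled s (proj₁ (proj₂ (recurrent (proj₁ settled))))
      core : ∀ {x} → V c x → Core e c x
      -- A halting stage beyond `x` releases `x` into the core.
      core {x} v = let s , x≤s , h = recurrent x in inj₂ (v , s , s≤s x≤s , h)
      absorb : ∀ {x} → V c x → ∀ y → Enlarged e c (suc x) y → Enlarged e c 0 y
      absorb v y (inj₁ p)             = inj₁ p
      absorb {x} v y (inj₂ (.x , refl , p)) = inj₁ (x , core v , η-sym p)
      refute : ∀ {c′ σ′} → c′ ≡ c → σ′ ≡ σ → ∀ {x} → V c′ x → RespondsN σ′ e c′ (suc x) → ⊥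
      -- Adding a point of `V` no longer enlarges the core, so the response would already occur on
      -- the core, where `σ` is a lock.
      refute refl refl v r = proj₂ (proj₁ coreLock) (Responds-⊆ {N} (absorb v) r)
      no-escape : ¬ Escape e s
      no-escape (c′ , _ , σ′ , _ , l , l′ , x , _ , v , r) = refute c≡ σ≡
        (to (vˢ-correct c′ x) (stage-sound vˢ {s} {c′ ∷ x ∷ []} v))
        (to (respondsNˢ-correct σ′ e c′ (suc x)) (stage-sound respondsNˢ {s} {σ′ ∷ e ∷ c′ ∷ suc x ∷ []} r))
        where
        c≡ : c′ ≡ c
        c≡ = firstLockᶠ-unique {e + e} {s} {c′} {c} l (proj₁ at-s)
        σ≡ : σ′ ≡ σ
        σ≡ = firstCoreLock-unique {e} {c} {s} {σ′} {σ} (subst (λ d → ⟦ firstCoreLockᶠ ⟧ (e ∷ d ∷ s ∷ σ′ ∷ [])) c≡ l′) (proj₂ at-s)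

    module _ (n : ℕ) (never : ∀ s → n ≤ s → ¬ Halts e s) where
      -- Above 2e, the rank of `w` and the bound on the initial classes, and above `n`, which bounds
      -- the points released by halting.
      r₀ : ℕ
      r₀ = suc (e + e + n)

      core-bounded : ∀ {y} → Core e c y → rank y < r₀
      core-bounded (inj₁ r) = <-≤-trans r (≤-trans (m≤m+n (e + e) n) (n≤1+n _))
      core-bounded {y} (inj₂ (_ , s , y≤s , h)) = s≤s (≤-trans (rank≤ y) (≤-trans (s≤s⁻¹ y≤s)
        (≤-trans (<⇒≤ (≰⇒> λ n≤s → never s n≤s h)) (m≤n+m n (e + e)))))

      closure-bounded : ∀ y → closure η (Core e c) y → rank y < r₀
      closure-bounded y (z , k , p) = subst (_< r₀) (sym (rank-cong p)) (core-bounded k)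

      -- `F-responds` yields points of `V` of large rank, and each is replaced by its least
      -- equivalent. Its rank keeps it out of the core and of the class of `w`; as halting is
      -- finite, adding its class gives a member of `B`.
      candidates : ∀ r → r₀ ≤ r → Σ ℕ λ x → r ≤ rank x × V c x ×
                   Σ ℕ λ m → SameSet (B m) (λ z → closure η (Core e c) z ⊎ η x z)
      candidates r r₀≤r = build (F-responds M bc-M vac-M {w} {decodeSeq (π₂ c)} (proj₁ (proj₁ lock))
        (proj₁ (proj₂ (proj₂ (proj₁ lock)))) r (subst (_< r) (sym (rank-lock lock)) (<-≤-trans (s≤s (m≤m+n (e + e) n)) r₀≤r)))
        where
        limit : Σ ℕ λ p → Σ ℕ λ t₀ → ∀ t → t₀ ≤ t → LastHalt e t p
        limit = lastHalt-limit em e n never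
        build : (Σ ℕ λ x → r ≤ rank x × V c x) → Σ ℕ λ x → r ≤ rank x × V c x ×
                Σ ℕ λ m → SameSet (B m) (λ z → closure η (Core e c) z ⊎ η x z)
        build (x , r≤ , v) = u , r≤u , V-cong {c} (η-sym u~x) v ,
          extra-index {e} {c} {proj₁ limit} {u} lock (proj₂ limit) (proj₂ (proj₂ (proj₂ (leastRep x))))
            (λ p → <⇒≢ (<-≤-trans (s≤s (m≤m+n (e + e) n)) (≤-trans r₀≤r r≤u)) (sym (trans (rank-cong p) (rank-lock lock))))
            (λ k → <⇒≱ (closure-bounded u k) (≤-trans r₀≤r r≤u))
          where
          u : ℕ
          u = proj₁ (leastRep x)
          u~x : η u x
          u~x = proj₁ (proj₂ (leastRep x))
          r≤u : r ≤ rank u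
          r≤u = subst (r ≤_) (sym (rank-cong u~x)) r≤

      responding : Σ ℕ λ x → r₀ ≤ rank x × V c x × Responds N (λ z → closure η (Core e c) z ⊎ η x z) (decodeSeq σ)
      responding = Respond.respond em η pos {N} {B} bc-N {closure η (Core e c)} {decodeSeq σ}
        (proj₁ (proj₁ coreLock)) r₀ closure-bounded {V c} candidates

      escape : Σ ℕ λ x → V c x × RespondsN σ e c (suc x)
      escape = enlarge responding
        where
        enlarge : (Σ ℕ λ x → r₀ ≤ rank x × V c x × Responds N (λ z → closure η (Core e c) z ⊎ η x z) (decodeSeq σ)) →
                  Σ ℕ λ x → V c x × RespondsN σ e c (suc x)
        enlarge (x , _ , v , r) = x , v , Responds-⊆ {N} (λ { y (inj₁ p) → inj₁ p ; y (inj₂ p) → inj₂ (x , refl , p) }) r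

      -- The response of `N` on an enlarged core is seen at all late stages, together with the
      -- settled locks. Hence `e` halts at late stages, against `never`.
      absurd : ⊥
      absurd = finish escape
        where
        finish : (Σ ℕ λ x → V c x × RespondsN σ e c (suc x)) → ⊥
        finish (x , v , r) = conclude (stab-×
            -- `Escape` bounds its witnesses by the stage, so the stage has to exceed `c`, `σ` and
            -- `x`.
            (stab-× (stab-true (suc c , λ _ → id)) (stab-× (stab-true (suc σ , λ _ → id)) (stab-true (suc x , λ _ → id))))
            (stab-× (stab-× (stab-firstLock (e + e) c) (stab-firstCoreLock e c σ))
                    (stab-× (stab-⇔ (vˢ-correct c x) (stab-at em vˢ (c ∷ x ∷ [])))
                            (stab-⇔ (respondsNˢ-correct σ e c (suc x)) (stab-at em respondsNˢ (σ ∷ e ∷ c ∷ suc x ∷ []))))))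
          where
          Facts : ℕ → Set
          Facts t = (c < t × (σ < t × x < t)) ×
            ((⟦ firstLockᶠ ⟧ (e + e ∷ t ∷ c ∷ []) × ⟦ firstCoreLockᶠ ⟧ (e ∷ c ∷ t ∷ σ ∷ [])) ×
             (⟦ vˢ ⟧[ t ] (c ∷ x ∷ []) × ⟦ respondsNˢ ⟧[ t ] (σ ∷ e ∷ c ∷ suc x ∷ [])))
          conclude : Stabilises Facts ((⊤ × (⊤ × ⊤)) × ((FirstLock (e + e) c × FirstCoreLock e c σ) × (V c x × RespondsN σ e c (suc x)))) → ⊥
          conclude (t₀ , f) = late (t₀ + n) (m≤n+m n t₀) (from (f (t₀ + n) (m≤m+n t₀ n)) ((tt , (tt , tt)) , ((lock , coreLock) , (v , r))))
            where
            late : ∀ t → n ≤ t → Facts t → ⊥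
            late t n≤t ((c< , (σ< , x<)) , ((l , l′) , (vₜ , rₜ))) =
              never t n≤t (from (proj₂ self t) (c , c< , σ , σ< , l , l′ , x , x< , vₜ , rₜ))

  contradictory : ⊥
  contradictory = from-locks (firstLock-exists (λ {w} → F-locking M bc-M vac-M {w}) (e + e))
    where
    from-locks : Σ ℕ (FirstLock (e + e)) → ⊥
    from-locks (c , lock) =
      let σ , coreLock = firstCoreLock-exists {e} {c} lock
          n , never    = finitely-often {c} {σ} lock coreLock
      in absurd {c} {σ} lock coreLock n never

theorem4 : ExcludedMiddle 0ℓ → (η : ℕ → ℕ → Set) → Positive η →
    Σ (ℕ → ℕ → Set) (λ B → EtaFamily η B × BCLearnable η B × ¬ VacLearnable η B)
theorem4 em η pos with em {VacLearnable η (Finite.F em η pos)}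
... | no ¬vac = Finite.F em η pos , Finite.F-family em η pos , Finite.F-BC em η pos , ¬vac
... | yes (M , bc-M , vac-M) = Family.B em η pos M , Family.B-family em η pos M , FamilyBC.B-BC em η pos M ,
  λ (N , bc-N , vac-N) → Diagonal.contradictory em η pos M N bc-M vac-M bc-N vac-N
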